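{- Let $\varphi:\mathbb{R}^2\to\mathbb{R}$ be a conewise linear function. Then the canonical representation of $\varphi$ is minimal with respect to monomial complexity $\mathrm{mComp}$.
   Context: Tropical operations: $a\oplus b=\max\{a,b\}$, $a\odot b=a+b$, $a\oslash b=a-b$. A tropical polynomial on $\mathbb{R}^d$ is a function $g(x)=\max_{1\le i\le n}(\langle b_i,x\rangle+a_i)$ with $a_i\in\mathbb{R}$ and arbitrary exponents $b_i\in\mathbb{R}^d$. A tropical rational function (equivalently a continuous piecewise-linear function with finitely many pieces) is $\varphi=g\oslash h=g-h$ with $g,h$ tropical polynomials; the pair $(g,h)$ is called a representation of $\varphi$. "Linear" means affine-linear. A function is conewise linear if there are a point $\tau$ and finitely many polyhedral cones with common apex $\tau$ covering the space, such that the (continuous) function is linear on each cone. $\mathrm{mComp}(g)$ is the number of linear regions of the tropical polynomial $g$, i.e. the number of connected components of $\mathbb{R}^d\setminus\mathcal{V}(g)$, where $\mathcal{V}(\varphi)=\{x:\varphi\text{ is not linear in any neighbourhood of }x\}$. $\mathcal{V}(\varphi)$ is a pure $(d-1)$-dimensional polyhedral complex with weights: if the $(d-1)$-face $\sigma$ separates linear regions with gradients $u_1,u_2$, then $w_\varphi(\sigma)=\|u_1-u_2\|$ if $\varphi$ is locally convex along $\sigma$ and $-\|u_1-u_2\|$ if $\varphi$ is locally concave along $\sigma$. $\mathcal{V}(\varphi)_+$ (resp. $\mathcal{V}(\varphi)_-$) is the subcomplex of faces of positive (resp. negative) weight, i.e. the closure of the set of points near which $\varphi$ is strictly (i.e.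 non-linearly) convex (resp. concave), with weights $|w_\varphi|$. For a tropical polynomial $g$, $\mathcal{V}(g)$ with its weights determines $g$ up to addition of a linear function, and a nonnegatively weighted pure $(d-1)$-dimensional complex is of the form $\mathcal{V}(g)$ iff it is balanced. Canonical representation: let $\varphi:\mathbb{R}^2\to\mathbb{R}$ be conewise linear with apex $\tau$. $\mathcal{V}(\varphi)_+$ consists of rays $\gamma_1,\dots,\gamma_n$ from $\tau$; let $v_i$ be the vector generating $\gamma_i$ whose norm is the weight of $\gamma_i$ in $\mathcal{V}(\varphi)_+$. Put $v_{n+1}=-\sum_{i=1}^n v_i$. If $v_{n+1}\ne0$ let $\gamma_{n+1}$ be the ray from $\tau$ generated by $v_{n+1}$ with weight $\|v_{n+1}\|$; if $v_{n+1}=0$ let $\gamma_{n+1}$ be empty. Let $X$ be the weighted complex consisting of $\mathcal{V}(\varphi)_+$ and $\gamma_{n+1}$, and $Y$ the one consisting of $\mathcal{V}(\varphi)_-$ and $\gamma_{n+1}$ (weights add where rays coincide). Both are balanced (the weighted sum of unit generators of the rays is $0$), so there are tropical polynomials $g,h$ with $\mathcal{V}(g)=X$, $\mathcal{V}(h)=Y$ and $\varphi=g\oslash h$ (unique up to adding the same linear function to $g$ and $h$). This $g\oslash h$ is the canonical representation of $\varphi$. Minimality: on representations of $\varphi$ put the preorder $g_1\oslash h_1\prec g_2\oslash h_2$ iff $\mathrm{mComp}(g_1)\le\mathrm{mComp}(g_2)$ and $\mathrm{mComp}(h_1)\le\mathrm{mComp}(h_2)$. A representation $g\oslash h$ is minimal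 if there is no representation $g'\oslash h'$ of $\varphi$ with $\mathrm{mComp}(g')\le\mathrm{mComp}(g)$ and $\mathrm{mComp}(h')\le\mathrm{mComp}(h)$ in which at least one inequality is strict. -}

module Defs where

open import Level using (0ℓ)
open import Algebra.Bundles using (CommutativeRing)
open import Data.Fin.Base using (Fin)
open import Data.List.Base using (List; []; _∷_; _∷ʳ_; foldr)
open import Data.List.NonEmpty.Base as List⁺ using (List⁺)
open import Data.List.Relation.Unary.All using (All)
open import Data.List.Relation.Unary.AllPairs using (AllPairs)
open import Data.List.Relation.Unary.Any using (Any)
open import Data.Nat.Base as ℕ using (ℕ)
open import Data.Product.Base using (∃; ∃-syntax; _×_)
open import Data.Sum.Base using (_⊎_)
open import Data.Vec.Functional using (Vector)
open import Relation.Binary.Bundles using (TotalOrder)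
open import Relation.Binary.Core using (Rel)
open import Relation.Binary.PropositionalEquality.Core using (_≡_)
open import Relation.Binary.Structures using (IsTotalOrder)
open import Relation.Nullary.Negation.Core using (¬_)
open import Relation.Unary using (Pred; _∈_; _⊆_; _∪_; _∩_; _≐_; ∁; Satisfiable)

-- The standard library has no type of real numbers.  Classically, a
-- Dedekind-complete ordered field is unique up to a unique isomorphism, so
-- quantifying over all of them amounts to working with ℝ.
record CompleteOrderedField : Set₁ where
  field
    commutativeRing : CommutativeRing 0ℓ 0ℓ
  open CommutativeRing commutativeRing public
  infix 4 _≤_
  field
    _≤_          : Rel Carrier 0ℓ
    isTotalOrder : IsTotalOrder _≈_ _≤_
    +-monoʳ-≤    : ∀ x {y z} → y ≤ z → x + y ≤ x + z
    *-nonNeg     : ∀ {x y} → 0# ≤ x → 0# ≤ y → 0# ≤ x * y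
    0≉1          : ¬ (0# ≈ 1#)
    inverse      : ∀ x → ¬ (x ≈ 0#) → ∃[ y ] x * y ≈ 1#

  UpperBound : Pred Carrier 0ℓ → Pred Carrier 0ℓ
  UpperBound P b = ∀ x → x ∈ P → x ≤ b

  field
    supremum : (P : Pred Carrier 0ℓ) → Satisfiable P → Satisfiable (UpperBound P) →
               ∃[ s ] s ∈ UpperBound P × (∀ b → b ∈ UpperBound P → s ≤ b)

  totalOrder : TotalOrder 0ℓ 0ℓ 0ℓ
  totalOrder = record { isTotalOrder = isTotalOrder }

module PiecewiseLinear (ℝ : CompleteOrderedField) where
  open CompleteOrderedField ℝ
  open import Algebra.Construct.NaturalChoice.Max totalOrder using (_⊔_)
  open import Algebra.Properties.CommutativeMonoid.Sum +-commutativeMonoid using (sum)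
  open import Data.Vec.Functional.Relation.Binary.Equality.Setoid setoid using (_≋_)
  open import Relation.Binary.Construct.NonStrictToStrict _≈_ _≤_ using (_<_)

  Point : ℕ → Set
  Point d = Vector Carrier d

  -- Functions are not required to preserve _≋_: every function the
  -- definitions below single out does so anyway.
  Fun : ℕ → Set
  Fun d = Point d → Carrier

  private variable d : ℕ

  infixl 6 _+ᵥ_ _-ᵥ_
  infixr 7 _•_

  0ᵥ : Point d
  0ᵥ _ = 0#

  _+ᵥ_ _-ᵥ_ : Point d → Point d → Point d
  (x +ᵥ y) i = x i + y i
  (x -ᵥ y) i = x i - y i

  -ᵥ_ : Point d → Point d
  (-ᵥ x) i = - x i

  _•_ : Carrier → Point d → Point d
  (t • x) i = t * x i

  ⟨_,_⟩ : Point d → Point d → Carrier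
  ⟨ x , y ⟩ = sum λ i → x i * y i

  IsNorm : Point d → Carrier → Set
  IsNorm x r = 0# ≤ r × r * r ≈ ⟨ x , x ⟩

  negate : Fun d → Fun d
  negate φ x = - φ x

  Ball : Point d → Carrier → Pred (Point d) 0ℓ
  Ball x r y = ⟨ y -ᵥ x , y -ᵥ x ⟩ < r * r

  Near : Point d → (Pred (Point d) 0ℓ → Set) → Set
  Near x P = ∃[ r ] 0# < r × P (Ball x r)

  Open : Pred (Pred (Point d) 0ℓ) 0ℓ
  Open U = ∀ x → x ∈ U → Near x (_⊆ U)

  Closure : Pred (Point d) 0ℓ → Pred (Point d) 0ℓ
  Closure A x = ∀ r → 0# < r → Satisfiable (Ball x r ∩ A)

  Continuous : Fun d → Set
  Continuous φ = ∀ x ε → 0# < ε →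
    Near x λ B → ∀ y → y ∈ B → (φ y - φ x < ε) × (φ x - φ y < ε)

  Connected : Pred (Point d) 0ℓ → Set₁
  Connected A = ∀ U V → Open U → Open V → A ⊆ U ∪ V →
    Satisfiable (A ∩ U) → Satisfiable (A ∩ V) → Satisfiable (A ∩ (U ∩ V))

  SameComponent : Pred (Point d) 0ℓ → Point d → Point d → Set₁
  SameComponent A x y = ∃[ S ] Connected S × S ⊆ A × x ∈ S × y ∈ S

  record NumberOfComponents (A : Pred (Point d) 0ℓ) (k : ℕ) : Set₁ where
    field
      representative : Fin k → Point d
      inside         : ∀ i → representative i ∈ A
      exhaustive     : ∀ x → x ∈ A → ∃[ i ] SameComponent A (representative i) x
      distinct       : ∀ i j → SameComponent A (representative i) (representative j) → i ≡ j

  record Affine (d : ℕ) : Set where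
    constructor affine
    field
      slope    : Point d
      constant : Carrier

    eval : Fun d
    eval x = ⟨ slope , x ⟩ + constant

  open Affine public

  LinearOn : Pred (Point d) 0ℓ → Fun d → Set
  LinearOn A φ = ∃[ ℓ ] (∀ x → x ∈ A → φ x ≈ eval ℓ x)

  TropicalPolynomial : ℕ → Set
  TropicalPolynomial d = List⁺ (Affine d)

  ⟦_⟧ : TropicalPolynomial d → Fun d
  ⟦ g ⟧ x = List⁺.foldr₁ _⊔_ (List⁺.map (λ ℓ → eval ℓ x) g)

  Represents : Fun d → TropicalPolynomial d → TropicalPolynomial d → Set
  Represents φ g h = ∀ x → φ x ≈ ⟦ g ⟧ x - ⟦ h ⟧ x

  -- A list of inner normals describes a polyhedral cone with a given apex.
  Cone : Point d → List (Point d) → Pred (Point d) 0ℓ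
  Cone τ normals x = All (λ n → 0# ≤ ⟨ n , x -ᵥ τ ⟩) normals

  record ConewiseLinear (φ : Fun d) (τ : Point d) : Set where
    field
      continuous : Continuous φ
      cones      : List (List (Point d))
      covering   : ∀ x → Any (λ C → x ∈ Cone τ C) cones
      linear     : All (λ C → LinearOn (Cone τ C) φ) cones

  𝒱 : Fun d → Pred (Point d) 0ℓ
  𝒱 φ x = ¬ Near x (λ B → LinearOn B φ)

  -- mComp φ k means that φ has exactly k linear regions.
  mComp : Fun d → ℕ → Set₁
  mComp φ k = NumberOfComponents (∁ (𝒱 φ)) k

  ConvexOn : Pred (Point d) 0ℓ → Fun d → Set
  ConvexOn A φ = ∀ x y s t → x ∈ A → y ∈ A → 0# ≤ s → 0# ≤ t → s + t ≈ 1# →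
    φ (s • x +ᵥ t • y) ≤ s * φ x + t * φ y

  LocallyConvex LocallyConcave : Fun d → Pred (Point d) 0ℓ
  LocallyConvex  φ x = Near x λ B → ConvexOn B φ
  LocallyConcave φ x = LocallyConvex (negate φ) x

  -- x lies in the relative interior of a (d-1)-face separating linear regions
  -- with gradients u₁ and u₂.
  Separates : Fun d → Point d → Point d → Point d → Set
  Separates φ x u₁ u₂ =
    ¬ (u₁ ≋ u₂) ×
    (∃[ n ] ∃[ a₁ ] ∃[ a₂ ] ¬ (n ≋ 0ᵥ) × Near x λ B → ∀ y → y ∈ B →
      (0# ≤ ⟨ n , y -ᵥ x ⟩ → φ y ≈ eval (affine u₁ a₁) y) ×
      (⟨ n , y -ᵥ x ⟩ ≤ 0# → φ y ≈ eval (affine u₂ a₂) y))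

  -- Weight φ x w means that w_φ(σ) = w for the (d-1)-face σ of 𝒱(φ) whose
  -- relative interior contains x.
  Weight : Fun d → Point d → Carrier → Set
  Weight φ x w = ∃[ u₁ ] ∃[ u₂ ] Separates φ x u₁ u₂ ×
    ( LocallyConvex  φ x × IsNorm (u₁ -ᵥ u₂) w
    ⊎ LocallyConcave φ x × IsNorm (u₁ -ᵥ u₂) (- w))

  -- Weights are recorded at points in the relative interiors of faces.
  record WeightedComplex (d : ℕ) : Set₁ where
    field
      support : Pred (Point d) 0ℓ
      weight  : Point d → Carrier → Set

  𝒱ʷ 𝒱₊ 𝒱₋ : Fun d → WeightedComplex d
  𝒱ʷ φ = record
    { support = 𝒱 φ
    ; weight  = Weight φ
    }
  𝒱₊ φ = record
    { support = Closure (LocallyConvex φ ∩ 𝒱 φ)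
    ; weight  = λ x w → 0# < w × Weight φ x w
    }
  𝒱₋ φ = record
    { support = Closure (LocallyConcave φ ∩ 𝒱 φ)
    ; weight  = λ x w → 0# < w × Weight φ x (- w)
    }

  -- The ray from τ generated by v; empty if v is zero.
  Ray : Point d → Point d → Pred (Point d) 0ℓ
  Ray τ v x = ¬ (v ≋ 0ᵥ) × (∃[ t ] 0# ≤ t × x ≋ τ +ᵥ t • v)

  -- A list of vectors stands for the weighted fan with apex τ in which each
  -- nonzero vector v contributes Ray τ v with weight ‖v‖.
  Fan : ℕ → Set
  Fan d = List (Point d)

  ∣_∣[_] : Fan d → Point d → Pred (Point d) 0ℓ
  ∣ vs ∣[ τ ] x = Any (λ v → x ∈ Ray τ v) vs

  data FanWeight (τ x : Point d) : Fan d → Carrier → Set where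
    []   : FanWeight τ x [] 0#
    hit  : ∀ {v vs r w} → x ∈ Ray τ v → IsNorm v r →
           FanWeight τ x vs w → FanWeight τ x (v ∷ vs) (r + w)
    miss : ∀ {v vs w} → ¬ (x ∈ Ray τ v) →
           FanWeight τ x vs w → FanWeight τ x (v ∷ vs) w

  -- The apex is excluded because it is not in the relative interior of a ray.
  record EqualsFan (C : WeightedComplex d) (τ : Point d) (vs : Fan d) : Set where
    open WeightedComplex C
    field
      supports : support ≐ ∣ vs ∣[ τ ]
      weights  : ∀ x → x ∈ support → ¬ (x ≋ τ) → ∃[ w ] FanWeight τ x vs w × weight x w

  SameDirection : Point d → Point d → Set
  SameDirection u v = ∃[ t ] 0# < t × u ≋ t • v

  record HasRays (C : WeightedComplex d) (τ : Point d) (vs : Fan d) : Set where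
    field
      nonzero   : All (λ v → ¬ (v ≋ 0ᵥ)) vs
      distinct  : AllPairs (λ u v → ¬ SameDirection u v) vs
      equalsFan : EqualsFan C τ vs

  balancing : Fan d → Point d
  balancing vs = -ᵥ foldr _+ᵥ_ 0ᵥ vs

  record Canonical (φ : Fun 2) (τ : Point 2) (g h : TropicalPolynomial 2) : Set where
    field
      vs us       : Fan 2
      𝒱₊-rays     : HasRays (𝒱₊ φ) τ vs
      𝒱₋-rays     : HasRays (𝒱₋ φ) τ us
      numerator   : EqualsFan (𝒱ʷ ⟦ g ⟧) τ (vs ∷ʳ balancing vs)
      denominator : EqualsFan (𝒱ʷ ⟦ h ⟧) τ (us ∷ʳ balancing vs)
      represents  : Represents φ g h

  record Minimal (φ : Fun d) (g h : TropicalPolynomial d) : Set₁ where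
    field
      represents : Represents φ g h
      m n        : ℕ
      mComp-g    : mComp ⟦ g ⟧ m
      mComp-h    : mComp ⟦ h ⟧ n
      minimal    : ∀ g′ h′ → Represents φ g′ h′ →
                   ∀ m′ n′ → mComp ⟦ g′ ⟧ m′ → mComp ⟦ h′ ⟧ n′ →
                   m′ ℕ.≤ m → n′ ℕ.≤ n → ¬ (m′ ℕ.< m ⊎ n′ ℕ.< n)

{-# OPTIONS --safe #-}

-- Pass to infinity: every tropical polynomial g has a recession function g ∞,
-- the support function of its Newton polygon, and two representations
-- φ = g - h = g′ - h′ satisfy g ∞ + h′ ∞ = g′ ∞ + h ∞.  The edges of the Newton
-- polygon of g are the rays of 𝒱 (g ∞); they inject into its vertices, which
-- are gradients of g, so mComp g′ is at least the number of rays of g′ ∞.  For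
-- the canonical g every linear region is unbounded, whence equality (if there
-- are at least two regions).
--
-- Edge lengths are additive, so g and h have a common ray at most in the
-- balancing direction d, and the lengths in g′ ∞ and g ∞ differ only in d and in
-- the common rays of g′ and h′.  If g′ has fewer regions than g and h′ no more
-- than h, then d is not a ray of g′ and counting leaves at most one common ray
-- d′ of g′ and h′.  Now g′ ∞ - g ∞ is linear off the two rays d and d′, strictly
-- concave along d and convex along d′, which the balancing condition forbids.
module Submission where

open import Defs
open import Axiom.ExcludedMiddle using (ExcludedMiddle)
open import Algebra.Solver.Ring.AlmostCommutativeRing using
  (fromCommutativeRing; _-Raw-AlmostCommutative⟶_)
open import Data.Bool.Base using (Bool; T)
open import Data.Empty using (⊥; ⊥-elim)
open import Data.Fin.Base using (Fin; zero; suc)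
open import Data.Fin.Patterns using (0F; 1F)
open import Data.Integer.Base as ℤ using (ℤ; +_; -[1+_])
open import Data.List.Base as List using (List; []; _∷_; _∷ʳ_; length)
open import Data.List.Membership.Propositional using () renaming (_∈_ to _∈ₗ_)
open import Data.List.NonEmpty.Base as List⁺ using (List⁺; _∷_)
open import Data.List.Relation.Unary.All as All using (All; []; _∷_)
open import Data.List.Relation.Unary.All.Properties using (¬Any⇒All¬)
open import Data.List.Relation.Unary.AllPairs using (AllPairs; []; _∷_)
open import Data.List.Relation.Unary.Any as Any using (Any; here; there)
open import Data.Maybe.Base using (Maybe; is-just; just; nothing)
open import Data.Nat.Base as ℕ using (ℕ; suc)
open import Data.Product.Base using (∃-syntax; _×_; _,_; proj₁; proj₂)
open import Data.Sum.Base using (_⊎_; inj₁; inj₂)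
open import Data.Vec.N-ary using (N-ary; Eq; curryⁿ; curryⁿ-cong)
open import Function.Base using (_∘_)
open import Level using (0ℓ)
open import Relation.Binary.PropositionalEquality.Core as ≡ using (_≡_)
open import Relation.Binary.Structures using (IsTotalOrder)
open import Relation.Nullary.Decidable.Core using (yes; no)
open import Relation.Nullary.Negation.Core using (¬_)
open import Relation.Unary using (Pred; _∈_; _⊆_; _∪_; _∩_; ∁; Satisfiable)
import Algebra.Properties.Ring
import Algebra.Properties.Semiring.Mult.TCOptimised
import Algebra.Solver.Ring
import Data.Fin.Properties as Finₚ
import Data.Integer.Properties as ℤₚ
import Data.List.Membership.Propositional.Properties as ∈ₚ
import Data.List.Relation.Unary.Any.Properties as Anyₚ
import Data.Nat.Properties as ℕₚ
import Relation.Binary.Reflection as Reflection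

-- In every direction, the edge length of the numerator minus that of the denominator is the same
-- for all representations. Where g and h have no common ray, their two lengths are the positive and
-- the negative part of this difference, so g′ and h′ must have every ray that g and h have there.
-- Only in the direction d can a competitor save a ray, and this single unit is all the slack in the
-- count.
--
-- A competitor may have bounded regions, so its rays only bound the number of its regions from
-- below. This is enough: the exact count is needed for g and h alone.
--
-- The contradiction at the end is one of signs. Two rays with weights of opposite sign balance only
-- if they point in the same direction. If g′ and h′ have no common ray at all, the weight along d
-- stands alone and balances even less.
--
-- Lengths are read off from one-sided gradients next to a direction, so that neither polygons nor
-- their Minkowski sums have to be constructed.

module _ (em : ∀ {ℓ} → ExcludedMiddle ℓ) (ℝ : CompleteOrderedField) where

  open CompleteOrderedField ℝ hiding (zero)
  open PiecewiseLinear ℝ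
  open import Algebra.Construct.NaturalChoice.Max totalOrder using
    (_⊔_; x≤x⊔y; x≤y⊔x; ⊔-sel; x≤y⇒x⊔y≈y; x≤y⇒y⊔x≈y)
  open import Data.Vec.Functional.Relation.Binary.Equality.Setoid setoid using
    (_≋_; ≋-refl; ≋-reflexive; ≋-sym; ≋-trans)
  open import Relation.Binary.Construct.NonStrictToStrict _≈_ _≤_ using (_<_)
  open import Relation.Binary.Reasoning.Setoid setoid
  module Order = IsTotalOrder isTotalOrder
  module R = Algebra.Properties.Ring ring
  module M = Algebra.Properties.Semiring.Mult.TCOptimised semiring

  -- A ring solver with integer coefficients.

  private
    ⟦_⟧ℤ : ℤ → Carrier
    ⟦ + n ⟧ℤ      = n M.× 1#
    ⟦ -[1+ n ] ⟧ℤ = - (suc n M.× 1#)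

    ⟦-⟧-homo : ∀ i → ⟦ ℤ.- i ⟧ℤ ≈ - ⟦ i ⟧ℤ
    ⟦-⟧-homo (+ 0)     = sym R.-0#≈0#
    ⟦-⟧-homo (+ suc n) = refl
    ⟦-⟧-homo -[1+ n ]  = sym (R.-‿involutive _)

    ⊖-homo : ∀ m n → ⟦ m ℤ.⊖ n ⟧ℤ ≈ m M.× 1# - n M.× 1#
    ⊖-homo m 0 = begin
      m M.× 1#        ≈⟨ +-identityʳ _ ⟨
      m M.× 1# + 0#   ≈⟨ +-congˡ R.-0#≈0# ⟨
      m M.× 1# - 0#   ∎
    ⊖-homo 0 (suc n) = sym (+-identityˡ _)
    ⊖-homo (suc m) (suc n) = begin
      ⟦ suc m ℤ.⊖ suc n ⟧ℤ                    ≡⟨ ≡.cong ⟦_⟧ℤ (ℤₚ.[1+m]⊖[1+n]≡m⊖n m n) ⟩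
      ⟦ m ℤ.⊖ n ⟧ℤ                            ≈⟨ ⊖-homo m n ⟩
      a - b                                   ≈⟨ +-congʳ (+-identityʳ a) ⟨
      a + 0# - b                              ≈⟨ +-congʳ (+-congˡ (-‿inverseʳ 1#)) ⟨
      a + (1# - 1#) - b                       ≈⟨ +-congʳ (+-assoc a 1# (- 1#)) ⟨
      a + 1# - 1# - b                         ≈⟨ +-assoc _ _ _ ⟩
      a + 1# + (- 1# - b)                     ≈⟨ +-cong (+-comm a 1#) (R.-‿+-comm 1# b) ⟩
      1# + a - (1# + b)                       ≈⟨ +-cong (M.1+× m 1#) (-‿cong (M.1+× n 1#)) ⟨
      suc m M.× 1# - suc n M.× 1#             ∎
      where
      a = m M.× 1#
      b = n M.× 1#

    ⟦+⟧-homo : ∀ i j → ⟦ i ℤ.+ j ⟧ℤ ≈ ⟦ i ⟧ℤ + ⟦ j ⟧ℤ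
    ⟦+⟧-homo (+ m) (+ n) = M.×-homo-+ 1# m n
    ⟦+⟧-homo (+ m) -[1+ n ] = ⊖-homo m (suc n)
    ⟦+⟧-homo -[1+ m ] (+ n) = trans (⊖-homo n (suc m)) (+-comm _ _)
    ⟦+⟧-homo -[1+ m ] -[1+ n ] = begin
      - (suc (suc (m ℕ.+ n)) M.× 1#)          ≡⟨ ≡.cong (λ k → - (suc k M.× 1#))
        (≡.sym (ℕₚ.+-suc m n)) ⟩
      - ((suc m ℕ.+ suc n) M.× 1#)            ≈⟨ -‿cong (M.×-homo-+ 1# (suc m) (suc n)) ⟩
      - (suc m M.× 1# + suc n M.× 1#)         ≈⟨ R.-‿+-comm _ _ ⟨
      - (suc m M.× 1#) - suc n M.× 1#         ∎

    ⟦+*⟧-homo : ∀ m j → ⟦ + m ℤ.* j ⟧ℤ ≈ m M.× 1# * ⟦ j ⟧ℤ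
    ⟦+*⟧-homo m (+ n) = begin
      ⟦ + m ℤ.* + n ⟧ℤ             ≡⟨ ≡.cong ⟦_⟧ℤ (ℤₚ.pos-* m n) ⟨
      (m ℕ.* n) M.× 1#             ≈⟨ M.×1-homo-* m n ⟩
      m M.× 1# * n M.× 1#          ∎
    ⟦+*⟧-homo m -[1+ n ] = begin
      ⟦ + m ℤ.* -[1+ n ] ⟧ℤ        ≡⟨ ≡.cong ⟦_⟧ℤ (ℤₚ.neg-distribʳ-* (+ m) (+ suc n)) ⟨
      ⟦ ℤ.- (+ m ℤ.* + suc n) ⟧ℤ   ≈⟨ ⟦-⟧-homo (+ m ℤ.* + suc n) ⟩
      - ⟦ + m ℤ.* + suc n ⟧ℤ       ≈⟨ -‿cong (⟦+*⟧-homo m (+ suc n)) ⟩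
      - (m M.× 1# * suc n M.× 1#)  ≈⟨ R.-‿distribʳ-* _ _ ⟩
      m M.× 1# * - (suc n M.× 1#)  ∎

    ⟦*⟧-homo : ∀ i j → ⟦ i ℤ.* j ⟧ℤ ≈ ⟦ i ⟧ℤ * ⟦ j ⟧ℤ
    ⟦*⟧-homo (+ m) j = ⟦+*⟧-homo m j
    ⟦*⟧-homo -[1+ m ] j = begin
      ⟦ -[1+ m ] ℤ.* j ⟧ℤ          ≡⟨ ≡.cong ⟦_⟧ℤ (ℤₚ.neg-distribˡ-* (+ suc m) j) ⟨
      ⟦ ℤ.- (+ suc m ℤ.* j) ⟧ℤ     ≈⟨ ⟦-⟧-homo (+ suc m ℤ.* j) ⟩
      - ⟦ + suc m ℤ.* j ⟧ℤ         ≈⟨ -‿cong (⟦+*⟧-homo (suc m) j) ⟩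
      - (suc m M.× 1# * ⟦ j ⟧ℤ)    ≈⟨ R.-‿distribˡ-* _ _ ⟩
      - (suc m M.× 1#) * ⟦ j ⟧ℤ    ∎

    -- Equality in the field cannot be computed, so the solver takes its coefficients from the
    -- integers, mapped to multiples of `1#`.
    ℤ⟶ℝ : ℤ.+-*-rawRing -Raw-AlmostCommutative⟶ fromCommutativeRing commutativeRing
    ℤ⟶ℝ = record
      { ⟦_⟧ = ⟦_⟧ℤ ; +-homo = ⟦+⟧-homo ; *-homo = ⟦*⟧-homo ; -‿homo = ⟦-⟧-homo
      ; 0-homo = refl ; 1-homo = refl }

    _≟ℤ_ : ∀ i j → Maybe (⟦ i ⟧ℤ ≈ ⟦ j ⟧ℤ)
    i ≟ℤ j with i ℤₚ.≟ j
    ... | yes ≡.refl = just refl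
    ... | no _       = nothing

  module Solver = Algebra.Solver.Ring ℤ.+-*-rawRing (fromCommutativeRing commutativeRing) ℤ⟶ℝ _≟ℤ_
  open Solver using (normalise; correct; var; _≟N_; ⟦_⟧N-cong) renaming (⟦_⟧ to sem; ⟦_⟧↓ to sem↓)
  open Solver public using (_:=_; _:+_; _:*_; _:-_; :-_; con; Polynomial)
  open Reflection setoid var sem sem↓ correct using (close)

  Normalised : ∀ {n} → Polynomial n → Polynomial n → Bool
  Normalised p q = is-just (normalise p ≟N normalise q)

  abstract
    -- Comparing coefficients instead of normalised ring elements is much faster
    -- than the library's solve; abstract, lest with-abstractions unfold the proofs.
    solve : ∀ n (f : N-ary n (Polynomial n) (Polynomial n × Polynomial n)) →
      T (Normalised (proj₁ (close n f)) (proj₂ (close n f))) →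
      Eq n _≈_ (curryⁿ (sem (proj₁ (close n f)))) (curryⁿ (sem (proj₂ (close n f))))
    solve n f t = curryⁿ-cong _≈_ (sem e) (sem e′) λ ρ →
      trans (sym (correct e ρ)) (trans (equal (normalise e ≟N normalise e′) t ρ) (correct e′ ρ))
      where
      e e′ : Polynomial n
      e  = proj₁ (close n f)
      e′ = proj₂ (close n f)
      equal : ∀ {p q : Solver.Normal n} (d : Maybe (p Solver.≈N q)) → T (is-just d) → ∀ ρ →
        Solver.⟦ p ⟧N ρ ≈ Solver.⟦ q ⟧N ρ
      equal (just d) _ = ⟦ d ⟧N-cong

  :0 :1 : ∀ {n} → Polynomial n
  :0 = con (+ 0)
  :1 = con (+ 1)

  -- Arithmetic in an ordered field.

  variable
    x y z a b c : Carrier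

  ≤-resp : x ≈ a → y ≈ b → x ≤ y → a ≤ b
  ≤-resp p q = Order.≤-respˡ-≈ p ∘ Order.≤-respʳ-≈ q

  <-resp : x ≈ a → y ≈ b → x < y → a < b
  <-resp p q (x≤y , x≉y) = ≤-resp p q x≤y , λ a≈b → x≉y (trans p (trans a≈b (sym q)))

  diff≥0 : x ≤ y → 0# ≤ y - x
  diff≥0 {x} {y} p = ≤-resp (-‿inverseˡ x) (+-comm (- x) y) (+-monoʳ-≤ (- x) p)

  -- Reduces inequalities to ring identities: the difference is written as a visibly nonnegative
  -- expression `a`, and the solver does the rest.
  ≤-by : 0# ≤ a → a ≈ y - x → x ≤ y
  ≤-by {a} {y} {x} p q = ≤-resp (+-identityʳ x)
    (trans (+-congˡ q) (solve 2 (λ x y → x :+ (y :- x) := y) _ x y)) (+-monoʳ-≤ x p)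

  diff>0 : x < y → 0# < y - x
  diff>0 {x} {y} (p , q) = diff≥0 p , λ e →
    q (trans (trans (sym (+-identityʳ x)) (+-congˡ e)) (solve 2 (λ x y → x :+ (y :- x) := y) _ x y))

  <-by : 0# < a → a ≈ y - x → x < y
  <-by (p , q) e = ≤-by p e , λ x≈y → q (sym (trans e (trans (+-congʳ (sym x≈y)) (-‿inverseʳ _))))

  <⇒≱ : x < y → ¬ (y ≤ x)
  <⇒≱ (p , q) r = q (Order.antisym p r)

  ≤-or-> : ∀ x y → x ≤ y ⊎ y < x
  ≤-or-> x y with em {P = x ≤ y} | Order.total x y
  ... | yes p | _      = inj₁ p
  ... | no ¬p | inj₁ p = inj₁ p
  ... | no ¬p | inj₂ q = inj₂ (q , λ e → ¬p (Order.reflexive (sym e)))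

  tri : ∀ x y → x < y ⊎ x ≈ y ⊎ y < x
  tri x y with em {P = x ≈ y} | ≤-or-> x y
  ... | yes p | _      = inj₂ (inj₁ p)
  ... | no ¬p | inj₁ q = inj₁ (q , ¬p)
  ... | no ¬p | inj₂ q = inj₂ (inj₂ q)

  ≮⇒≥ : ¬ (x < y) → y ≤ x
  ≮⇒≥ {x} {y} p with ≤-or-> y x
  ... | inj₁ q = q
  ... | inj₂ q = ⊥-elim (p q)

  ≰⇒> : ¬ (x ≤ y) → y < x
  ≰⇒> {x} {y} p with ≤-or-> x y
  ... | inj₁ q = ⊥-elim (p q)
  ... | inj₂ q = q

  +-nn : 0# ≤ x → 0# ≤ y → 0# ≤ x + y
  +-nn {x} p q = Order.trans (Order.≤-respʳ-≈ (sym (+-identityʳ x)) p) (+-monoʳ-≤ x q)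

  +-pos : 0# < x → 0# ≤ y → 0# < x + y
  +-pos {x} {y} p q = +-nn (proj₁ p) q , λ e →
    <⇒≱ p (≤-by q (trans (solve 2 (λ x y → y := (x :+ y) :- x) _ x y) (+-congʳ (sym e))))

  +-pos′ : 0# ≤ x → 0# < y → 0# < x + y
  +-pos′ p q = <-resp refl (+-comm _ _) (+-pos q p)

  *-pos : 0# < x → 0# < y → 0# < x * y
  *-pos {x} {y} (p , 0≉x) (q , 0≉y) = *-nonNeg p q , λ e → 0≉y (cancel e (inverse x (0≉x ∘ sym)))
    where
    cancel : 0# ≈ x * y → ∃[ i ] x * i ≈ 1# → 0# ≈ y
    cancel e (i , xi≈1) = trans (sym (zeroʳ i)) (trans (*-congˡ e)
      (trans (solve 3 (λ x y i → i :* (x :* y) := x :* i :* y) _ x y i)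
        (trans (*-congʳ xi≈1) (*-identityˡ y))))

  sq-nn : ∀ x → 0# ≤ x * x
  sq-nn x with Order.total 0# x
  ... | inj₁ p = *-nonNeg p p
  ... | inj₂ p = ≤-resp refl (solve 1 (λ x → (:0 :- x) :* (:0 :- x) := x :* x) _ x)
    (*-nonNeg (diff≥0 p) (diff≥0 p))

  0<1 : 0# < 1#
  0<1 = ≤-resp refl (*-identityˡ 1#) (sq-nn 1#) , 0≉1

  0<+⇒ : 0# < x → 0# ≤ y → x + y ≈ 0# → ⊥
  0<+⇒ p q e = proj₂ (+-pos p q) (sym e)

  cancel-pos : 0# < a → 0# < a * x → 0# < x
  cancel-pos {a} {x} p q = ≰⇒> λ x≤0 → 0<+⇒ q (*-nonNeg (proj₁ p) (diff≥0 x≤0))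
    (solve 2 (λ a x → a :* x :+ a :* (:0 :- x) := :0) _ a x)

  cancel-nn : 0# < a → 0# ≤ a * x → 0# ≤ x
  cancel-nn {a} {x} p q = ≮⇒≥ λ x<0 → 0<+⇒ (*-pos p (diff>0 x<0)) q
    (solve 2 (λ a x → a :* (:0 :- x) :+ a :* x := :0) _ a x)

  recip : 0# < x → ∃[ i ] 0# < i × x * i ≈ 1#
  recip {x} p with inverse x (proj₂ p ∘ sym)
  ... | i , e = i , cancel-pos p (<-resp refl (sym e) 0<1) , e

  double : ∀ x → x + x ≈ (1# + 1#) * x
  double x = sym (trans (distribʳ x 1# 1#) (+-cong (*-identityˡ x) (*-identityˡ x)))

  half : ∃[ h ] 0# < h × h + h ≈ 1#
  half = let (h , 0<h , e) = recip 0<2 in h , 0<h , trans (double h) e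
    where
    0<2 : 0# < 1# + 1#
    0<2 = +-pos 0<1 (proj₁ 0<1)

  lower : 0# < x → 0# < y → ∃[ z ] 0# < z × z ≤ x × z ≤ y
  lower {x} {y} p q with Order.total x y
  ... | inj₁ x≤y = x , p , Order.refl , x≤y
  ... | inj₂ y≤x = y , q , y≤x , Order.refl

  sq-mono : 0# ≤ x → x ≤ y → x * x ≤ y * y
  sq-mono {x} {y} p q = ≤-by (*-nonNeg (diff≥0 q) (+-nn p (Order.trans p q)))
    (solve 2 (λ x y → (y :- x) :* (x :+ y) := y :* y :- x :* x) _ x y)

  <-≤ : x < y → y ≤ z → x < z
  <-≤ {x} {y} {z} p q = <-by (+-pos (diff>0 p) (diff≥0 q))
    (solve 3 (λ x y z → (y :- x) :+ (z :- y) := z :- x) _ x y z)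

  -- Vectors.

  variable
    p q u v τ : Point 2

  ext₂ : p 0F ≈ q 0F → p 1F ≈ q 1F → p ≋ q
  ext₂ e f zero = e
  ext₂ e f (suc zero) = f

  dot : ∀ {n} (a b c d : Polynomial n) → Polynomial n
  dot a b c d = a :* c :+ (b :* d :+ :0)

  ⟨⟩-cong : p ≋ q → u ≋ v → ⟨ p , u ⟩ ≈ ⟨ q , v ⟩
  ⟨⟩-cong e f = +-cong (*-cong (e 0F) (f 0F)) (+-congʳ (*-cong (e 1F) (f 1F)))

  ⟨⟩-congʳ : ∀ (p : Point 2) → u ≋ v → ⟨ p , u ⟩ ≈ ⟨ p , v ⟩
  ⟨⟩-congʳ p = ⟨⟩-cong (≋-refl {x = p})

  ⟨⟩-congˡ : ∀ (p : Point 2) → u ≋ v → ⟨ u , p ⟩ ≈ ⟨ v , p ⟩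
  ⟨⟩-congˡ p e = ⟨⟩-cong e (≋-refl {x = p})

  J : Point 2 → Point 2
  J x 0F = - x 1F
  J x 1F = x 0F

  ‖_‖²-nn : ∀ (p : Point 2) → 0# ≤ ⟨ p , p ⟩
  ‖ p ‖²-nn = +-nn (sq-nn (p 0F)) (+-nn (sq-nn (p 1F)) Order.refl)

  sq-zero : x * x ≈ 0# → x ≈ 0#
  sq-zero {x} e with tri 0# x
  ... | inj₁ p = ⊥-elim (proj₂ (*-pos p p) (sym e))
  ... | inj₂ (inj₁ p) = sym p
  ... | inj₂ (inj₂ p) = ⊥-elim (proj₂ (*-pos (diff>0 p) (diff>0 p))
    (trans (sym e) (solve 1 (λ x → x :* x := (:0 :- x) :* (:0 :- x)) _ x)))

  sq-pos : ¬ (x ≈ 0#) → 0# < x * x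
  sq-pos {x} p = sq-nn x , λ e → p (sq-zero (sym e))

  ‖_‖²-pos : ∀ (p : Point 2) → ¬ (p ≋ 0ᵥ) → 0# < ⟨ p , p ⟩
  ‖ p ‖²-pos ne with em {P = p 0F ≈ 0#} | em {P = p 1F ≈ 0#}
  ... | no n  | _ = +-pos (sq-pos n) (+-nn (sq-nn (p 1F)) Order.refl)
  ... | yes _ | no n = +-pos′ (sq-nn (p 0F)) (+-pos (sq-pos n) Order.refl)
  ... | yes e | yes f = ⊥-elim (ne (ext₂ e f))

  -- Near, as a record so that the centre can be inferred.
  record Nearby (x : Point 2) (P : Pred (Point 2) 0ℓ) : Set where
    constructor near
    field
      radius   : Carrier
      positive : 0# < radius
      holds    : ∀ y → y ∈ Ball x radius → P y

  Ball-mono : ∀ {r s} (p : Point 2) → 0# ≤ r → r ≤ s → ∀ y → y ∈ Ball p r → y ∈ Ball p s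
  Ball-mono p 0≤r r≤s y y∈ = <-≤ y∈ (sq-mono 0≤r r≤s)

  Nearby-∩ : ∀ {P Q : Pred (Point 2) _} → Nearby p P → Nearby p Q → Nearby p (P ∩ Q)
  Nearby-∩ {p} (near r 0<r f) (near s 0<s g) with lower 0<r 0<s
  ... | t , 0<t , t≤r , t≤s = near t 0<t λ y y∈ →
    f y (Ball-mono p (proj₁ 0<t) t≤r y y∈) , g y (Ball-mono p (proj₁ 0<t) t≤s y y∈)

  Nearby-map : ∀ {P Q : Pred (Point 2) _} → (∀ y → P y → Q y) → Nearby p P → Nearby p Q
  Nearby-map h (near r 0<r f) = near r 0<r λ y y∈ → h y (f y y∈)

  center : ∀ {r} (p : Point 2) → 0# < r → p ∈ Ball p r
  center p 0<r = <-resp (solve 2 (λ a b → :0 := dot (a :- a) (b :- b) (a :- a) (b :- b)) _ (p 0F)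
    (p 1F)) refl (*-pos 0<r 0<r)

  Nearby-center : ∀ {P : Pred (Point 2) _} → Nearby p P → P p
  Nearby-center {p} (near r 0<r f) = f p (center p 0<r)

  -- Affine inequalities and balls, without square roots.

  eval-cong : ∀ ℓ → p ≋ q → eval ℓ p ≈ eval ℓ q
  eval-cong ℓ e = +-congʳ (⟨⟩-congʳ (slope ℓ) e)

  -- Completing the square replaces the Cauchy-Schwarz inequality. With z = y - p, M = |b|² + 1 and
  -- r = e / M, the value at y times 2r is r²M + (r² - |z|²) + |rb + z|², which is positive on the
  -- ball of radius r.
  affine-pos : ∀ ℓ (p : Point 2) → 0# < eval ℓ p → Nearby p λ y → 0# < eval ℓ y
  affine-pos (affine b c) p 0<e with recip (+-pos′ (‖ b ‖²-nn) 0<1)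
  ... | i , 0<i , Mi≈1 = near r (*-pos 0<e 0<i) λ y y∈ →
    cancel-pos (+-pos 0<r (proj₁ 0<r)) (<-resp refl (identity y)
      (+-pos (*-pos (*-pos 0<r 0<r) 0<M) (+-nn (proj₁ (diff>0 y∈)) (‖ r • b +ᵥ (y -ᵥ p) ‖²-nn))))
    where
    e = ⟨ b , p ⟩ + c
    r = e * i
    M = ⟨ b , b ⟩ + 1#
    0<r = *-pos 0<e 0<i
    0<M = +-pos′ (‖ b ‖²-nn) 0<1
    rM≈e : r * M ≈ e
    rM≈e = trans (solve 3 (λ e i M → e :* i :* M := e :* (M :* i)) _ e i M)
      (trans (*-congˡ Mi≈1) (*-identityʳ e))
    identity : ∀ y → r * r * M + ((r * r - ⟨ y -ᵥ p , y -ᵥ p ⟩) + ⟨ r • b +ᵥ (y -ᵥ p) , r • b +ᵥ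
      (y -ᵥ p) ⟩) ≈ (r + r) * (⟨ b , y ⟩ + c)
    identity y = trans
      (solve 5 (λ b0 b1 z0 z1 r → let M = dot b0 b1 b0 b1 :+ :1 in
          r :* r :* M :+ ((r :* r :- dot z0 z1 z0 z1) :+ dot (r :* b0 :+ z0) (r :* b1 :+ z1)
            (r :* b0 :+ z0) (r :* b1 :+ z1))
          := (r :+ r) :* (r :* M :+ dot b0 b1 z0 z1)) _ (b 0F) (b 1F) (y 0F - p 0F) (y 1F - p 1F) r)
      (*-congˡ (trans (+-congʳ rM≈e)
        (solve 7 (λ b0 b1 y0 y1 p0 p1 c → (dot b0 b1 p0 p1 :+ c) :+ dot b0 b1 (y0 :- p0) (y1 :- p1) :=
          dot b0 b1 y0 y1 :+ c)
          _ (b 0F) (b 1F) (y 0F) (y 1F) (p 0F) (p 1F) c)))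

  affine-< : ∀ ℓ ℓ′ (p : Point 2) → eval ℓ p < eval ℓ′ p → Nearby p λ y → eval ℓ y < eval ℓ′ y
  affine-< ℓ@(affine b c) ℓ′@(affine b′ c′) p lt =
    Nearby-map {p} (λ y h → <-by h (diff y))
      (affine-pos (affine (b′ -ᵥ b) (c′ - c)) p (<-resp refl (sym (diff p)) (diff>0 lt)))
    where
    diff : ∀ y → ⟨ b′ -ᵥ b , y ⟩ + (c′ - c) ≈ (⟨ b′ , y ⟩ + c′) - (⟨ b , y ⟩ + c)
    diff y = solve 8 (λ b0 b1 c b0′ b1′ c′ y0 y1 → dot (b0′ :- b0) (b1′ :- b1) y0 y1 :+ (c′ :- c)
      := (dot b0′ b1′ y0 y1 :+ c′) :- (dot b0 b1 y0 y1 :+ c)) _ (b 0F) (b 1F) c (b′ 0F) (b′ 1F) c′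
        (y 0F) (y 1F)

  ‖+‖² : ∀ (p q : Point 2) → ⟨ p +ᵥ q , p +ᵥ q ⟩ ≈ ⟨ p , p ⟩ + (⟨ p , q ⟩ + ⟨ p , q ⟩) + ⟨ q , q ⟩
  ‖+‖² p q = solve 4 (λ a b c d → dot (a :+ c) (b :+ d) (a :+ c) (b :+ d)
    := dot a b a b :+ (dot a b c d :+ dot a b c d) :+ dot c d c d) _ (p 0F) (p 1F) (q 0F) (q 1F)

  -- With w = q - p, expand |y - p|² as |w|² + 2⟨w, y - q⟩ + |y - q|² and split the slack k = r² -
  -- |w|² into halves. Positivity of `ℓ` keeps the middle term below k/2; the radius is at most some
  -- t with t² ≤ t ≤ k/2, which takes care of the last term.
  ball-open : ∀ {r} (p q : Point 2) → q ∈ Ball p r → Nearby q (Ball p r)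
  ball-open {r} p q q∈ with half
  ... | h , 0<h , h+h≈1 = local (lower 0<1 0<hk)
    (affine-pos ℓ q (<-resp refl (trans
      (solve 2 (λ m b → m := m :- (b :+ b) :+ (b :+ b)) _ (h * k) ⟨ w , q ⟩) (sym (evalℓ q))) 0<hk))
    where
    w = q -ᵥ p
    k = r * r - ⟨ w , w ⟩
    0<hk = *-pos 0<h (diff>0 q∈)
    ℓ = affine (-ᵥ (w +ᵥ w)) (h * k + (⟨ w , q ⟩ + ⟨ w , q ⟩))
    evalℓ : ∀ y → eval ℓ y ≈ h * k - (⟨ w , y ⟩ + ⟨ w , y ⟩) + (⟨ w , q ⟩ + ⟨ w , q ⟩)
    evalℓ y = solve 6 (λ m w0 w1 y0 y1 b → dot (:- (w0 :+ w0)) (:- (w1 :+ w1)) y0 y1 :+ (m :+ b)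
      := m :- (dot w0 w1 y0 y1 :+ dot w0 w1 y0 y1) :+ b) _ (h * k) (w 0F) (w 1F) (y 0F) (y 1F)
        (⟨ w , q ⟩ + ⟨ w , q ⟩)
    hk+hk≈k : h * k + h * k ≈ k
    hk+hk≈k = trans (solve 2 (λ h k → h :* k :+ h :* k := (h :+ h) :* k) _ h k)
      (trans (*-congʳ h+h≈1) (*-identityˡ k))
    expand : ∀ y → ⟨ y -ᵥ p , y -ᵥ p ⟩ ≈ ⟨ w , w ⟩ +
      (⟨ w , y ⟩ - ⟨ w , q ⟩ + (⟨ w , y ⟩ - ⟨ w , q ⟩)) + ⟨ y -ᵥ q , y -ᵥ q ⟩
    expand y = trans (⟨⟩-cong split split)
      (trans (‖+‖² w (y -ᵥ q)) (+-congʳ (+-congˡ (+-cong lin lin))))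
      where
      split : y -ᵥ p ≋ w +ᵥ (y -ᵥ q)
      split i = solve 3 (λ y p q → y :- p := (q :- p) :+ (y :- q)) _ (y i) (p i) (q i)
      lin : ⟨ w , y -ᵥ q ⟩ ≈ ⟨ w , y ⟩ - ⟨ w , q ⟩
      lin = solve 6 (λ w0 w1 y0 y1 q0 q1 → dot w0 w1 (y0 :- q0) (y1 :- q1) :=
        dot w0 w1 y0 y1 :- dot w0 w1 q0 q1)
        _ (w 0F) (w 1F) (y 0F) (y 1F) (q 0F) (q 1F)
    local : ∃[ t ] 0# < t × t ≤ 1# × t ≤ h * k → Nearby q (λ y → 0# < eval ℓ y) → Nearby q (Ball p r)
    local (t , 0<t , t≤1 , t≤hk) (near s 0<s f) with lower 0<s 0<t
    ... | s′ , 0<s′ , s′≤s , s′≤t = near s′ 0<s′ λ y y∈ →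
      <-by (+-pos (f y (Ball-mono q (proj₁ 0<s′) s′≤s y y∈))
             (+-nn (diff≥0 t≤hk) (+-nn (*-nonNeg (proj₁ 0<t) (diff≥0 t≤1))
               (diff≥0 (Order.trans (proj₁ y∈) (sq-mono (proj₁ 0<s′) s′≤t))))))
        (trans (trans (+-congʳ (evalℓ y)) (solve 6 (λ m t Y Q Z W →
            m :- (Y :+ Y) :+ (Q :+ Q) :+ ((m :- t) :+ (t :* (:1 :- t) :+ (t :* t :- Z)))
            := (m :+ m) :+ W :- (W :+ (Y :- Q :+ (Y :- Q)) :+ Z)) _
              (h * k) t ⟨ w , y ⟩ ⟨ w , q ⟩ ⟨ y -ᵥ q , y -ᵥ q ⟩ ⟨ w , w ⟩))
          (+-cong (trans (+-congʳ hk+hk≈k)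
            (solve 2 (λ r a → (r :* r :- a) :+ a := r :* r) _ r ⟨ w , w ⟩))
                  (-‿cong (sym (expand y)))))

  -- Gradients.

  nz-cancel : ¬ (a ≈ 0#) → a * x ≈ 0# → x ≈ 0#
  nz-cancel {a} {x} a≉0 e = let (i , ai≈1) = inverse a a≉0 in
    trans (sym (*-identityˡ x)) (trans (*-congʳ (sym ai≈1))
      (trans (solve 3 (λ a i x → a :* i :* x := i :* (a :* x)) _ a i x) (trans (*-congˡ e) (zeroʳ i))))

  ≋0⇐‖‖² : ⟨ p , p ⟩ ≈ 0# → p ≋ 0ᵥ
  ≋0⇐‖‖² {p} e with em {P = p ≋ 0ᵥ}
  ... | yes p≋0 = p≋0
  ... | no p≉0  = ⊥-elim (proj₂ (‖ p ‖²-pos p≉0) (sym e))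

  -ᵥ≋0⇒≋ : p -ᵥ q ≋ 0ᵥ → p ≋ q
  -ᵥ≋0⇒≋ {p} {q} e i = trans (solve 2 (λ x y → x := y :+ (x :- y)) _ (p i) (q i))
    (trans (+-congˡ (e i)) (+-identityʳ _))

  -- The condition `t * t ≤ ε * ε` expresses |t| ≤ ε and so covers both directions of the line.
  -- Dividing r by |q|² + 1 instead of |q| avoids the square root and the case q = 0.
  Ball-along : ∀ {r} (p q : Point 2) → 0# < r → ∃[ ε ] 0# < ε ×
    (∀ t → t * t ≤ ε * ε → p +ᵥ t • q ∈ Ball p r)
  Ball-along {r} p q 0<r = let (i , 0<i , ai≈1) = recip 0<N+1 in
    r * i , *-pos 0<r 0<i , λ t t²≤ε² →
      <-by (+-pos′ (*-nonNeg (diff≥0 t²≤ε²) (‖ q ‖²-nn)) (*-pos (*-pos (*-pos 0<r 0<i) (*-pos 0<r 0<i))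
             (+-pos′ (*-nonNeg (‖ q ‖²-nn) (‖ q ‖²-nn)) 0<N+1)))
        (trans (solve 3 (λ ε N T → (ε :* ε :- T) :* N :+ ε :* ε :* (N :* N :+ (N :+ :1)) := ε :*
          (N :+ :1) :* (ε :* (N :+ :1)) :- T :* N)
                  _ (r * i) N (t * t))
          (+-cong (*-cong (unscale i ai≈1) (unscale i ai≈1)) (-‿cong (sym (scaled t)))))
    where
    N : Carrier
    N = ⟨ q , q ⟩
    0<N+1 : 0# < N + 1#
    0<N+1 = +-pos′ (‖ q ‖²-nn) 0<1
    unscale : ∀ i → (N + 1#) * i ≈ 1# → r * i * (N + 1#) ≈ r
    unscale i e = trans (solve 3 (λ r i M → r :* i :* M := r :* (M :* i)) _ r i (N + 1#))
      (trans (*-congˡ e) (*-identityʳ r))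
    scaled : ∀ t → ⟨ p +ᵥ t • q -ᵥ p , p +ᵥ t • q -ᵥ p ⟩ ≈ t * t * N
    scaled t = solve 5 (λ p0 p1 q0 q1 t → dot (p0 :+ t :* q0 :- p0) (p1 :+ t :* q1 :- p1)
      (p0 :+ t :* q0 :- p0) (p1 :+ t :* q1 :- p1)
      := t :* t :* dot q0 q1 q0 q1) _ (p 0F) (p 1F) (q 0F) (q 1F) t

  Nearby-along : ∀ {P : Pred (Point 2) _} (q : Point 2) → Nearby p P → ∃[ ε ] 0# < ε ×
    (∀ t → t * t ≤ ε * ε → P (p +ᵥ t • q))
  Nearby-along {p} q (near r 0<r f) = let (ε , 0<ε , g) = Ball-along p q 0<r in ε , 0<ε , λ t h → f _
                                            (g t h)

  eval-step : ∀ ℓ (p q : Point 2) t → eval ℓ (p +ᵥ t • q) ≈ eval ℓ p + t * ⟨ slope ℓ , q ⟩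
  eval-step ℓ p q t = solve 8 (λ b0 b1 c p0 p1 q0 q1 t → dot b0 b1 (p0 :+ t :* q0) (p1 :+ t :* q1) :+ c
    := dot b0 b1 p0 p1 :+ c :+ t :* dot b0 b1 q0 q1) _ (slope ℓ 0F) (slope ℓ 1F) (constant ℓ) (p 0F)
      (p 1F) (q 0F) (q 1F) t

  ⟨⟩-subˡ : ∀ (u v q : Point 2) → ⟨ u -ᵥ v , q ⟩ ≈ ⟨ u , q ⟩ - ⟨ v , q ⟩
  ⟨⟩-subˡ u v q = solve 6 (λ a b c d e f → dot (a :- c) (b :- d) e f := dot a b e f :- dot c d e f) _
    (u 0F) (u 1F) (v 0F) (v 1F) (q 0F) (q 1F)

  -- Let d be the difference of the slopes. Moving from p along d or -d, whichever lies on the side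
  -- of `n`, the functions drift apart at rate |d|², so d vanishes. For `n` equal to `0ᵥ` the half
  -- ball is the whole ball.
  slope-≋ : ∀ n ℓ ℓ′ → Nearby p (λ y → 0# ≤ ⟨ n , y -ᵥ p ⟩ → eval ℓ y ≈ eval ℓ′ y) → slope ℓ ≋ slope ℓ′
  slope-≋ {p} n ℓ ℓ′ equal = -ᵥ≋0⇒≋
    (≋0⇐‖‖² (direction (Order.total 0# ⟨ n , d ⟩) (Nearby-along d equal)))
    where
    d : Point 2
    d = slope ℓ -ᵥ slope ℓ′
    offset : ∀ t → ⟨ n , p +ᵥ t • d -ᵥ p ⟩ ≈ t * ⟨ n , d ⟩
    offset t = solve 7 (λ n0 n1 p0 p1 d0 d1 t → dot n0 n1 (p0 :+ t :* d0 :- p0) (p1 :+ t :* d1 :- p1) :=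
      t :* dot n0 n1 d0 d1)
      _ (n 0F) (n 1F) (p 0F) (p 1F) (d 0F) (d 1F) t
    offset₀ : ⟨ n , p -ᵥ p ⟩ ≈ 0#
    offset₀ = solve 4 (λ n0 n1 p0 p1 → dot n0 n1 (p0 :- p0) (p1 :- p1) := :0) _ (n 0F) (n 1F) (p 0F)
      (p 1F)
    at-p : eval ℓ p ≈ eval ℓ′ p
    at-p = Nearby-center equal (Order.reflexive (sym offset₀))
    solved : ∀ t → ¬ (t ≈ 0#) → eval ℓ (p +ᵥ t • d) ≈ eval ℓ′ (p +ᵥ t • d) → ⟨ d , d ⟩ ≈ 0#
    solved t t≉0 e = nz-cancel t≉0 (trans (*-congˡ (⟨⟩-subˡ (slope ℓ) (slope ℓ′) d))
      (trans (solve 4 (λ t A B C → t :* (A :- B) := C :+ t :* A :- (C :+ t :* B)) _ t ⟨ slope ℓ ,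
        d ⟩ ⟨ slope ℓ′ , d ⟩ (eval ℓ p))
      (trans (+-cong (sym (eval-step ℓ p d t))
        (-‿cong (trans (+-congʳ at-p) (sym (eval-step ℓ′ p d t)))))
      (trans (+-congʳ e) (-‿inverseʳ _)))))
    direction : 0# ≤ ⟨ n , d ⟩ ⊎ ⟨ n , d ⟩ ≤ 0# → ∃[ ε ] 0# < ε ×
      (∀ t → t * t ≤ ε * ε → 0# ≤ ⟨ n , p +ᵥ t • d -ᵥ p ⟩ → eval ℓ (p +ᵥ t • d) ≈ eval ℓ′
        (p +ᵥ t • d)) →
      ⟨ d , d ⟩ ≈ 0#
    direction (inj₁ le) (ε , 0<ε , f) = solved ε (proj₂ 0<ε ∘ sym)
      (f ε Order.refl (≤-resp refl (sym (offset ε)) (*-nonNeg (proj₁ 0<ε) le)))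
    direction (inj₂ ge) (ε , 0<ε , f) = solved (- ε)
      (λ e → proj₂ 0<ε (sym (trans (sym (R.-‿involutive ε)) (trans (-‿cong e) R.-0#≈0#))))
      (f (- ε) (Order.reflexive (solve 1 (λ ε → (:- ε) :* (:- ε) := ε :* ε) _ ε))
        (≤-resp refl (trans (solve 2 (λ ε x → ε :* (:0 :- x) := (:- ε) :* x) _ ε ⟨ n , d ⟩)
          (sym (offset (- ε)))) (*-nonNeg (proj₁ 0<ε) (diff≥0 ge))))

  -- Starting from the common value at p, `ℓ` would overtake `ℓ′` at rate |d|² along the difference
  -- d of the slopes.
  touching-≋ : ∀ ℓ ℓ′ → eval ℓ p ≈ eval ℓ′ p → Nearby p (λ y → eval ℓ y ≤ eval ℓ′ y) →
    slope ℓ ≋ slope ℓ′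
  touching-≋ {p} ℓ ℓ′ at-p below = let (ε , 0<ε , f) = Nearby-along d below in
    -ᵥ≋0⇒≋ (≋0⇐‖‖² (Order.antisym
      (≤-by (cancel-nn 0<ε (≤-resp refl (step ε) (diff≥0 (f ε Order.refl)))) (sym (+-identityˡ _)))
      (‖ d ‖²-nn)))
    where
    d : Point 2
    d = slope ℓ -ᵥ slope ℓ′
    step : ∀ t → eval ℓ′ (p +ᵥ t • d) - eval ℓ (p +ᵥ t • d) ≈ t * (- ⟨ d , d ⟩)
    step t = trans (+-cong (trans (eval-step ℓ′ p d t) (+-congʳ (sym at-p)))
      (-‿cong (eval-step ℓ p d t)))
      (trans (solve 4 (λ t A B C → C :+ t :* B :- (C :+ t :* A) := t :* (:- (A :- B))) _ t ⟨ slope ℓ ,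
        d ⟩ ⟨ slope ℓ′ , d ⟩ (eval ℓ p))
      (*-congˡ (-‿cong (sym (⟨⟩-subˡ (slope ℓ) (slope ℓ′) d)))))

  record GradientAt (φ : Fun 2) (u x : Point 2) : Set where
    constructor gradient
    field
      offset : Carrier
      affine-near : Nearby x λ y → φ y ≈ eval (affine u offset) y

  variable
    φ ψ : Fun 2

  gradient-cong : u ≋ v → GradientAt φ u p → GradientAt φ v p
  gradient-cong e (gradient c h) = gradient c (Nearby-map (λ y h → trans h (+-congʳ (⟨⟩-congˡ y e))) h)

  gradient-unique : GradientAt φ u p → GradientAt φ v p → u ≋ v
  gradient-unique {u = u} {v = v} (gradient c h) (gradient c′ h′) = slope-≋ 0ᵥ (affine u c)
    (affine v c′)
    (Nearby-map (λ y (e , e′) _ → trans (sym e) e′) (Nearby-∩ h h′))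

  Nearby-open : ∀ {P} → Nearby p P → Nearby p λ y → Nearby y P
  Nearby-open {p} (near r 0<r f) = near r 0<r λ y y∈ → Nearby-map f (ball-open p y y∈)

  Open⇐ : ∀ {U} → (∀ z → z ∈ U → Nearby z U) → Open U
  Open⇐ h z z∈U = let near r 0<r f = h z z∈U in r , 0<r , λ {y} → f y

  gradient-nearby : GradientAt φ u p → Nearby p (GradientAt φ u)
  gradient-nearby (gradient c h) = Nearby-map (λ _ → gradient c) (Nearby-open h)

  gradient-open : ∀ (φ : Fun 2) u → Open (GradientAt φ u)
  gradient-open φ u = Open⇐ λ _ → gradient-nearby

  Ball-resp : ∀ {r} → 0# < r → p ≋ q → q ∈ Ball p r
  Ball-resp {p} {q} 0<r e = <-resp
    (sym (trans (⟨⟩-cong q-p≋0 q-p≋0) (solve 0 (dot :0 :0 :0 :0 := :0) _))) refl (*-pos 0<r 0<r)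
    where
    q-p≋0 : q -ᵥ p ≋ 0ᵥ
    q-p≋0 i = trans (+-congʳ (sym (e i))) (-‿inverseʳ (p i))

  Open-resp : ∀ {U : Pred (Point 2) _} → Open U → p ≋ q → p ∈ U → q ∈ U
  Open-resp {p} open-U e p∈U = let (r , 0<r , B⊆U) = open-U p p∈U in B⊆U (Ball-resp 0<r e)

  -- The points with gradient u and those with another gradient form two disjoint open sets that
  -- cover S.
  gradient-constant : ∀ {S} → Connected S → (∀ z → z ∈ S → ∃[ u ] GradientAt φ u z) →
    p ∈ S → q ∈ S → GradientAt φ u p → GradientAt φ v q → u ≋ v
  gradient-constant {φ} {p} {q} {u} {v} {S} connected has-gradient p∈S q∈S gp gq with em {P = u ≋ v}
  ... | yes u≋v = u≋v
  ... | no  u≉v = ⊥-elim (clash (connected (GradientAt φ u) Other (gradient-open φ u) Other-open cover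
    (p , p∈S , gp) (q , q∈S , v , u≉v , gq)))
    where
    Other : Pred (Point 2) _
    Other z = ∃[ w ] ¬ (u ≋ w) × GradientAt φ w z
    Other-open : Open Other
    Other-open = Open⇐ λ z (w , u≉w , g) → Nearby-map (λ _ g → w , u≉w , g) (gradient-nearby g)
    cover : S ⊆ GradientAt φ u ∪ Other
    cover {z} z∈S with has-gradient z z∈S
    ... | w , g with em {P = u ≋ w}
    ...   | yes u≋w = inj₁ (gradient-cong (≋-sym u≋w) g)
    ...   | no  u≉w = inj₂ (w , u≉w , g)
    clash : Satisfiable (S ∩ (GradientAt φ u ∩ Other)) → ⊥
    clash (z , _ , g , w , u≉w , g′) = u≉w (gradient-unique g g′)

  -- Segments.

  between : Point 2 → Point 2 → Carrier → Point 2
  between p q t = p +ᵥ t • (q -ᵥ p)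

  between-cong : ∀ p q → x ≈ y → between p q x ≋ between p q y
  between-cong p q e i = +-congˡ (*-congʳ e)

  between-shift : ∀ p q s t → between p q s +ᵥ (t - s) • (q -ᵥ p) ≋ between p q t
  between-shift p q s t i = solve 4
    (λ p q s t → p :+ s :* (q :- p) :+ (t :- s) :* (q :- p) := p :+ t :* (q :- p)) _ (p i) (q i) s t

  between-open : ∀ {U} → Open U → ∀ (p q : Point 2) s → between p q s ∈ U → ∃[ δ ] 0# < δ ×
    (∀ t → (t - s) * (t - s) ≤ δ * δ → between p q t ∈ U)
  between-open open-U p q s s∈U = let (r , 0<r , B⊆U) = open-U _ s∈U
                                      (δ , 0<δ , f) = Ball-along (between p q s) (q -ᵥ p) 0<r in
    δ , 0<δ , λ t h → Open-resp open-U (between-shift p q s t) (B⊆U (f (t - s) h))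

  Segment : Point 2 → Point 2 → Pred (Point 2) _
  Segment p q z = ∃[ t ] 0# ≤ t × t ≤ 1# × z ≋ between p q t

  -- Consider the supremum s of the parameters in [a, b] whose points lie in U. If s is in U,
  -- slightly larger parameters belong to the set as well; if s is in V, slightly smaller ones are
  -- still upper bounds.
  crossing : ∀ {U V} → Open U → Open V → ∀ (p q : Point 2) →
    (∀ t → 0# ≤ t → t ≤ 1# → between p q t ∈ U ∪ V) →
    0# ≤ a → a ≤ b → b ≤ 1# → between p q a ∈ U → between p q b ∈ V →
    ∃[ t ] 0# ≤ t × t ≤ 1# × between p q t ∈ U ∩ V
  crossing {a} {b} {U} {V} open-U open-V p q cover 0≤a a≤b b≤1 a∈U b∈V with em {P =
    ∃[ t ] 0# ≤ t × t ≤ 1# × between p q t ∈ U ∩ V}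
  ... | yes found = found
  ... | no ¬found = ⊥-elim (contradiction
    (supremum Left (a , Order.refl , a≤b , a∈U) (b , λ _ (_ , t≤b , _) → t≤b)))
    where
    Left : Pred Carrier _
    Left t = a ≤ t × t ≤ b × between p q t ∈ U

    disjoint : ∀ t → a ≤ t → t ≤ b → between p q t ∈ U → between p q t ∈ V → ⊥
    disjoint t a≤t t≤b t∈U t∈V = ¬found (t , Order.trans 0≤a a≤t , Order.trans t≤b b≤1 , t∈U , t∈V)

    in-U : ∀ s → s ∈ UpperBound Left → a ≤ s → s ≤ b → between p q s ∈ U → ⊥
    in-U s upper a≤s s≤b s∈U = right (between-open open-U p q s s∈U)
      (diff>0 (s≤b , λ s≈b → disjoint s a≤s s≤b s∈U
        (Open-resp open-V (between-cong p q (sym s≈b)) b∈V)))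
      where
      right : ∃[ δ ] 0# < δ × (∀ t → (t - s) * (t - s) ≤ δ * δ → between p q t ∈ U) → 0# < b - s → ⊥
      right (δ , 0<δ , f) 0<b-s = let (ε , 0<ε , ε≤δ , ε≤b-s) = lower 0<δ 0<b-s in
        <⇒≱ (<-by 0<ε (solve 2 (λ s ε → ε := s :+ ε :- s) _ s ε))
          (upper (s + ε)
            ( Order.trans a≤s (≤-by (proj₁ 0<ε) (solve 2 (λ s ε → ε := s :+ ε :- s) _ s ε))
            , ≤-by (diff≥0 ε≤b-s) (solve 3 (λ b s ε → b :- s :- ε := b :- (s :+ ε)) _ b s ε)
            , f (s + ε) (≤-resp (solve 2 (λ s ε → ε :* ε := (s :+ ε :- s) :* (s :+ ε :- s)) _ s ε) refl
              (sq-mono (proj₁ 0<ε) ε≤δ))))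

    in-V : ∀ s → s ∈ UpperBound Left → (∀ b → b ∈ UpperBound Left → s ≤ b) → between p q s ∈ V → ⊥
    in-V s upper least s∈V = left (between-open open-V p q s s∈V)
      where
      left : ∃[ δ ] 0# < δ × (∀ t → (t - s) * (t - s) ≤ δ * δ → between p q t ∈ V) → ⊥
      left (δ , 0<δ , f) = <⇒≱ (<-by 0<δ (solve 2 (λ s δ → δ := s :- (s :- δ)) _ s δ))
        (least (s - δ) λ t t∈@(a≤t , t≤b , t∈U) → ≮⇒≥ λ s-δ<t → disjoint t a≤t t≤b t∈U
          (f t (≤-resp (solve 2 (λ s t → (s :- t) :* (s :- t) := (t :- s) :* (t :- s)) _ s t) refl
            (sq-mono (diff≥0 (upper t t∈)) (≤-by (proj₁ (diff>0 s-δ<t))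
              (solve 3 (λ s t δ → t :- (s :- δ) := δ :- (s :- t)) _ s t δ))))))

    contradiction : ∃[ s ] s ∈ UpperBound Left × (∀ b → b ∈ UpperBound Left → s ≤ b) → ⊥
    contradiction (s , upper , least) = cases (cover s (Order.trans 0≤a a≤s) (Order.trans s≤b b≤1))
      where
      a≤s : a ≤ s
      a≤s = upper a (Order.refl , a≤b , a∈U)
      s≤b : s ≤ b
      s≤b = least b λ _ (_ , t≤b , _) → t≤b
      cases : between p q s ∈ U ∪ V → ⊥
      cases (inj₁ s∈U) = in-U s upper a≤s s≤b s∈U
      cases (inj₂ s∈V) = in-V s upper least s∈V

  segment-connected : ∀ p q → Connected (Segment p q)
  segment-connected p q U V open-U open-V cover (y , (s , 0≤s , s≤1 , y≋) , y∈U)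
    (z , (t , 0≤t , t≤1 , z≋) , z∈V) with Order.total s t
  ... | inj₁ s≤t = let (r , 0≤r , r≤1 , r∈U , r∈V) = crossing open-U open-V p q cover′ 0≤s s≤t t≤1
                         (Open-resp open-U y≋ y∈U) (Open-resp open-V z≋ z∈V)
                   in between p q r , (r , 0≤r , r≤1 , ≋-refl) , r∈U , r∈V
    where
    cover′ : ∀ t → 0# ≤ t → t ≤ 1# → between p q t ∈ U ∪ V
    cover′ t 0≤t t≤1 = cover (t , 0≤t , t≤1 , ≋-refl)
  ... | inj₂ t≤s = let (r , 0≤r , r≤1 , r∈V , r∈U) = crossing open-V open-U p q cover′ 0≤t t≤s s≤1
                         (Open-resp open-V z≋ z∈V) (Open-resp open-U y≋ y∈U)
                   in between p q r , (r , 0≤r , r≤1 , ≋-refl) , r∈U , r∈V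
    where
    cover′ : ∀ t → 0# ≤ t → t ≤ 1# → between p q t ∈ V ∪ U
    cover′ t 0≤t t≤1 with cover (t , 0≤t , t≤1 , ≋-refl)
    ... | inj₁ h = inj₂ h
    ... | inj₂ h = inj₁ h

  start∈Segment : ∀ p q → p ∈ Segment p q
  start∈Segment p q = 0# , Order.refl , proj₁ 0<1 , λ i → solve 2 (λ p q → p := p :+ :0 :* (q :- p)) _
    (p i) (q i)

  end∈Segment : ∀ p q → q ∈ Segment p q
  end∈Segment p q = 1# , proj₁ 0<1 , Order.refl , λ i → solve 2 (λ p q → q := p :+ :1 :* (q :- p)) _
    (p i) (q i)

  gradient-along : (∀ t → 0# ≤ t → t ≤ 1# → ∃[ w ] GradientAt φ w (between p q t)) →
    GradientAt φ u p → GradientAt φ v q → u ≋ v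
  gradient-along {φ} {p} {q} has-gradient = gradient-constant {S = Segment p q} (segment-connected p q)
    (λ z (t , 0≤t , t≤1 , e) → let (w , g) = has-gradient t 0≤t t≤1 in w , Open-resp (gradient-open φ w)
                                     (≋-sym e) g)
    (start∈Segment p q) (end∈Segment p q)

  -- Tropical polynomials.

  infix 4 _∈ₘ_
  _∈ₘ_ : Affine 2 → TropicalPolynomial 2 → Set
  ℓ ∈ₘ g = ℓ ∈ₗ List⁺.toList g

  variable
    ℓ ℓ′ : Affine 2

  upper : ∀ g → ℓ ∈ₘ g → ∀ p → eval ℓ p ≤ ⟦ g ⟧ p
  upper (ℓ ∷ []) (here ≡.refl) p = Order.refl
  upper (ℓ ∷ ℓ′ ∷ ls) (here ≡.refl) p = x≤x⊔y (eval ℓ p) (⟦ ℓ′ ∷ ls ⟧ p)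
  upper (ℓ ∷ ℓ′ ∷ ls) (there i) p = Order.trans (upper (ℓ′ ∷ ls) i p) (x≤y⊔x (eval ℓ p) (⟦ ℓ′ ∷ ls ⟧ p))

  attained : ∀ g p → ∃[ ℓ ] ℓ ∈ₘ g × eval ℓ p ≈ ⟦ g ⟧ p
  attained (ℓ ∷ ls) p = go ℓ ls
    where
    go : ∀ ℓ ls → ∃[ m ] m ∈ₘ (ℓ ∷ ls) × eval m p ≈ ⟦ ℓ ∷ ls ⟧ p
    go ℓ [] = ℓ , here ≡.refl , refl
    go ℓ (ℓ′ ∷ ls) with ⊔-sel (eval ℓ p) (⟦ ℓ′ ∷ ls ⟧ p) | go ℓ′ ls
    ... | inj₁ e | _         = ℓ , here ≡.refl , sym e
    ... | inj₂ e | m , i , f = m , there i , trans f (sym e)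

  least : ∀ g → (∀ {ℓ} → ℓ ∈ₘ g → eval ℓ p ≤ c) → ⟦ g ⟧ p ≤ c
  least {p} g bound = let (ℓ , ℓ∈g , e) = attained g p in ≤-resp e refl (bound ℓ∈g)

  ≈-by-bound : ∀ g → ℓ ∈ₘ g → (∀ {ℓ′} → ℓ′ ∈ₘ g → eval ℓ′ p ≤ eval ℓ p) → ⟦ g ⟧ p ≈ eval ℓ p
  ≈-by-bound {p = p} g ℓ∈g bound = Order.antisym (least {p} g bound) (upper g ℓ∈g p)

  ⟦⟧-cong : ∀ g → p ≋ q → ⟦ g ⟧ p ≈ ⟦ g ⟧ q
  ⟦⟧-cong {p} {q} g e = Order.antisym
    (least {p} g λ {ℓ} ℓ∈g → ≤-resp (eval-cong ℓ (≋-sym e)) refl (upper g ℓ∈g q))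
    (least {q} g λ {ℓ} ℓ∈g → ≤-resp (eval-cong ℓ e) refl (upper g ℓ∈g p))

  parallel-≤ : ∀ ℓ ℓ′ p q → slope ℓ ≋ slope ℓ′ → eval ℓ p ≤ eval ℓ′ p → eval ℓ q ≤ eval ℓ′ q
  parallel-≤ ℓ ℓ′ p q e le = ≤-by (diff≥0 (≤-resp (+-congʳ (⟨⟩-congˡ p e)) refl le))
    (trans (solve 4 (λ P Q c c′ → P :+ c′ :- (P :+ c) := Q :+ c′ :- (Q :+ c)) _ ⟨ slope ℓ′ ,
      p ⟩ ⟨ slope ℓ′ , q ⟩ (constant ℓ) (constant ℓ′))
      (+-congˡ (-‿cong (+-congʳ (⟨⟩-congˡ q (≋-sym e))))))

  parallel-≈ : ∀ ℓ ℓ′ p q → slope ℓ ≋ slope ℓ′ → eval ℓ p ≈ eval ℓ′ p → eval ℓ q ≈ eval ℓ′ q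
  parallel-≈ ℓ ℓ′ p q e h = Order.antisym (parallel-≤ ℓ ℓ′ p q e (Order.reflexive h))
    (parallel-≤ ℓ′ ℓ p q (≋-sym e) (Order.reflexive (sym h)))

  infix 4 _≃_at_
  _≃_at_ : Fun 2 → Fun 2 → Point 2 → Set
  φ ≃ ψ at p = Nearby p λ y → φ y ≈ ψ y

  -- A monomial attaining the maximum at p touches from below the affine function that g equals near
  -- p, so the two have the same slope.
  gradient-monomial : ∀ g → GradientAt ⟦ g ⟧ u p → ∃[ ℓ ] ℓ ∈ₘ g × slope ℓ ≋ u × ⟦ g ⟧ ≃ eval ℓ at p
  gradient-monomial {u} {p} g (gradient c g≈) = m , m∈g , m∥u ,
      Nearby-map (λ y h → trans h (sym (parallel-≈ m (affine u c) p y m∥u at-p))) g≈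
    where
    m : Affine 2
    m = proj₁ (attained g p)
    m∈g : m ∈ₘ g
    m∈g = proj₁ (proj₂ (attained g p))
    at-p : eval m p ≈ eval (affine u c) p
    at-p = trans (proj₂ (proj₂ (attained g p))) (Nearby-center g≈)
    m∥u : slope m ≋ u
    m∥u = touching-≋ m (affine u c) at-p (Nearby-map (λ y h → ≤-resp refl h (upper g m∈g y)) g≈)

  -- A monomial equal to g near some point supports g from below everywhere, so
  -- two of them with equal slopes coincide.
  same-monomial : ∀ g → ℓ ∈ₘ g → ⟦ g ⟧ ≃ eval ℓ at p → GradientAt ⟦ g ⟧ (slope ℓ) q →
    ⟦ g ⟧ ≃ eval ℓ at q
  same-monomial {ℓ} {p} {q} g ℓ∈g g≈ℓ gq = let (m , m∈g , m∥ℓ , g≈m) = gradient-monomial g gq in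
    Nearby-map (λ y h → trans h (Order.antisym
        (parallel-≤ m ℓ p y m∥ℓ (≤-resp refl (Nearby-center g≈ℓ) (upper g m∈g p)))
        (parallel-≤ ℓ m q y (≋-sym m∥ℓ) (≤-resp refl (Nearby-center g≈m) (upper g ℓ∈g q)))))
      g≈m

  eval-between : ∀ ℓ p q t → eval ℓ (between p q t) ≈ (1# - t) * eval ℓ p + t * eval ℓ q
  eval-between ℓ p q t = solve 8 (λ b0 b1 c p0 p1 q0 q1 t → dot b0 b1 (p0 :+ t :* (q0 :- p0))
    (p1 :+ t :* (q1 :- p1)) :+ c
    := (:1 :- t) :* (dot b0 b1 p0 p1 :+ c) :+ t :* (dot b0 b1 q0 q1 :+ c))
    _ (slope ℓ 0F) (slope ℓ 1F) (constant ℓ) (p 0F) (p 1F) (q 0F) (q 1F) t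

  convex : ∀ g → ℓ ∈ₘ g → ∀ p q t → 0# ≤ t → t ≤ 1# → ⟦ g ⟧ p ≈ eval ℓ p → ⟦ g ⟧ q ≈ eval ℓ q →
    ⟦ g ⟧ (between p q t) ≈ eval ℓ (between p q t)
  convex {ℓ} g ℓ∈g p q t 0≤t t≤1 gp gq = ≈-by-bound {p = between p q t} g ℓ∈g λ {m} m∈g →
    ≤-by (+-nn (*-nonNeg (diff≥0 t≤1) (diff≥0 (≤-resp refl gp (upper g m∈g p))))
      (*-nonNeg 0≤t (diff≥0 (≤-resp refl gq (upper g m∈g q)))))
      (trans (solve 5 (λ t L L′ M M′ → (:1 :- t) :* (L :- M) :+ t :* (L′ :- M′) :=
        (:1 :- t) :* L :+ t :* L′ :- ((:1 :- t) :* M :+ t :* M′))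
          _ t (eval ℓ p) (eval ℓ q) (eval m p) (eval m q))
        (+-cong (sym (eval-between ℓ p q t)) (-‿cong (sym (eval-between m p q t)))))

  -- A point y near the intermediate point z₀ divides the translates of p and q by y - z₀ in the
  -- same ratio, and these translates are close to p and q.
  convex-near : ∀ g → ℓ ∈ₘ g → ⟦ g ⟧ ≃ eval ℓ at p → ⟦ g ⟧ ≃ eval ℓ at q →
    ∀ t → 0# ≤ t → t ≤ 1# → ⟦ g ⟧ ≃ eval ℓ at between p q t
  convex-near {ℓ} {p} {q} g ℓ∈g (near r 0<r f) (near s 0<s f′) t 0≤t t≤1 = let (ρ , 0<ρ , ρ≤r , ρ≤s) =
                                                                                 lower 0<r 0<s in
    near ρ 0<ρ λ y y∈ → trans (⟦⟧-cong g (split y)) (trans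
      (convex g ℓ∈g (moved y p) (moved y q) t 0≤t t≤1
        (f (moved y p) (Ball-mono p (proj₁ 0<ρ) ρ≤r (moved y p) (moved∈ y p y∈)))
        (f′ (moved y q) (Ball-mono q (proj₁ 0<ρ) ρ≤s (moved y q) (moved∈ y q y∈))))
      (eval-cong ℓ (≋-sym (split y))))
    where
    z₀ : Point 2
    z₀ = between p q t
    moved : Point 2 → Point 2 → Point 2
    moved y x = x +ᵥ (y -ᵥ z₀)
    moved∈ : ∀ {ρ} y x → y ∈ Ball z₀ ρ → moved y x ∈ Ball x ρ
    moved∈ y x = <-resp (⟨⟩-cong shift shift) refl
      where
      shift : y -ᵥ z₀ ≋ moved y x -ᵥ x
      shift i = solve 2 (λ d x → d := x :+ d :- x) _ ((y -ᵥ z₀) i) (x i)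
    split : ∀ y → y ≋ between (moved y p) (moved y q) t
    split y i = solve 4 (λ y p q t → let z = p :+ t :* (q :- p) in
      y := p :+ (y :- z) :+ t :* (q :+ (y :- z) :- (p :+ (y :- z)))) _ (y i) (p i) (q i) t

  -- Linear regions.

  regular⇒gradient : p ∈ ∁ (𝒱 φ) → ∃[ u ] GradientAt φ u p
  regular⇒gradient {p} {φ} reg with em {P = Near p λ B → LinearOn B φ}
  ... | yes (r , 0<r , ℓ , f) = slope ℓ , gradient (constant ℓ) (near r 0<r f)
  ... | no ¬near = ⊥-elim (reg ¬near)

  gradient⇒regular : GradientAt φ u p → p ∈ ∁ (𝒱 φ)
  gradient⇒regular {u = u} (gradient c (near r 0<r f)) singular = singular (r , 0<r , affine u c , f)

  component-gradient : SameComponent (∁ (𝒱 φ)) p q → GradientAt φ u p → GradientAt φ v q → u ≋ v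
  component-gradient (S , connected , S⊆ , p∈S , q∈S) = gradient-constant connected
    (λ z z∈S → regular⇒gradient (S⊆ z∈S)) p∈S q∈S

  Distinct : List (Point 2) → Set
  Distinct = AllPairs λ u v → ¬ (u ≋ v)

  Gradient : Fun 2 → Pred (Point 2) 0ℓ
  Gradient φ u = ∃[ x ] GradientAt φ u x

  all-lookup : ∀ {A : Set} {P : Pred A 0ℓ} {xs} → All P xs → ∀ i → P (List.lookup xs i)
  all-lookup (px ∷ _) zero = px
  all-lookup (_ ∷ pxs) (suc i) = all-lookup pxs i

  distinct-lookup : ∀ {us} → Distinct us → ∀ i j → List.lookup us i ≋ List.lookup us j → i ≡ j
  distinct-lookup (_ ∷ _) zero zero e = ≡.refl
  distinct-lookup (u≉ ∷ _) zero (suc j) e = ⊥-elim (all-lookup u≉ j e)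
  distinct-lookup (u≉ ∷ _) (suc i) zero e = ⊥-elim (all-lookup u≉ i (≋-sym e))
  distinct-lookup (_ ∷ ds) (suc i) (suc j) e = ≡.cong suc (distinct-lookup ds i j e)

  -- The gradient is constant on a component, so sending each listed gradient to the component of a
  -- point that has it is injective.
  gradients≤mComp : ∀ {k us} → mComp φ k → Distinct us → All (Gradient φ) us → length us ℕ.≤ k
  gradients≤mComp {φ} {k} {us} comp distinct grads = Finₚ.injective⇒≤ {f = region} λ {i} {j} e →
    distinct-lookup distinct i j (≋-trans (≋-sym (same i)) (≋-trans (same′ e) (same j)))
    where
    open NumberOfComponents comp hiding (distinct)
    point : ∀ i → Gradient φ (List.lookup us i)
    point = all-lookup grads
    found : ∀ i → ∃[ j ] SameComponent (∁ (𝒱 φ)) (representative j) (proj₁ (point i))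
    found i = exhaustive _ (gradient⇒regular (proj₂ (point i)))
    region : Fin (length us) → Fin k
    region i = proj₁ (found i)
    slope-of : ∀ j → ∃[ u ] GradientAt φ u (representative j)
    slope-of j = regular⇒gradient (inside j)
    same : ∀ i → proj₁ (slope-of (region i)) ≋ List.lookup us i
    same i = component-gradient (proj₂ (found i)) (proj₂ (slope-of (region i))) (proj₂ (point i))
    same′ : ∀ {i j} → region i ≡ region j → proj₁ (slope-of (region i)) ≋ proj₁ (slope-of (region j))
    same′ e = ≋-reflexive (≡.cong (λ k → proj₁ (slope-of k)) e)

  select : (P : Pred (Point 2) 0ℓ) (L : List (Point 2)) →
    ∃[ us ] Distinct us × All P us × (∀ {u} → u ∈ₗ L → P u → Any (u ≋_) us)
  select P [] = [] , [] , [] , λ ()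
  select P (w ∷ L) with select P L
  ... | us , distinct , Ps , complete with em {P = P w} | em {P = Any (w ≋_) us}
  ...   | no ¬Pw | _        = us , distinct , Ps ,
    λ { (here ≡.refl) Pw → ⊥-elim (¬Pw Pw) ; (there i) → complete i }
  ...   | yes Pw | yes w∈us = us , distinct , Ps , λ { (here ≡.refl) _ → w∈us ; (there i) → complete i }
  ...   | yes Pw | no w∉us  = w ∷ us , ¬Any⇒All¬ us w∉us ∷ distinct , Pw ∷ Ps ,
                              λ { (here ≡.refl) _ → here ≋-refl ; (there i) Pu → there (complete i Pu) }

  -- Regions correspond to gradients: points with equal gradients share a monomial, and by convexity
  -- the segment between them stays in the region.
  components : ∀ g → ∃[ us ] Distinct us × All (Gradient ⟦ g ⟧) us × mComp ⟦ g ⟧ (length us)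
  components g with select (Gradient ⟦ g ⟧) (List.map slope (List⁺.toList g))
  ... | us , distinct , grads , complete = us , distinct , grads , record
    { representative = λ i → proj₁ (point i)
    ; inside         = λ i → gradient⇒regular (proj₂ (point i))
    ; exhaustive     = exhaustive
    ; distinct       = λ i j same → distinct-lookup distinct i j
      (component-gradient same (proj₂ (point i)) (proj₂ (point j)))
    }
    where
    point : ∀ i → Gradient ⟦ g ⟧ (List.lookup us i)
    point = all-lookup grads
    connect : GradientAt ⟦ g ⟧ u p → GradientAt ⟦ g ⟧ u q → SameComponent (∁ (𝒱 ⟦ g ⟧)) p q
    connect {u} {p} {q} gp gq = let (ℓ , ℓ∈g , ℓ∥u , g≈ℓ) = gradient-monomial g gp in
      Segment p q , segment-connected p q ,
      (λ { (t , 0≤t , t≤1 , e) → gradient⇒regular (Open-resp (gradient-open ⟦ g ⟧ (slope ℓ)) (≋-sym e)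
           (gradient (constant ℓ) (convex-near g ℓ∈g g≈ℓ
             (same-monomial g ℓ∈g g≈ℓ (gradient-cong (≋-sym ℓ∥u) gq)) t 0≤t t≤1))) }) ,
      start∈Segment p q , end∈Segment p q
    exhaustive : ∀ x → x ∈ ∁ (𝒱 ⟦ g ⟧) → ∃[ i ] SameComponent (∁ (𝒱 ⟦ g ⟧)) (proj₁ (point i)) x
    exhaustive x x∈ = let (u , gx) = regular⇒gradient x∈
                          (ℓ , ℓ∈g , ℓ∥u , _) = gradient-monomial g gx
                          any = complete (∈ₚ.∈-map⁺ slope ℓ∈g) (x , gradient-cong (≋-sym ℓ∥u) gx) in
      Any.index any , connect (proj₂ (point (Any.index any)))
        (gradient-cong (≋-trans (≋-sym ℓ∥u) (Anyₚ.lookup-index any)) gx)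

  -- Behaviour at infinity.

  Eventually : (Carrier → Set) → Set
  Eventually P = ∃[ s ] 0# ≤ s × (∀ t → s ≤ t → P t)

  -- The threshold (1 + b²) / a serves both signs of b, because b + (1 + b²) is always positive.
  grows : 0# < a → ∀ b → Eventually λ t → 0# < b + t * a
  grows {a} 0<a b = let (i , 0<i , ai≈1) = recip 0<a in (1# + b * b) * i , proj₁ (*-pos 0<1+b² 0<i) ,
                          λ t T≤t →
      <-resp refl (+-congˡ (trans (+-congˡ (sym (trans (*-congˡ ai≈1) (*-identityʳ _))))
          (solve 4 (λ t a i M → (t :- M :* i) :* a :+ M :* (a :* i) := t :* a) _ t a i (1# + b * b))))
        (<-resp refl (solve 2 (λ b x → (b :+ (:1 :+ b :* b)) :+ x := b :+ (x :+ (:1 :+ b :* b))) _ b _)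
          (+-pos square (*-nonNeg (diff≥0 T≤t) (proj₁ 0<a))))
    where
    0<1+b² : 0# < 1# + b * b
    0<1+b² = +-pos 0<1 (sq-nn b)
    square : 0# < b + (1# + b * b)
    square with ≤-or-> 0# b
    ... | inj₁ 0≤b = +-pos′ 0≤b 0<1+b²
    ... | inj₂ b<0 = <-resp refl (solve 1
      (λ b → (:0 :- b) :+ (:1 :+ b) :* (:1 :+ b) := b :+ (:1 :+ b :* b)) _ b)
                       (+-pos (diff>0 b<0) (sq-nn (1# + b)))

  eventually-all : ∀ (ls : List (Affine 2)) {P : Affine 2 → Carrier → Set} →
    (∀ {ℓ} → ℓ ∈ₗ ls → Eventually (P ℓ)) → Eventually λ t → ∀ ℓ → ℓ ∈ₗ ls → P ℓ t
  eventually-all [] f = 0# , Order.refl , λ _ _ _ ()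
  eventually-all (_ ∷ ls) f with f (here ≡.refl) | eventually-all ls (λ i → f (there i))
  ... | r , 0≤r , g | s , 0≤s , h = r + s , +-nn 0≤r 0≤s , λ t r+s≤t →
    λ { _ (here ≡.refl) → g t (Order.trans (≤-by 0≤s (solve 2 (λ r s → s := r :+ s :- r) _ r s)) r+s≤t)
      ; ℓ (there i) → h t (Order.trans
        (≤-by 0≤r (solve 2 (λ r s → r := r :+ s :- s) _ r s)) r+s≤t) ℓ i }

  nearby-all : ∀ (ls : List (Affine 2)) {P : Affine 2 → Pred (Point 2) 0ℓ} →
    (∀ {ℓ} → ℓ ∈ₗ ls → Nearby p (P ℓ)) → Nearby p λ y → ∀ ℓ → ℓ ∈ₗ ls → P ℓ y
  nearby-all [] f = near 1# 0<1 λ _ _ _ ()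
  nearby-all (_ ∷ ls) f = Nearby-map (λ y (h , h′) → λ { _ (here ≡.refl) → h ; ℓ (there i) → h′ ℓ i })
    (Nearby-∩ (f (here ≡.refl)) (nearby-all ls (λ i → f (there i))))

  -- Monomials parallel to `ℓ` may exceed it by a constant, so the affine function near p comes from
  -- the monomial attaining the maximum, which the hypothesis forces to be parallel to `ℓ`.
  dominant : ∀ g → ℓ ∈ₘ g → (∀ {m} → m ∈ₘ g → slope m ≋ slope ℓ ⊎ eval m p < eval ℓ p) →
    GradientAt ⟦ g ⟧ (slope ℓ) p
  dominant {ℓ} {p} g ℓ∈g dom with attained g p
  ... | m , m∈g , m≈g with dom m∈g
  ...   | inj₂ m<ℓ = ⊥-elim (<⇒≱ m<ℓ (≤-resp refl (sym m≈g) (upper g ℓ∈g p)))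
  ...   | inj₁ m∥ℓ = gradient-cong m∥ℓ (gradient (constant m)
          (Nearby-map (λ y f → ≈-by-bound {p = y} g m∈g (f _)) (nearby-all (List⁺.toList g) below)))
    where
    below : ∀ {k} → k ∈ₘ g → Nearby p λ y → eval k y ≤ eval m y
    below {k} k∈g with dom k∈g
    ... | inj₁ k∥ℓ = near 1# 0<1 λ y _ → parallel-≤ k m p y (≋-trans k∥ℓ (≋-sym m∥ℓ))
      (≤-resp refl (sym m≈g) (upper g k∈g p))
    ... | inj₂ k<ℓ = Nearby-map (λ _ → proj₁)
      (affine-< k m p (<-≤ k<ℓ (≤-resp refl (sym m≈g) (upper g ℓ∈g p))))

  linearPart : Affine 2 → Affine 2
  linearPart ℓ = affine (slope ℓ) 0#

  infix 9 _∞
  _∞ : TropicalPolynomial 2 → TropicalPolynomial 2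
  g ∞ = List⁺.map linearPart g

  ∈∞⁺ : ∀ g → ℓ ∈ₘ g → linearPart ℓ ∈ₘ g ∞
  ∈∞⁺ (_ ∷ _) i = ∈ₚ.∈-map⁺ linearPart i

  ∈∞⁻ : ∀ g → ℓ ∈ₘ g ∞ → ∃[ m ] m ∈ₘ g × ℓ ≡ linearPart m
  ∈∞⁻ (_ ∷ _) i = ∈ₚ.∈-map⁻ linearPart i

  gradient-monomial∞ : ∀ g → GradientAt ⟦ g ∞ ⟧ u v →
    ∃[ ℓ ] ℓ ∈ₘ g × slope ℓ ≋ u × ⟦ g ∞ ⟧ ≃ eval (linearPart ℓ) at v
  gradient-monomial∞ {u} {v} g gv = let (_ , ℓ∈ , ℓ∥u , g≈) = gradient-monomial (g ∞) gv in from
                                          (∈∞⁻ g ℓ∈) ℓ∥u g≈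
    where
    from : ∃[ m ] m ∈ₘ g × ℓ ≡ linearPart m → slope ℓ ≋ u → ⟦ g ∞ ⟧ ≃ eval ℓ at v →
      ∃[ m ] m ∈ₘ g × slope m ≋ u × ⟦ g ∞ ⟧ ≃ eval (linearPart m) at v
    from (m , m∈g , ≡.refl) m∥u g≈ = m , m∈g , m∥u , g≈

  -- A monomial that ties with `ℓ` at v touches from below a function that is linear there, so it is
  -- parallel to `ℓ`.
  separated : ∀ g → ⟦ g ∞ ⟧ ≃ eval (linearPart ℓ) at v → ∀ {m} → m ∈ₘ g →
    slope m ≋ slope ℓ ⊎ eval (linearPart m) v < eval (linearPart ℓ) v
  separated {ℓ} {v} g g≈ {m} m∈g with ≤-or-> (eval (linearPart ℓ) v) (eval (linearPart m) v)
  ... | inj₂ m<ℓ = inj₂ m<ℓ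
  ... | inj₁ ℓ≤m = inj₁ (touching-≋ (linearPart m) (linearPart ℓ)
        (Order.antisym (≤-resp refl (Nearby-center g≈) (upper (g ∞) (∈∞⁺ g m∈g) v)) ℓ≤m)
        (Nearby-map (λ y h → ≤-resp refl h (upper (g ∞) (∈∞⁺ g m∈g) y)) g≈))

  -- Along the ray from τ in direction v, every monomial not parallel to `ℓ` falls behind it at a
  -- linear rate and is beaten from some point on.
  recession : ∀ g → GradientAt ⟦ g ∞ ⟧ u v → ∀ τ → ∃[ t ] 0# < t × GradientAt ⟦ g ⟧ u (τ +ᵥ t • v)
  recession {u} {v} g gv τ =
    let (ℓ , ℓ∈g , ℓ∥u , g≈) = gradient-monomial∞ g gv
        (s , 0≤s , f) = eventually-all (List⁺.toList g)
          (λ {m} m∈g → below {ℓ} {m} (separated {ℓ} g g≈ m∈g))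
    in s + 1# , +-pos′ 0≤s 0<1 , gradient-cong ℓ∥u
      (dominant g ℓ∈g λ {m} → f (s + 1#) (≤-by (proj₁ 0<1) (solve 1 (λ s → :1 := s :+ :1 :- s) _ s)) m)
    where
    below : ∀ {m} → slope m ≋ slope ℓ ⊎ eval (linearPart m) v < eval (linearPart ℓ) v →
      Eventually λ t → slope m ≋ slope ℓ ⊎ eval m (τ +ᵥ t • v) < eval ℓ (τ +ᵥ t • v)
    below {ℓ} {m} (inj₁ m∥ℓ) = 0# , Order.refl , λ _ _ → inj₁ m∥ℓ
    below {ℓ} {m} (inj₂ m<ℓ) = let (s , 0≤s , f) = grows (diff>0 m<ℓ) (eval ℓ τ - eval m τ) in
      s , 0≤s , λ t s≤t → inj₂ (<-by (f t s≤t)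
        (trans (solve 5 (λ L M t A B → L :- M :+ t :* (A :+ :0 :- (B :+ :0)) := L :+ t :* A :-
          (M :+ t :* B))
            _ (eval ℓ τ) (eval m τ) t ⟨ slope ℓ , v ⟩ ⟨ slope m , v ⟩)
          (+-cong (sym (eval-step ℓ τ v t)) (-‿cong (sym (eval-step m τ v t))))))

  Regular : Fun 2 → Pred (Point 2) 0ℓ
  Regular φ z = ∃[ u ] GradientAt φ u z

  -- Holds when 𝒱 φ is a union of rays from τ.
  Conic : Fun 2 → Point 2 → Set
  Conic φ τ = ∀ v t → 0# < t → Regular φ (τ +ᵥ v) → Regular φ (τ +ᵥ t • v)

  Nearby-translate : ∀ {P : Pred (Point 2) 0ℓ} τ → Nearby (τ +ᵥ v) P → Nearby v λ w → P (τ +ᵥ w)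
  Nearby-translate {v} τ (near r 0<r f) = near r 0<r λ y y∈ → f (τ +ᵥ y)
    (<-resp (⟨⟩-cong (shift y) (shift y)) refl y∈)
    where
    shift : ∀ y → y -ᵥ v ≋ (τ +ᵥ y) -ᵥ (τ +ᵥ v)
    shift y i = solve 3 (λ y v t → y :- v := t :+ y :- (t :+ v)) _ (y i) (v i) (τ i)

  -- The segment from τ + v to τ + tv consists of regular points, hence stays in one region, where
  -- the monomial cannot change.
  conic-ray : ∀ g → Conic ⟦ g ⟧ τ → ℓ ∈ₘ g → ⟦ g ⟧ ≃ eval ℓ at (τ +ᵥ v) →
    ∀ t → 1# ≤ t → ⟦ g ⟧ (τ +ᵥ t • v) ≈ eval ℓ (τ +ᵥ t • v)
  conic-ray {τ} {ℓ} {v} g conic ℓ∈g g≈ℓ t 1≤t = Nearby-center (same-monomial g ℓ∈g g≈ℓ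
      (gradient-cong (≋-sym (gradient-along regular at-v at-tv)) at-tv))
    where
    at-v : GradientAt ⟦ g ⟧ (slope ℓ) (τ +ᵥ v)
    at-v = gradient (constant ℓ) g≈ℓ
    0<t : 0# < t
    0<t = <-≤ 0<1 1≤t
    at-tv : GradientAt ⟦ g ⟧ (proj₁ (conic v t 0<t (slope ℓ , at-v))) (τ +ᵥ t • v)
    at-tv = proj₂ (conic v t 0<t (slope ℓ , at-v))
    regular : ∀ s → 0# ≤ s → s ≤ 1# → Regular ⟦ g ⟧ (between (τ +ᵥ v) (τ +ᵥ t • v) s)
    regular s 0≤s s≤1 = let (w , gw) = conic v (1# + s * (t - 1#))
                              (+-pos 0<1 (*-nonNeg 0≤s (diff≥0 1≤t))) (slope ℓ , at-v) in
      w , Open-resp (gradient-open ⟦ g ⟧ w)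
        (λ i → solve 4 (λ a v t s → a :+ (:1 :+ s :* (t :- :1)) :* v := (a :+ v) :+ s :*
          ((a :+ t :* v) :- (a :+ v))) _ (τ i) (v i) t s) gw

  -- The converse of `recession`: `ℓ` stays maximal along the whole ray through τ + y, whereas a
  -- monomial with larger linear part at y would eventually overtake it. This makes every region of
  -- a conic g visible at infinity.
  blow-up : ∀ g → Conic ⟦ g ⟧ τ → GradientAt ⟦ g ⟧ u (τ +ᵥ v) → GradientAt ⟦ g ∞ ⟧ u v
  blow-up {τ} {u} {v} g conic gv = let (ℓ , ℓ∈g , ℓ∥u , g≈ℓ) = gradient-monomial g gv in
    gradient-cong ℓ∥u (gradient 0# (Nearby-map (linear ℓ∈g) (Nearby-translate τ (Nearby-open g≈ℓ))))
    where
    linear : ℓ ∈ₘ g → ∀ y → ⟦ g ⟧ ≃ eval ℓ at (τ +ᵥ y) → ⟦ g ∞ ⟧ y ≈ eval (linearPart ℓ) y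
    linear {ℓ} ℓ∈g y g≈ℓ = ≈-by-bound {p = y} (g ∞) (∈∞⁺ g ℓ∈g) λ m∈ → below (∈∞⁻ g m∈)
      where
      below : ∀ {m} → ∃[ m′ ] m′ ∈ₘ g × m ≡ linearPart m′ → eval m y ≤ eval (linearPart ℓ) y
      below (m , m∈g , ≡.refl) = ≮⇒≥ λ ℓ<m →
        let (s , 0≤s , f) = grows (diff>0 ℓ<m) (eval m τ - eval ℓ τ)
            s≤s+1 = ≤-by (proj₁ 0<1) (solve 1 (λ s → :1 := s :+ :1 :- s) _ s)
            1≤s+1 = ≤-by 0≤s (solve 1 (λ s → s := s :+ :1 :- :1) _ s)
        in <⇒≱ (<-by (f (s + 1#) s≤s+1)
            (trans (solve 5 (λ L M t A B → M :- L :+ t :* (B :+ :0 :- (A :+ :0)) := M :+ t :* B :-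
              (L :+ t :* A))
                _ (eval ℓ τ) (eval m τ) (s + 1#) ⟨ slope ℓ , y ⟩ ⟨ slope m , y ⟩)
              (+-cong (sym (eval-step m τ y (s + 1#))) (-‿cong (sym (eval-step ℓ τ y (s + 1#)))))))
          (≤-resp refl (conic-ray g conic ℓ∈g g≈ℓ (s + 1#) 1≤s+1) (upper g m∈g (τ +ᵥ (s + 1#) • y)))

  linear-scale : ∀ ℓ t p → eval (linearPart ℓ) (t • p) ≈ t * eval (linearPart ℓ) p
  linear-scale ℓ t p = solve 5 (λ b0 b1 p0 p1 t → dot b0 b1 (t :* p0) (t :* p1) :+ :0 := t :*
    (dot b0 b1 p0 p1 :+ :0))
    _ (slope ℓ 0F) (slope ℓ 1F) (p 0F) (p 1F) t

  *-monoˡ : 0# ≤ a → x ≤ y → a * x ≤ a * y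
  *-monoˡ {a} {x} {y} 0≤a x≤y = ≤-by (*-nonNeg 0≤a (diff≥0 x≤y))
    (solve 3 (λ a x y → a :* (y :- x) := a :* y :- a :* x) _ a x y)

  homogeneous : ∀ g t p → 0# ≤ t → ⟦ g ∞ ⟧ (t • p) ≈ t * ⟦ g ∞ ⟧ p
  homogeneous g t p 0≤t = Order.antisym
    (least {p = t • p} (g ∞) λ {ℓ} ℓ∈ → below (∈∞⁻ g ℓ∈) ℓ∈)
    (above (attained (g ∞) p))
    where
    below : ∃[ m ] m ∈ₘ g × ℓ ≡ linearPart m → ℓ ∈ₘ g ∞ → eval ℓ (t • p) ≤ t * ⟦ g ∞ ⟧ p
    below (m , _ , ≡.refl) ℓ∈ = ≤-resp (sym (linear-scale m t p)) refl (*-monoˡ 0≤t (upper (g ∞) ℓ∈ p))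
    above : ∃[ ℓ ] ℓ ∈ₘ g ∞ × eval ℓ p ≈ ⟦ g ∞ ⟧ p → t * ⟦ g ∞ ⟧ p ≤ ⟦ g ∞ ⟧ (t • p)
    above (ℓ , ℓ∈ , e) with ∈∞⁻ g ℓ∈
    ... | m , _ , ≡.refl = ≤-resp (trans (linear-scale m t p) (*-congˡ e)) refl (upper (g ∞) ℓ∈ (t • p))

  constants-bounded : ∀ (ls : List (Affine 2)) → ∃[ c ] 0# ≤ c ×
    (∀ {ℓ} → ℓ ∈ₗ ls → constant ℓ ≤ c × - constant ℓ ≤ c)
  constants-bounded [] = 0# , Order.refl , λ ()
  constants-bounded (ℓ ∷ ls) with constants-bounded ls | Order.total 0# (constant ℓ)
  ... | c , 0≤c , f | inj₁ 0≤k = c + constant ℓ , +-nn 0≤c 0≤k ,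
    λ { (here ≡.refl) → ≤-by 0≤c (solve 2 (λ c k → c := c :+ k :- k) _ c (constant ℓ))
                      , ≤-by (+-nn (+-nn 0≤c 0≤k) 0≤k)
                        (solve 2 (λ c k → c :+ k :+ k := c :+ k :- (:- k)) _ c (constant ℓ))
      ; (there i) → let step = ≤-by 0≤k (solve 2 (λ c k → k := c :+ k :- c) _ c (constant ℓ)) in
          Order.trans (proj₁ (f i)) step , Order.trans (proj₂ (f i)) step }
  ... | c , 0≤c , f | inj₂ k≤0 = c - constant ℓ , +-nn 0≤c 0≤-k ,
    λ { (here ≡.refl) → ≤-by (+-nn (+-nn 0≤c 0≤-k) 0≤-k)
      (solve 2 (λ c k → c :- k :- k := c :- k :- k) _ c (constant ℓ))
                      , ≤-by 0≤c (solve 2 (λ c k → c := c :- k :- (:- k)) _ c (constant ℓ))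
      ; (there i) → let step = ≤-by 0≤-k (solve 2 (λ c k → :- k := c :- k :- c) _ c (constant ℓ)) in
          Order.trans (proj₁ (f i)) step , Order.trans (proj₂ (f i)) step }
    where
    0≤-k : 0# ≤ - constant ℓ
    0≤-k = ≤-resp refl (+-identityˡ _) (diff≥0 k≤0)

  close-to-recession : ∀ g → ∃[ c ] 0# ≤ c × (∀ p → ⟦ g ∞ ⟧ p ≤ ⟦ g ⟧ p + c × ⟦ g ⟧ p ≤ ⟦ g ∞ ⟧ p + c)
  close-to-recession g = let (c , 0≤c , f) = constants-bounded (List⁺.toList g) in
    c , 0≤c , λ p →
      least {p = p} (g ∞) (λ ℓ∈ → lower-bound c f p (∈∞⁻ g ℓ∈)) ,
      least {p = p} g λ {ℓ} ℓ∈g → Order.trans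
        (≤-by (diff≥0 (proj₁ (f ℓ∈g))) (solve 3
          (λ b c k → c :- k := b :+ :0 :+ c :- (b :+ k)) _ ⟨ slope ℓ , p ⟩ c (constant ℓ)))
        (+-monoˡ-≤ c (upper (g ∞) (∈∞⁺ g ℓ∈g) p))
    where
    +-monoˡ-≤ : ∀ z → x ≤ y → x + z ≤ y + z
    +-monoˡ-≤ z x≤y = ≤-resp (+-comm _ _) (+-comm _ _) (+-monoʳ-≤ z x≤y)
    lower-bound : ∀ c → (∀ {ℓ} → ℓ ∈ₘ g → constant ℓ ≤ c × - constant ℓ ≤ c) → ∀ p →
      ∃[ m ] m ∈ₘ g × ℓ ≡ linearPart m → eval ℓ p ≤ ⟦ g ⟧ p + c
    lower-bound c f p (m , m∈g , ≡.refl) = Order.trans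
      (≤-by (diff≥0 (proj₂ (f m∈g))) (solve 3
        (λ b c k → c :- (:- k) := b :+ k :+ c :- (b :+ :0)) _ ⟨ slope m , p ⟩ c (constant m)))
      (+-monoˡ-≤ c (upper g m∈g p))

  -- Each polynomial stays within a constant of its recession function, so the excess of the left
  -- side over the right is bounded above. A positive excess at p would grow without bound along the
  -- multiples of p.
  recession-≤ : ∀ g h g′ h′ → (∀ x → ⟦ g ⟧ x - ⟦ h ⟧ x ≈ ⟦ g′ ⟧ x - ⟦ h′ ⟧ x) →
    ∀ p → ⟦ g ∞ ⟧ p + ⟦ h′ ∞ ⟧ p ≤ ⟦ g′ ∞ ⟧ p + ⟦ h ∞ ⟧ p
  recession-≤ g h g′ h′ equal p =
    let (c₁ , _ , f₁) = close-to-recession g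
        (c₂ , _ , f₂) = close-to-recession h′
        (c₃ , _ , f₃) = close-to-recession g′
        (c₄ , _ , f₄) = close-to-recession h
    in ≮⇒≥ λ lt → let (t , 0≤t , f) = grows (diff>0 lt) (- (c₁ + c₂ + (c₃ + c₄)))
                      q = t • p in
      0<+⇒ (f t Order.refl)
        (+-nn (+-nn (diff≥0 (proj₁ (f₁ q))) (diff≥0 (proj₁ (f₂ q))))
          (+-nn (diff≥0 (proj₂ (f₃ q))) (diff≥0 (proj₂ (f₄ q)))))
        (trans (+-congʳ (+-congˡ (trans
          (solve 5 (λ t A B C D → t :* (A :+ B :- (C :+ D)) := t :* A :+ t :* B :- (t :* C :+ t :* D))
                                         _ t (⟦ g ∞ ⟧ p) (⟦ h′ ∞ ⟧ p) (⟦ g′ ∞ ⟧ p) (⟦ h ∞ ⟧ p))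
            (+-cong (+-cong (sym (homogeneous g t p 0≤t)) (sym (homogeneous h′ t p 0≤t)))
              (-‿cong (+-cong (sym (homogeneous g′ t p 0≤t)) (sym (homogeneous h t p 0≤t))))))))
          (collect c₁ c₂ c₃ c₄ (⟦ g ∞ ⟧ q) (⟦ h′ ∞ ⟧ q) (⟦ g′ ∞ ⟧ q) (⟦ h ∞ ⟧ q) (⟦ g ⟧ q) (⟦ h′ ⟧ q)
            (⟦ g′ ⟧ q) (⟦ h ⟧ q) (equal q)))
    where
    collect : ∀ c₁ c₂ c₃ c₄ A B C D a b c d → a - d ≈ c - b →
      - (c₁ + c₂ + (c₃ + c₄)) + (A + B - (C + D)) +
        ((a + c₁ - A + (b + c₂ - B)) + ((C + c₃ - c) + (D + c₄ - d))) ≈ 0#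
    collect c₁ c₂ c₃ c₄ A B C D a b c d e = trans (solve 12 (λ c₁ c₂ c₃ c₄ A B C D a b c d →
          :- (c₁ :+ c₂ :+ (c₃ :+ c₄)) :+ (A :+ B :- (C :+ D)) :+
            ((a :+ c₁ :- A :+ (b :+ c₂ :- B)) :+ ((C :+ c₃ :- c) :+ (D :+ c₄ :- d)))
          := a :- d :- (c :- b)) _ c₁ c₂ c₃ c₄ A B C D a b c d)
      (trans (+-congʳ e) (-‿inverseʳ _))

  recession-identity : ∀ g h g′ h′ → (∀ x → ⟦ g ⟧ x - ⟦ h ⟧ x ≈ ⟦ g′ ⟧ x - ⟦ h′ ⟧ x) →
    ∀ p → ⟦ g ∞ ⟧ p + ⟦ h′ ∞ ⟧ p ≈ ⟦ g′ ∞ ⟧ p + ⟦ h ∞ ⟧ p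
  recession-identity g h g′ h′ equal p = Order.antisym (recession-≤ g h g′ h′ equal p)
    (recession-≤ g′ h′ g h (sym ∘ equal) p)

  -- Edges of the Newton polygon.

  lin : Point 2 → Affine 2
  lin b = affine b 0#

  lin-cong : u ≋ v → ∀ p → eval (lin u) p ≈ eval (lin v) p
  lin-cong e p = +-congʳ (⟨⟩-congˡ p e)

  J-perp : ∀ (v : Point 2) → ⟨ J v , v ⟩ ≈ 0#
  J-perp v = solve 2 (λ a b → dot (:- b) a a b := :0) _ (v 0F) (v 1F)

  J-neg : ∀ (v w : Point 2) → ⟨ J w , v ⟩ ≈ - ⟨ J v , w ⟩
  J-neg v w = solve 4 (λ a b c d → dot (:- d) c a b := :- dot (:- b) a c d) _ (v 0F) (v 1F) (w 0F)
    (w 1F)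

  perp⇒multiple : ∀ (w v : Point 2) → ¬ (v ≋ 0ᵥ) → ⟨ w , v ⟩ ≈ 0# → ∃[ t ] w ≋ t • J v
  perp⇒multiple w v v≉0 e = let (i , _ , Ni≈1) = recip (‖ v ‖²-pos v≉0) in
    ⟨ w , J v ⟩ * i , ext₂
      (trans (scale i Ni≈1 (w 0F)) (sym
        (trans (solve 5 (λ a b c d i → dot a b (:- d) c :* i :* (:- d) :=
          (a :* dot c d c d :- c :* dot a b c d) :* i) _ (w 0F) (w 1F) (v 0F) (v 1F) i)
        (*-congʳ (trans (+-congˡ (-‿cong (trans (*-congˡ e) (zeroʳ _))))
          (trans (+-congˡ R.-0#≈0#) (+-identityʳ _)))))))
      (trans (scale i Ni≈1 (w 1F)) (sym
        (trans (solve 5 (λ a b c d i → dot a b (:- d) c :* i :* c :=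
          (b :* dot c d c d :- d :* dot a b c d) :* i) _ (w 0F) (w 1F) (v 0F) (v 1F) i)
        (*-congʳ (trans (+-congˡ (-‿cong (trans (*-congˡ e) (zeroʳ _))))
          (trans (+-congˡ R.-0#≈0#) (+-identityʳ _)))))))
    where
    scale : ∀ i → ⟨ v , v ⟩ * i ≈ 1# → ∀ x → x ≈ x * ⟨ v , v ⟩ * i
    scale i e x = sym (trans (*-assoc x ⟨ v , v ⟩ i) (trans (*-congˡ e) (*-identityʳ x)))

  -- Meant for n orthogonal to v, so that n cuts every ball around v in half.
  record HalfSlope (φ : Fun 2) (n v b : Point 2) : Set where
    constructor half-slope
    field
      linear-near : Nearby v λ y → 0# ≤ ⟨ n , y ⟩ → φ y ≈ eval (lin b) y

  open HalfSlope public

  half-slope-≋ : ∀ n ℓ ℓ′ → ⟨ n , v ⟩ ≈ 0# → Nearby v (λ y → 0# ≤ ⟨ n , y ⟩ → eval ℓ y ≈ eval ℓ′ y) →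
    slope ℓ ≋ slope ℓ′
  half-slope-≋ {v} n ℓ ℓ′ n⊥v h = slope-≋ {v} n ℓ ℓ′
    (Nearby-map (λ y f le → f (≤-resp refl (recentre y) le)) h)
    where
    recentre : ∀ y → ⟨ n , y -ᵥ v ⟩ ≈ ⟨ n , y ⟩
    recentre y = trans (solve 6 (λ a b c d e f → dot a b (c :- e) (d :- f) :=
      dot a b c d :- dot a b e f) _ (n 0F) (n 1F) (y 0F) (y 1F) (v 0F) (v 1F))
      (trans (+-congˡ (trans (-‿cong n⊥v) R.-0#≈0#)) (+-identityʳ _))

  half-unique : ∀ n → ⟨ n , v ⟩ ≈ 0# → HalfSlope φ n v p → HalfSlope φ n v q → p ≋ q
  half-unique {p = p} {q = q} n n⊥v (half-slope h) (half-slope h′) = half-slope-≋ n (lin p) (lin q) n⊥v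
    (Nearby-map (λ y (f , f′) le → trans (sym (f le)) (f′ le)) (Nearby-∩ h h′))

  half-gradient-≋ : ∀ n → ⟨ n , v ⟩ ≈ 0# → HalfSlope φ n v p → GradientAt φ q v → p ≋ q
  half-gradient-≋ {p = p} {q = q} n n⊥v (half-slope h) (gradient c h′) = half-slope-≋ n (lin p)
    (affine q c) n⊥v
    (Nearby-map (λ y (f , e) le → trans (sym (f le)) e) (Nearby-∩ h h′))

  half-cong : ∀ {n} → (∀ x → φ x ≈ ψ x) → HalfSlope φ n v p → HalfSlope ψ n v p
  half-cong e (half-slope h) = half-slope (Nearby-map (λ y f le → trans (sym (e y)) (f le)) h)

  half-sum : ∀ {n} → HalfSlope φ n v p → HalfSlope ψ n v q → HalfSlope (λ x → φ x + ψ x) n v (p +ᵥ q)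
  half-sum {p = p} {q = q} (half-slope h) (half-slope h′) = half-slope
    (Nearby-map (λ y (f , f′) le → trans (+-cong (f le) (f′ le))
    (solve 6 (λ a b c d e f → (dot a b e f :+ :0) :+ (dot c d e f :+ :0) := dot (a :+ c)
      (b :+ d) e f :+ :0) _ (p 0F) (p 1F) (q 0F) (q 1F) (y 0F) (y 1F))) (Nearby-∩ h h′))

  half-difference : ∀ {n} → HalfSlope φ n v p → HalfSlope ψ n v q → HalfSlope (λ x → φ x - ψ x) n v
    (p -ᵥ q)
  half-difference {p = p} {q = q} (half-slope h) (half-slope h′) = half-slope
    (Nearby-map (λ y (f , f′) le → trans (+-cong (f le) (-‿cong (f′ le)))
    (solve 6 (λ a b c d e f → (dot a b e f :+ :0) :- (dot c d e f :+ :0) := dot (a :- c)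
      (b :- d) e f :+ :0) _ (p 0F) (p 1F) (q 0F) (q 1F) (y 0F) (y 1F))) (Nearby-∩ h h′))

  half-gradient : ∀ n → ⟨ n , v ⟩ ≈ 0# → 0# < ⟨ n , q ⟩ → HalfSlope φ n v p →
    ∃[ ε ] 0# < ε × GradientAt φ p (v +ᵥ ε • q)
  half-gradient {v} {q} n n⊥v 0<nq (half-slope h) =
    let (ε , 0<ε , f) = Nearby-along q (Nearby-open h)
        positive = <-resp refl (sym (trans (eval-step (lin n) v q ε)
          (trans (+-congʳ (trans (+-identityʳ _) n⊥v)) (+-identityˡ _)))) (*-pos 0<ε 0<nq)
    in ε , 0<ε , gradient 0# (Nearby-map
         (λ y (g , 0<ny) → g (≤-resp refl (+-identityʳ _) (proj₁ 0<ny)))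
         (Nearby-∩ (f ε Order.refl) (affine-pos (lin n) (v +ᵥ ε • q) positive)))

  -- For the support function of a polygon, `b⁺` and `b⁻` are the ends of the face that is maximal
  -- in direction v; `b⁺` is the gradient just to the left of v and `b⁻` the one just to the right.
  -- The face is measured in units of J v, so `width` is its length divided by |v|, and zero if the
  -- face is a vertex.
  record Edge (φ : Fun 2) (v : Point 2) : Set where
    field
      b⁺ b⁻  : Point 2
      width  : Carrier
      0≤width : 0# ≤ width
      edge   : b⁺ ≋ b⁻ +ᵥ width • J v
      left   : HalfSlope φ (J v) v b⁺
      right  : HalfSlope φ (-ᵥ J v) v b⁻
      below⁺ : ∀ y → eval (lin b⁺) y ≤ φ y
      below⁻ : ∀ y → eval (lin b⁻) y ≤ φ y

  open Edge public

  -J-perp : ∀ (v : Point 2) → ⟨ -ᵥ J v , v ⟩ ≈ 0#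
  -J-perp v = solve 2 (λ a b → dot (:- (:- b)) (:- a) a b := :0) _ (v 0F) (v 1F)

  -J≥0⇒J≤0 : ∀ (v y : Point 2) → 0# ≤ ⟨ -ᵥ J v , y ⟩ → ⟨ J v , y ⟩ ≤ 0#
  -J≥0⇒J≤0 v y le = ≤-by le (solve 4
    (λ a b c d → dot (:- (:- b)) (:- a) c d := :0 :- dot (:- b) a c d) _ (v 0F) (v 1F) (y 0F) (y 1F))

  J≤0⇒-J≥0 : ∀ (v y : Point 2) → ⟨ J v , y ⟩ ≤ 0# → 0# ≤ ⟨ -ᵥ J v , y ⟩
  J≤0⇒-J≥0 v y le = ≤-resp refl (solve 4
    (λ a b c d → :0 :- dot (:- b) a c d := dot (:- (:- b)) (:- a) c d) _ (v 0F) (v 1F) (y 0F) (y 1F))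
      (diff≥0 le)

  lin-shift : ∀ b v t y → eval (lin (b +ᵥ t • J v)) y ≈ eval (lin b) y + t * ⟨ J v , y ⟩
  lin-shift b v t y = solve 7 (λ b0 b1 v0 v1 t y0 y1 → dot (b0 :+ t :* (:- v1))
    (b1 :+ t :* v0) y0 y1 :+ :0
     := dot b0 b1 y0 y1 :+ :0 :+ t :* dot (:- v1) v0 y0 y1) _ (b 0F) (b 1F) (v 0F) (v 1F) t (y 0F)
       (y 1F)

  edge-constant : ∀ ℓ {v} → Edge (eval (linearPart ℓ)) v
  edge-constant ℓ {v} = record
    { b⁺ = slope ℓ ; b⁻ = slope ℓ ; width = 0# ; 0≤width = Order.refl
    ; edge = λ i → solve 2 (λ b j → b := b :+ :0 :* j) _ (slope ℓ i) (J v i)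
    ; left = half-slope (near 1# 0<1 λ _ _ _ → refl) ; right = half-slope (near 1# 0<1 λ _ _ _ → refl)
    ; below⁺ = λ _ → Order.refl ; below⁻ = λ _ → Order.refl }

  module _ {φ : Fun 2} (b v : Point 2) (v≉0 : ¬ (v ≋ 0ᵥ)) (E : Edge φ v) where
    private
      φ′ : Fun 2
      φ′ y = eval (lin b) y ⊔ φ y
      φ≤φ′ : ∀ y → φ y ≤ φ′ y
      φ≤φ′ y = x≤y⊔x (eval (lin b) y) (φ y)
      b≤φ′ : ∀ y → eval (lin b) y ≤ φ′ y
      b≤φ′ y = x≤x⊔y (eval (lin b) y) (φ y)

      at-v : φ v ≈ eval (lin (b⁺ E)) v
      at-v = Nearby-center (linear-near (left E)) (Order.reflexive (sym (J-perp v)))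
      at-v⁻ : φ v ≈ eval (lin (b⁻ E)) v
      at-v⁻ = Nearby-center (linear-near (right E)) (Order.reflexive (sym (-J-perp v)))

      keep : ∀ {n u} → HalfSlope φ n v u → Nearby v
        (λ y → 0# ≤ ⟨ n , y ⟩ → eval (lin b) y ≤ eval (lin u) y) → HalfSlope φ′ n v u
      keep (half-slope h) h′ = half-slope
        (Nearby-map (λ y (f , le) 0≤ → trans (x≤y⇒x⊔y≈y (≤-resp refl (sym (f 0≤)) (le 0≤))) (f 0≤))
          (Nearby-∩ h h′))
      replace : ∀ {n u} → HalfSlope φ n v u → Nearby v
        (λ y → 0# ≤ ⟨ n , y ⟩ → eval (lin u) y ≤ eval (lin b) y) → HalfSlope φ′ n v b
      replace (half-slope h) h′ = half-slope
        (Nearby-map (λ y (f , le) 0≤ → x≤y⇒y⊔x≈y (≤-resp (sym (f 0≤)) refl (le 0≤))) (Nearby-∩ h h′))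
      everywhere : ∀ {P : Pred (Point 2) 0ℓ} → (∀ y → P y) → Nearby v P
      everywhere f = near 1# 0<1 λ y _ → f y
      nn-nonpos : 0# ≤ a → x ≤ 0# → a * x ≤ 0#
      nn-nonpos {a} {x} 0≤a x≤0 = ≤-by (*-nonNeg 0≤a (diff≥0 x≤0))
        (solve 2 (λ a x → a :* (:0 :- x) := :0 :- a :* x) _ a x)

      below : eval (lin b) v < φ v → Edge φ′ v
      below lt = record
        { b⁺ = b⁺ E ; b⁻ = b⁻ E ; width = width E ; 0≤width = 0≤width E ; edge = edge E
        ; left  = keep (left E) (Nearby-map (λ _ lt _ → proj₁ lt)
          (affine-< (lin b) (lin (b⁺ E)) v (<-resp refl at-v lt)))
        ; right = keep (right E) (Nearby-map (λ _ lt _ → proj₁ lt)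
          (affine-< (lin b) (lin (b⁻ E)) v (<-resp refl at-v⁻ lt)))
        ; below⁺ = λ y → Order.trans (below⁺ E y) (φ≤φ′ y)
        ; below⁻ = λ y → Order.trans (below⁻ E y) (φ≤φ′ y) }

      above : φ v < eval (lin b) v → Edge φ′ v
      above lt = record
        { b⁺ = b ; b⁻ = b ; width = 0# ; 0≤width = Order.refl
        ; edge = λ i → solve 2 (λ b j → b := b :+ :0 :* j) _ (b i) (J v i)
        ; left  = replace (left E) (Nearby-map (λ _ lt _ → proj₁ lt)
          (affine-< (lin (b⁺ E)) (lin b) v (<-resp at-v refl lt)))
        ; right = replace (right E) (Nearby-map (λ _ lt _ → proj₁ lt)
          (affine-< (lin (b⁻ E)) (lin b) v (<-resp at-v⁻ refl lt)))
        ; below⁺ = b≤φ′ ; below⁻ = b≤φ′ }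

      module _ (t : Carrier) (b≋ : b ≋ b⁺ E +ᵥ t • J v) where
        s : Carrier
        s = width E
        b≋⁻ : b ≋ b⁻ E +ᵥ (s + t) • J v
        b≋⁻ i = trans (b≋ i) (trans (+-congʳ (edge E i))
          (solve 4 (λ b s t j → b :+ s :* j :+ t :* j := b :+ (s :+ t) :* j) _ (b⁻ E i) s t (J v i)))
        over⁺ : ∀ y → eval (lin b) y ≈ eval (lin (b⁺ E)) y + t * ⟨ J v , y ⟩
        over⁺ y = trans (lin-cong b≋ y) (lin-shift (b⁺ E) v t y)
        over⁻ : ∀ y → eval (lin b) y ≈ eval (lin (b⁻ E)) y + (s + t) * ⟨ J v , y ⟩
        over⁻ y = trans (lin-cong b≋⁻ y) (lin-shift (b⁻ E) v (s + t) y)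
        difference : ∀ L x → x ≈ L + x - L
        difference L x = solve 2 (λ L x → x := L :+ x :- L) _ L x
        difference′ : ∀ L x → 0# - x ≈ L - (L + x)
        difference′ L x = solve 2 (λ L x → :0 :- x := L :- (L :+ x)) _ L x

        -- The cases are: `b` at or beyond `b⁺` on the line of the edge, `b` between the ends, and
        -- `b` beyond `b⁻`. Only the outer two move an end.
        on-edge : Edge φ′ v
        on-edge with ≤-or-> 0# t | ≤-or-> 0# (s + t)
        ... | inj₁ 0≤t | _ = record
          { b⁺ = b ; b⁻ = b⁻ E ; width = s + t ; 0≤width = +-nn (0≤width E) 0≤t ; edge = b≋⁻
          ; left  = replace (left E) (everywhere λ y 0≤ → ≤-by (*-nonNeg 0≤t 0≤)
            (trans (difference _ _) (+-congʳ (sym (over⁺ y)))))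
          ; right = keep (right E) (everywhere λ y 0≤ → ≤-by
            (diff≥0 (nn-nonpos (+-nn (0≤width E) 0≤t) (-J≥0⇒J≤0 v y 0≤)))
                      (trans (difference′ _ _) (+-congˡ (-‿cong (sym (over⁻ y))))))
          ; below⁺ = b≤φ′ ; below⁻ = λ y → Order.trans (below⁻ E y) (φ≤φ′ y) }
        ... | inj₂ t<0 | inj₁ 0≤s+t = record
          { b⁺ = b⁺ E ; b⁻ = b⁻ E ; width = width E ; 0≤width = 0≤width E ; edge = edge E
          ; left  = keep (left E) (everywhere λ y 0≤ → ≤-by (*-nonNeg (proj₁ (diff>0 t<0)) 0≤)
                      (trans (solve 3 (λ L t x → (:0 :- t) :* x := L :- (L :+ t :* x)) _
                        (eval (lin (b⁺ E)) y) t ⟨ J v , y ⟩) (+-congˡ (-‿cong (sym (over⁺ y))))))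
          ; right = keep (right E) (everywhere λ y 0≤ → ≤-by
            (diff≥0 (nn-nonpos 0≤s+t (-J≥0⇒J≤0 v y 0≤)))
                      (trans (difference′ _ _) (+-congˡ (-‿cong (sym (over⁻ y))))))
          ; below⁺ = λ y → Order.trans (below⁺ E y) (φ≤φ′ y) ; below⁻ = λ y → Order.trans (below⁻ E y)
            (φ≤φ′ y) }
        ... | inj₂ t<0 | inj₂ s+t<0 = record
          { b⁺ = b⁺ E ; b⁻ = b ; width = - t ; 0≤width = ≤-resp refl (+-identityˡ _)
            (proj₁ (diff>0 t<0))
          ; edge = λ i → trans (solve 3 (λ b t j → b := b :+ t :* j :+ (:- t) :* j) _ (b⁺ E i) t
            (J v i)) (+-congʳ (sym (b≋ i)))
          ; left  = keep (left E) (everywhere λ y 0≤ → ≤-by (*-nonNeg (proj₁ (diff>0 t<0)) 0≤)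
                      (trans (solve 3 (λ L t x → (:0 :- t) :* x := L :- (L :+ t :* x)) _
                        (eval (lin (b⁺ E)) y) t ⟨ J v , y ⟩) (+-congˡ (-‿cong (sym (over⁺ y))))))
          ; right = replace (right E) (everywhere λ y 0≤ → ≤-by
            (*-nonNeg (proj₁ (diff>0 s+t<0)) (diff≥0 (-J≥0⇒J≤0 v y 0≤)))
                      (trans (solve 3 (λ L r x → (:0 :- r) :* (:0 :- x) := L :+ r :* x :- L) _
                        (eval (lin (b⁻ E)) y) (s + t) ⟨ J v , y ⟩) (+-congʳ (sym (over⁻ y)))))
          ; below⁺ = λ y → Order.trans (below⁺ E y) (φ≤φ′ y) ; below⁻ = b≤φ′ }

    edge-⊔ : Edge φ′ v
    edge-⊔ with tri (eval (lin b) v) (φ v)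
    ... | inj₁ lt        = below lt
    ... | inj₂ (inj₂ gt) = above gt
    -- A tie at v makes `b -ᵥ b⁺ E` orthogonal to v, which puts `b` on the line of the edge.
    ... | inj₂ (inj₁ eq) = let (t , e) = perp⇒multiple (b -ᵥ b⁺ E) v v≉0 perp in
          on-edge t λ i → trans (solve 2 (λ b b′ → b := b′ :+ (b :- b′)) _ (b i) (b⁺ E i))
            (+-congˡ (e i))
      where
      perp : ⟨ b -ᵥ b⁺ E , v ⟩ ≈ 0#
      perp = trans (⟨⟩-subˡ b (b⁺ E) v)
        (trans (solve 2 (λ x y → x :- y := x :+ :0 :- (y :+ :0)) _ ⟨ b , v ⟩ ⟨ b⁺ E , v ⟩)
        (trans (+-congʳ (trans eq at-v)) (-‿inverseʳ _)))

  edge-at : ∀ g v → ¬ (v ≋ 0ᵥ) → Edge ⟦ g ∞ ⟧ v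
  edge-at (ℓ ∷ ls) v v≉0 = go ℓ ls
    where
    go : ∀ ℓ ls → Edge ⟦ (ℓ ∷ ls) ∞ ⟧ v
    go ℓ []        = edge-constant ℓ
    go ℓ (ℓ′ ∷ ls) = edge-⊔ (slope ℓ) v v≉0 (go ℓ′ ls)

  multiple-unique : ¬ (p ≋ 0ᵥ) → x • p ≋ y • p → x ≈ y
  multiple-unique {p} {x} {y} p≉0 e = trans (solve 2 (λ x y → x := y :+ (x :- y)) _ x y)
    (trans (+-congˡ (nz-cancel (λ N≈0 → proj₂ (‖ p ‖²-pos p≉0) (sym N≈0)) zero-product))
      (+-identityʳ y))
    where
    zero-product : ⟨ p , p ⟩ * (x - y) ≈ 0#
    zero-product = trans (solve 4 (λ a b x y → dot a b a b :* (x :- y) := dot (x :* a)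
      (x :* b) a b :- dot (y :* a) (y :* b) a b) _ (p 0F) (p 1F) x y)
      (trans (+-congʳ (⟨⟩-congˡ p e)) (-‿inverseʳ _))

  J≉0 : ¬ (v ≋ 0ᵥ) → ¬ (J v ≋ 0ᵥ)
  J≉0 v≉0 e = v≉0 (ext₂ (e 1F) (trans (sym (R.-‿involutive _)) (trans (-‿cong (e 0F)) R.-0#≈0#)))

  b⁺-unique : (E E′ : Edge φ v) → b⁺ E ≋ b⁺ E′
  b⁺-unique {v = v} E E′ = half-unique (J v) (J-perp v) (left E) (left E′)

  -- Faces of Minkowski sums are sums of faces: on each side of v the ends are one-sided gradients,
  -- hence additive and unique, and their differences are the widths times J v.
  width-sum : ∀ {φ₁ φ₂ φ₃ φ₄} → ¬ (v ≋ 0ᵥ) → (E₁ : Edge φ₁ v) (E₂ : Edge φ₂ v) (E₃ : Edge φ₃ v)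
    (E₄ : Edge φ₄ v) →
    (∀ x → φ₁ x + φ₂ x ≈ φ₃ x + φ₄ x) → width E₁ + width E₂ ≈ width E₃ + width E₄
  width-sum {v} v≉0 E₁ E₂ E₃ E₄ e = multiple-unique (J≉0 v≉0) λ i →
    trans (split E₁ E₂ i) (trans (+-cong (plus i) (-‿cong (minus i))) (sym (split E₃ E₄ i)))
    where
    split : ∀ {φ ψ} (E : Edge φ v) (E′ : Edge ψ v) → (width E + width E′) • J v ≋ (b⁺ E +ᵥ b⁺ E′) -ᵥ
      (b⁻ E +ᵥ b⁻ E′)
    split E E′ i = trans (solve 5 (λ s t j a b → (s :+ t) :* j := (a :+ s :* j) :+ (b :+ t :* j) :-
      (a :+ b)) _ (width E) (width E′) (J v i) (b⁻ E i) (b⁻ E′ i))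
      (+-congʳ (+-cong (sym (edge E i)) (sym (edge E′ i))))
    plus : b⁺ E₁ +ᵥ b⁺ E₂ ≋ b⁺ E₃ +ᵥ b⁺ E₄
    plus = half-unique (J v) (J-perp v) (half-cong e (half-sum (left E₁) (left E₂)))
      (half-sum (left E₃) (left E₄))
    minus : b⁻ E₁ +ᵥ b⁻ E₂ ≋ b⁻ E₃ +ᵥ b⁻ E₄
    minus = half-unique (-ᵥ J v) (-J-perp v) (half-cong e (half-sum (right E₁) (right E₂)))
      (half-sum (right E₃) (right E₄))

  flat : (E : Edge φ v) → width E ≈ 0# → b⁺ E ≋ b⁻ E
  flat {v = v} E w≈0 i = trans (edge E i)
    (trans (+-congˡ (trans (*-congʳ w≈0) (zeroˡ _))) (+-identityʳ _))

  halves-linear : HalfSlope φ (J v) v p → HalfSlope φ (-ᵥ J v) v q → p ≋ q → φ ≃ eval (lin p) at v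
  halves-linear {φ} {v} {p} {q} (half-slope h) (half-slope h′) p≋q =
    Nearby-map (λ y (f , f′) → cases y f f′ (Order.total 0# ⟨ J v , y ⟩)) (Nearby-∩ h h′)
    where
    cases : ∀ y → (0# ≤ ⟨ J v , y ⟩ → φ y ≈ eval (lin p) y) →
      (0# ≤ ⟨ -ᵥ J v , y ⟩ → φ y ≈ eval (lin q) y) →
      0# ≤ ⟨ J v , y ⟩ ⊎ ⟨ J v , y ⟩ ≤ 0# → φ y ≈ eval (lin p) y
    cases y f f′ (inj₁ le) = f le
    cases y f f′ (inj₂ ge) = trans (f′ (J≤0⇒-J≥0 v y ge)) (lin-cong (≋-sym p≋q) y)

  flat⇒linear : (E : Edge φ v) → width E ≈ 0# → φ ≃ eval (lin (b⁺ E)) at v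
  flat⇒linear E w≈0 = halves-linear (left E) (right E) (flat E w≈0)

  gradient⇒flat : ¬ (v ≋ 0ᵥ) → (E : Edge φ v) → GradientAt φ u v → width E ≈ 0#
  gradient⇒flat {v} v≉0 E gv = multiple-unique (J≉0 v≉0) λ i →
    trans (solve 2 (λ b s → s := b :+ s :- b) _ (b⁻ E i) (width E * J v i))
      (trans (+-cong (trans (sym (edge E i))
        (trans (half-gradient-≋ (J v) (J-perp v) (left E) gv i)
          (sym (half-gradient-≋ (-ᵥ J v) (-J-perp v) (right E) gv i)))) refl)
        (trans (-‿inverseʳ _) (sym (zeroˡ _))))

  -- The direction v is an outer normal of an edge of the Newton polygon; equivalently, it generates
  -- a ray of 𝒱 (g ∞).
  record Active (g : TropicalPolynomial 2) (v : Point 2) : Set where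
    constructor active
    field
      nonzero : ¬ (v ≋ 0ᵥ)
      at      : Edge ⟦ g ∞ ⟧ v
      0<width : 0# < width at

  open Active public

  -- Rescaling directions.

  Nearby-scale : ∀ {P : Pred (Point 2) 0ℓ} {t i} → 0# < t → t * i ≈ 1# → v ≋ t • u → Nearby u P →
    Nearby v λ y → P (i • y)
  Nearby-scale {v} {u} {P} {t} {i} 0<t ti≈1 e (near r 0<r f) = near (t * r) (*-pos 0<t 0<r) λ y y∈ → f
    (i • y)
    (<-by (*-pos 0<i² (diff>0 y∈)) (trans
      (solve 4 (λ i t r Y → i :* i :* (t :* r :* (t :* r) :- Y) := t :* i :* (t :* i) :*
        (r :* r) :- i :* i :* Y) _ i t r _)
      (+-cong (trans (*-congʳ (trans (*-cong ti≈1 ti≈1) (*-identityˡ 1#))) (*-identityˡ _))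
        (-‿cong (sym (scaled y))))))
    where
    0<i² : 0# < i * i
    0<i² = sq-pos λ i≈0 → 0≉1 (trans (sym (trans (*-congˡ i≈0) (zeroʳ t))) ti≈1)
    factor : ∀ y → i • y -ᵥ u ≋ i • (y -ᵥ v)
    factor y k = trans (+-congˡ (-‿cong
      (trans (sym (*-identityˡ (u k)))
        (trans (*-congʳ (sym ti≈1)) (solve 3 (λ t i u → t :* i :* u := i :* (t :* u)) _ t i (u k))))))
      (trans (solve 3 (λ i y w → i :* y :- i :* w := i :* (y :- w)) _ i (y k) (t * u k))
        (*-congˡ (+-congˡ (-‿cong (sym (e k))))))
    scaled : ∀ y → ⟨ i • y -ᵥ u , i • y -ᵥ u ⟩ ≈ i * i * ⟨ y -ᵥ v , y -ᵥ v ⟩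
    scaled y = trans (⟨⟩-cong (factor y) (factor y))
      (solve 3 (λ i a b → dot (i :* a) (i :* b) (i :* a) (i :* b) := i :* i :* dot a b a b) _ i
        ((y -ᵥ v) 0F) ((y -ᵥ v) 1F))

  half-scale : ∀ g {n n′ b t i} → 0# < t → t * i ≈ 1# → v ≋ t • u →
    (∀ y → 0# ≤ ⟨ n′ , y ⟩ → 0# ≤ ⟨ n , i • y ⟩) →
    HalfSlope ⟦ g ∞ ⟧ n u b → HalfSlope ⟦ g ∞ ⟧ n′ v b
  half-scale g {b = b} {t} {i} 0<t ti≈1 e side (half-slope h) = half-slope (Nearby-map
    (λ y f le → trans (⟦⟧-cong (g ∞) (unscaled y)) (trans (homogeneous g t (i • y) (proj₁ 0<t))
      (trans (*-congˡ (f (side y le)))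
        (trans (sym (linear-scale (lin b) t (i • y))) (eval-cong (lin b) (λ k → sym (unscaled y k)))))))
    (Nearby-scale 0<t ti≈1 e h))
    where
    unscaled : ∀ y → y ≋ t • i • y
    unscaled y k = trans (sym (*-identityˡ (y k))) (trans (*-congʳ (sym ti≈1)) (*-assoc t i (y k)))

  -- The face in direction v depends only on the ray of v, but its unit J v grows by the factor t,
  -- so the width shrinks by it.
  edge-scale : ∀ g {t i} → 0# < t → 0# < i → t * i ≈ 1# → v ≋ t • u → (E : Edge ⟦ g ∞ ⟧ u) →
    ∃[ E′ ] b⁺ {⟦ g ∞ ⟧} {v} E′ ≡ b⁺ E × width E′ ≡ width E * i
  edge-scale {v} {u} g {t} {i} 0<t 0<i ti≈1 e E = record
    { b⁺ = b⁺ E ; b⁻ = b⁻ E ; width = width E * i ; 0≤width = *-nonNeg (0≤width E) (proj₁ 0<i)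
    ; edge = λ k → trans (edge E k)
      (+-congˡ (trans (*-congˡ (unscaled k)) (sym (*-assoc (width E) i (J v k)))))
    ; left = half-scale g 0<t ti≈1 e
      (λ y le → ≤-resp refl (pos y) (*-nonNeg (proj₁ (*-pos 0<i 0<i)) le)) (left E)
    ; right = half-scale g 0<t ti≈1 e
      (λ y le → ≤-resp refl (neg y) (*-nonNeg (proj₁ (*-pos 0<i 0<i)) le)) (right E)
    ; below⁺ = below⁺ E ; below⁻ = below⁻ E } , ≡.refl , ≡.refl
    where
    u≋iv : u ≋ i • v
    u≋iv k = trans (sym (*-identityˡ (u k))) (trans (*-congʳ (sym ti≈1))
      (trans (solve 3 (λ t i u → t :* i :* u := i :* (t :* u)) _ t i (u k)) (*-congˡ (sym (e k)))))
    unscaled : J u ≋ i • J v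
    unscaled = ext₂ (trans (-‿cong (u≋iv 1F)) (R.-‿distribʳ-* i (v 1F))) (u≋iv 0F)
    pos : ∀ y → i * i * ⟨ J v , y ⟩ ≈ ⟨ J u , i • y ⟩
    pos y = trans (solve 5 (λ i a b c d → i :* i :* dot a b c d := dot (i :* a) (i :* b) (i :* c)
      (i :* d)) _ i (J v 0F) (J v 1F) (y 0F) (y 1F))
      (⟨⟩-congˡ (i • y) λ k → sym (unscaled k))
    neg : ∀ y → i * i * ⟨ -ᵥ J v , y ⟩ ≈ ⟨ -ᵥ J u , i • y ⟩
    neg y = trans (solve 5 (λ i a b c d → i :* i :* dot (:- a) (:- b) c d := dot (:- (i :* a))
      (:- (i :* b)) (i :* c) (i :* d)) _ i (J v 0F) (J v 1F) (y 0F) (y 1F))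
      (⟨⟩-congˡ (i • y) λ k → -‿cong (sym (unscaled k)))

  ≋0-multiple : ∀ {t} → 0# < t → t • p ≋ 0ᵥ → p ≋ 0ᵥ
  ≋0-multiple 0<t e i = nz-cancel (λ t≈0 → proj₂ 0<t (sym t≈0)) (e i)

  active-scale : ∀ g → SameDirection v u → (A : Active g u) → ∃[ A′ ] b⁺ (at {g} {v} A′) ≡ b⁺ (at A)
  active-scale g (t , 0<t , e) A =
    let (i , 0<i , ti≈1) = recip 0<t
        (E , same , w≡) = edge-scale g 0<t 0<i ti≈1 e (at A)
    in active (λ v≋0 → nonzero A (≋0-multiple 0<t (≋-trans (≋-sym e) v≋0))) E
         (≡.subst (0# <_) (≡.sym w≡) (*-pos (0<width A) 0<i)) , same

  same-direction⇒same-vertex : ∀ g → SameDirection v u → (A : Active g v) (B : Active g u) → b⁺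
    (at A) ≋ b⁺ (at B)
  same-direction⇒same-vertex g v~u A B = let (B′ , same) = active-scale g v~u B in
    ≋-trans (b⁺-unique (at A) (at B′)) (≋-reflexive same)

  SameDirection-sym : SameDirection u v → SameDirection v u
  SameDirection-sym (t , 0<t , e) = let (i , 0<i , ti≈1) = recip 0<t in
    i , 0<i , λ k → trans (sym (*-identityˡ _))
      (trans (*-congʳ (sym ti≈1)) (trans (solve 3 (λ t i u → t :* i :* u := i :* (t :* u)) _ t i _)
        (*-congˡ (sym (e k)))))

  SameDirection-trans : ∀ {w : Point 2} → SameDirection u v → SameDirection v w → SameDirection u w
  SameDirection-trans (s , 0<s , e) (t , 0<t , f) = s * t , *-pos 0<s 0<t , λ k → trans (e k)
    (trans (*-congˡ (f k)) (sym (*-assoc s t _)))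

  -- Rays inject into vertices.

  Separate : List (Point 2) → Set
  Separate = AllPairs λ u v → ¬ SameDirection u v

  parallel⇒multiple : ∀ (v w : Point 2) → ¬ (w ≋ 0ᵥ) → ⟨ J v , w ⟩ ≈ 0# → ∃[ t ] v ≋ t • w
  parallel⇒multiple v w w≉0 e =
    let (t , v≋) = perp⇒multiple v (J w) (J≉0 w≉0)
          (trans (solve 4 (λ a b c d → dot a b (:- d) c := :- dot (:- b) a c d) _ (v 0F) (v 1F) (w 0F)
            (w 1F)) (trans (-‿cong e) R.-0#≈0#))
    in - t , ext₂ (trans (v≋ 0F) (solve 2 (λ t w → t :* (:- w) := (:- t) :* w) _ t (w 0F)))
                  (trans (v≋ 1F) (solve 2 (λ t w → t :* (:- w) := (:- t) :* w) _ t (w 1F)))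

  -- Also `b⁻` lies below g ∞, and `b⁺` differs from it by a positive multiple of J v; so wherever
  -- `b⁺` is maximal, J v is nonnegative.
  active-left : ∀ g (A : Active g v) y → ⟦ g ∞ ⟧ y ≈ eval (lin (b⁺ (at A))) y → 0# ≤ ⟨ J v , y ⟩
  active-left {v} g A y e = cancel-nn (0<width A) (≤-resp refl
    (trans (+-congʳ (trans e (trans (lin-cong (edge (at A)) y)
      (lin-shift (b⁻ (at A)) v (width (at A)) y))))
      (solve 2 (λ L x → L :+ x :- L := x) _ (eval (lin (b⁻ (at A))) y) (width (at A) * ⟨ J v , y ⟩)))
    (diff≥0 (below⁻ (at A) y)))

  -- The normal cone of the common vertex lies to the left of both v and u. Since it contains v and
  -- u, each is to the left of the other and they are parallel. It also contains points strictly to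
  -- the left of u, which excludes opposite directions.
  same-vertex⇒same-direction : ∀ g (A : Active g v) (B : Active g u) → b⁺ (at A) ≋ b⁺ (at B) →
    SameDirection v u
  same-vertex⇒same-direction {v} {u} g A B e =
    let (r , v≋ru) = parallel⇒multiple v u (nonzero B)
          (Order.antisym (≤-by vu≤0 (solve 1 (λ x → :- x := :0 :- x) _ ⟨ J v , u ⟩))
            (active-left g A u at-u))
    in r , ≰⇒> (λ r≤0 → contradiction r v≋ru r≤0 (Nearby-along (J u) (linear-near (left (at B))))) ,
      v≋ru
    where
    on-B : ∀ y → ⟦ g ∞ ⟧ y ≈ eval (lin (b⁺ (at B))) y → ⟦ g ∞ ⟧ y ≈ eval (lin (b⁺ (at A))) y
    on-B y h = trans h (lin-cong (≋-sym e) y)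
    at-u : ⟦ g ∞ ⟧ u ≈ eval (lin (b⁺ (at A))) u
    at-u = on-B u (Nearby-center (linear-near (left (at B))) (Order.reflexive (sym (J-perp u))))
    at-v : ⟦ g ∞ ⟧ v ≈ eval (lin (b⁺ (at B))) v
    at-v = trans (Nearby-center (linear-near (left (at A))) (Order.reflexive (sym (J-perp v))))
      (lin-cong e v)
    vu≤0 : 0# ≤ - ⟨ J v , u ⟩
    vu≤0 = ≤-resp refl (J-neg v u) (active-left g B v at-v)
    Ju-step : ∀ ε → ⟨ J u , u +ᵥ ε • J u ⟩ ≈ ε * ⟨ u , u ⟩
    Ju-step ε = solve 3 (λ a b ε → dot (:- b) a (a :+ ε :* (:- b)) (b :+ ε :* a) := ε :* dot a b a b) _
      (u 0F) (u 1F) ε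
    Jv-step : ∀ r → v ≋ r • u → ∀ ε → ⟨ J v , u +ᵥ ε • J u ⟩ ≈ r * (ε * ⟨ u , u ⟩)
    Jv-step r v≋ ε = trans (⟨⟩-congˡ (u +ᵥ ε • J u)
      (ext₂ {p = J v} {q = r • J u} (trans (-‿cong (v≋ 1F)) (R.-‿distribʳ-* r (u 1F))) (v≋ 0F)))
      (solve 4 (λ a b ε r → dot (r :* (:- b)) (r :* a) (a :+ ε :* (:- b)) (b :+ ε :* a) := r :*
        (ε :* dot a b a b)) _ (u 0F) (u 1F) ε r)
    contradiction : ∀ r → v ≋ r • u → r ≤ 0# →
      ∃[ ε ] 0# < ε × (∀ t → t * t ≤ ε * ε → 0# ≤ ⟨ J u , u +ᵥ t • J u ⟩ →
        ⟦ g ∞ ⟧ (u +ᵥ t • J u) ≈ eval (lin (b⁺ (at B))) (u +ᵥ t • J u)) → ⊥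
    contradiction r v≋ r≤0 (ε , 0<ε , f) = nonzero A λ i → trans (v≋ i)
      (trans (*-congʳ r≈0) (zeroˡ (u i)))
      where
      0<εN : 0# < ε * ⟨ u , u ⟩
      0<εN = *-pos 0<ε (‖ u ‖²-pos (nonzero B))
      at-y : ⟦ g ∞ ⟧ (u +ᵥ ε • J u) ≈ eval (lin (b⁺ (at B))) (u +ᵥ ε • J u)
      at-y = f ε Order.refl (≤-resp refl (sym (Ju-step ε)) (proj₁ 0<εN))
      r≈0 : r ≈ 0#
      r≈0 = Order.antisym r≤0 (cancel-nn 0<εN
        (≤-resp refl (trans (Jv-step r v≋ ε) (*-comm _ _))
          (active-left g A (u +ᵥ ε • J u) (on-B (u +ᵥ ε • J u) at-y))))

  -- A small step from v in direction J v reaches the interior of the normal cone of `b⁺`; far out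
  -- in that direction g itself has this gradient.
  active-gradient : ∀ g (A : Active g v) → Gradient ⟦ g ⟧ (b⁺ (at A))
  active-gradient {v} g A =
    let (ε , _ , gv) = half-gradient {q = J v} (J v) (J-perp v) (‖ J v ‖²-pos (J≉0 (nonzero A)))
          (left (at A))
        (t , _ , gt) = recession g gv 0ᵥ
    in _ , gt

  vertices : ∀ g {vs} → All (Active g) vs → List (Point 2)
  vertices g [] = []
  vertices g (A ∷ As) = b⁺ (at A) ∷ vertices g As

  vertices-distinct : ∀ g {vs} (As : All (Active g) vs) → Separate vs → Distinct (vertices g As)
  vertices-distinct g [] [] = []
  vertices-distinct g (A ∷ As) (v≁ ∷ separate) = head A As v≁ ∷ vertices-distinct g As separate
    where
    head : ∀ {v vs} (A : Active g v) (As : All (Active g) vs) → All (λ u → ¬ SameDirection v u) vs → All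
      (λ u → ¬ (b⁺ (at A) ≋ u)) (vertices g As)
    head A [] [] = []
    head A (B ∷ Bs) (v≁u ∷ v≁) = (λ e → v≁u (same-vertex⇒same-direction g A B e)) ∷ head A Bs v≁

  vertices-gradients : ∀ g {vs} (As : All (Active g) vs) → All (Gradient ⟦ g ⟧) (vertices g As)
  vertices-gradients g [] = []
  vertices-gradients g (A ∷ As) = active-gradient g A ∷ vertices-gradients g As

  vertices-length : ∀ g {vs} (As : All (Active g) vs) → length (vertices g As) ≡ length vs
  vertices-length g [] = ≡.refl
  vertices-length g (A ∷ As) = ≡.cong suc (vertices-length g As)

  actives≤mComp : ∀ g {k vs} → mComp ⟦ g ⟧ k → All (Active g) vs → Separate vs → length vs ℕ.≤ k
  actives≤mComp g {k} comp As separate = ≡.subst (ℕ._≤ k) (vertices-length g As)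
    (gradients≤mComp comp (vertices-distinct g As separate) (vertices-gradients g As))

  -- For negative A m, the inequality t A m - B m ≤ 0 means t ≥ B m / A m. The required t is the
  -- largest of these quotients, and the equality holds at a monomial where it is attained.
  extreme : ∀ (ls : List (Affine 2)) (A B : Affine 2 → Carrier) →
    (∀ {m} → m ∈ₗ ls → (A m ≈ 0# × B m ≈ 0#) ⊎ A m < 0#) →
    (∀ {m} → m ∈ₗ ls → A m ≈ 0#) ⊎
    (∃[ t ] (∀ m → m ∈ₗ ls → t * A m - B m ≤ 0#) × ∃[ m ] m ∈ₗ ls × A m < 0# × t * A m - B m ≈ 0#)
  extreme [] A B cond = inj₁ λ ()
  extreme (k ∷ ls) A B cond = step (extreme ls A B (λ i → cond (there i))) (cond (here ≡.refl))
    where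
    Extreme : List (Affine 2) → Set
    Extreme ls = ∃[ t ] (∀ m → m ∈ₗ ls →
      t * A m - B m ≤ 0#) × ∃[ m ] m ∈ₗ ls × A m < 0# × t * A m - B m ≈ 0#
    vanish : ∀ {m} t → A m ≈ 0# → B m ≈ 0# → t * A m - B m ≈ 0#
    vanish t a b = trans (+-cong (trans (*-congˡ a) (zeroʳ t)) (trans (-‿cong b) R.-0#≈0#))
      (+-identityʳ 0#)
    root : A k < 0# → ∃[ t ] t * A k - B k ≈ 0#
    root (_ , Ak≉0) = let (i , e) = inverse (A k) Ak≉0 in B k * i ,
      trans (+-congʳ (trans (*-assoc (B k) i (A k))
        (trans (*-congˡ (trans (*-comm i (A k)) e)) (*-identityʳ _)))) (-‿inverseʳ _)
    nonpositive : ∀ {m} → m ∈ₗ ls → A m ≤ 0#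
    nonpositive i with cond (there i)
    ... | inj₁ (a , _) = Order.reflexive a
    ... | inj₂ lt      = proj₁ lt
    raise : ∀ t t′ → A k < 0# → 0# < t * A k - B k → t′ * A k - B k ≈ 0# → t ≤ t′
    raise t t′ lt gt root≈0 = ≤-by (proj₁ (cancel-pos (diff>0 lt) (<-resp refl
      (trans (solve 4 (λ t t′ a b → t :* a :- b := (:0 :- a) :* (t′ :- t) :+ (t′ :* a :- b)) _ t t′
        (A k) (B k))
        (trans (+-congˡ root≈0) (+-identityʳ _))) gt))) refl
    step : ((∀ {m} → m ∈ₗ ls → A m ≈ 0#) ⊎ Extreme ls) → (A k ≈ 0# × B k ≈ 0#) ⊎ A k < 0# →
      (∀ {m} → m ∈ₗ (k ∷ ls) → A m ≈ 0#) ⊎ Extreme (k ∷ ls)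
    step (inj₁ all) (inj₁ (a , _)) = inj₁ λ { (here ≡.refl) → a ; (there i) → all i }
    step (inj₁ all) (inj₂ lt) = let (t , e) = root lt in
      inj₂ (t , (λ { _ (here ≡.refl) → Order.reflexive e ; m (there i) → Order.reflexive
        (vanish t (all i) (flat′ i)) }) , k , here ≡.refl , lt , e)
      where
      flat′ : ∀ {m} → m ∈ₗ ls → B m ≈ 0#
      flat′ i with cond (there i)
      ... | inj₁ (_ , b) = b
      ... | inj₂ lt      = ⊥-elim (proj₂ lt (all i))
    step (inj₂ (t , le , m , i , lt , e)) (inj₁ (a , b)) =
      inj₂ (t , (λ { _ (here ≡.refl) → Order.reflexive (vanish t a b) ; m (there i) → le m i }) , m ,
        there i , lt , e)
    step (inj₂ (t , le , m , i , lt , e)) (inj₂ lt′) with ≤-or-> (t * A k - B k) 0#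
    ... | inj₁ le′ = inj₂ (t , (λ { _ (here ≡.refl) → le′ ; m (there i) → le m i }) , m , there i , lt ,
      e)
    -- The old t is too small for k. Raising it to B k / A k preserves the other inequalities,
    -- because A is nonpositive there.
    ... | inj₂ gt  = let (t′ , e′) = root lt′ in
      inj₂ (t′ , (λ { _ (here ≡.refl) → Order.reflexive e′
                    ; m (there i) → ≤-by (+-nn (diff≥0 (le m i))
                      (*-nonNeg (diff≥0 (raise t t′ lt′ gt e′)) (diff≥0 (nonpositive i))))
                        (solve 4 (λ t t′ a b → (:0 :- (t :* a :- b)) :+ (t′ :- t) :* (:0 :- a) := :0 :-
                          (t′ :* a :- b)) _ t t′ (A m) (B m)) })
           , k , here ≡.refl , lt′ , e′)

  -- Turn a direction x in the normal cone of the vertex u clockwise until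
  -- another slope becomes maximal as well.
  vertex⇒active : ∀ g {u u′ x x′} → GradientAt ⟦ g ∞ ⟧ u x → GradientAt ⟦ g ∞ ⟧ u′ x′ → ¬ (u ≋ u′) →
    ∃[ v ] ∃[ A ] b⁺ (at {g} {v} A) ≋ u
  vertex⇒active g {u} {u′} {x} {x′} gu gu′ u≉u′ = from (gradient-monomial∞ g gu)
    where
    from : ∃[ ℓ ] ℓ ∈ₘ g × slope ℓ ≋ u × ⟦ g ∞ ⟧ ≃ eval (linearPart ℓ) at x → ∃[ v ] ∃[ A ] b⁺
      (at {g} {v} A) ≋ u
    from (ℓ , ℓ∈g , ℓ∥u , g≈) = cases (extreme (List⁺.toList g) A B λ {m} m∈g → sign m (sep m∈g))
      where
      A B : Affine 2 → Carrier
      A m = ⟨ slope m -ᵥ slope ℓ , x ⟩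
      B m = ⟨ slope m -ᵥ slope ℓ , J x ⟩
      sep : ∀ {m} → m ∈ₘ g → slope m ≋ slope ℓ ⊎ eval (linearPart m) x < eval (linearPart ℓ) x
      sep = separated {ℓ} g g≈
      parallel : ∀ m q → slope m ≋ slope ℓ → ⟨ slope m -ᵥ slope ℓ , q ⟩ ≈ 0#
      parallel m q e = trans (⟨⟩-subˡ (slope m) (slope ℓ) q)
        (trans (+-congʳ (⟨⟩-congˡ q e)) (-‿inverseʳ _))
      A≈ : ∀ m q → ⟨ slope m -ᵥ slope ℓ , q ⟩ ≈ eval (linearPart m) q - eval (linearPart ℓ) q
      A≈ m q = trans (⟨⟩-subˡ (slope m) (slope ℓ) q)
        (solve 2 (λ a b → a :- b := a :+ :0 :- (b :+ :0)) _ ⟨ slope m , q ⟩ ⟨ slope ℓ , q ⟩)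
      negative : ∀ m → eval (linearPart m) x < eval (linearPart ℓ) x → A m < 0#
      negative m lt = <-by (diff>0 lt)
        (trans (solve 2 (λ a b → b :- a := :0 :- (a :- b)) _ (eval (linearPart m) x)
          (eval (linearPart ℓ) x)) (+-congˡ (-‿cong (sym (A≈ m x)))))
      sign : ∀ m → slope m ≋ slope ℓ ⊎ eval (linearPart m) x < eval (linearPart ℓ) x →
        (A m ≈ 0# × B m ≈ 0#) ⊎ A m < 0#
      sign m (inj₁ e)  = inj₁ (parallel m x e , parallel m (J x) e)
      sign m (inj₂ lt) = inj₂ (negative m lt)
      cases : ((∀ {m} → m ∈ₘ g → A m ≈ 0#) ⊎
        (∃[ t ] (∀ m → m ∈ₘ g → t * A m - B m ≤ 0#) × ∃[ m ] m ∈ₘ g × A m < 0# × t * A m - B m ≈ 0#)) →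
        ∃[ v ] ∃[ A ] b⁺ (at {g} {v} A) ≋ u
      -- All slopes coincide with that of `ℓ`, so there is no room for a second gradient u′.
      cases (inj₁ all) = let (m , m∈g , m∥u′ , _) = gradient-monomial∞ g gu′ in
        ⊥-elim (u≉u′ (≋-trans (≋-sym ℓ∥u) (≋-trans (≋-sym (only {m} (sep m∈g) (all {m} m∈g))) m∥u′)))
        where
        only : ∀ {m} → slope m ≋ slope ℓ ⊎ eval (linearPart m) x < eval (linearPart ℓ) x → A m ≈ 0# →
          slope m ≋ slope ℓ
        only (inj₁ e) _ = e
        only {m} (inj₂ lt) a = ⊥-elim (proj₂ (negative m lt) a)
      cases (inj₂ (t , le , k , k∈g , Ak<0 , root)) =
        d , active d≉0 E (0≤width E , λ 0≈w → curved (sym 0≈w)) , ≋-trans b⁺≋ℓ ℓ∥u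
        where
        -- For large t this direction is close to that of x, and it turns clockwise as t decreases.
        -- The value from `extreme` is the first at which a slope other than that of `ℓ` ties.
        d : Point 2
        d = t • x -ᵥ J x
        along-d : ∀ m → ⟨ slope m -ᵥ slope ℓ , d ⟩ ≈ t * A m - B m
        along-d m = solve 7 (λ a b c d e f t → dot a b (t :* c :- e) (t :* d :- f) :=
          t :* dot a b c d :- dot a b e f) _
          ((slope m -ᵥ slope ℓ) 0F) ((slope m -ᵥ slope ℓ) 1F) (x 0F) (x 1F) (J x 0F) (J x 1F) t
        x≉0 : ¬ (x ≋ 0ᵥ)
        x≉0 e = proj₂ Ak<0 (trans (⟨⟩-congʳ (slope k -ᵥ slope ℓ) e)
          (solve 2 (λ a b → dot a b :0 :0 := :0) _ ((slope k -ᵥ slope ℓ) 0F) ((slope k -ᵥ slope ℓ) 1F)))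
        turned : ⟨ J d , x ⟩ ≈ ⟨ x , x ⟩
        turned = solve 3 (λ a b t → dot (:- (t :* b :- a)) (t :* a :- (:- b)) a b := dot a b a b) _
          (x 0F) (x 1F) t
        0<Jvx : 0# < ⟨ J d , x ⟩
        0<Jvx = <-resp refl (sym turned) (‖ x ‖²-pos x≉0)
        d≉0 : ¬ (d ≋ 0ᵥ)
        d≉0 e = proj₂ 0<Jvx (sym (trans
          (⟨⟩-congˡ x (ext₂ {p = J d} {q = 0ᵥ} (trans (-‿cong (e 1F)) R.-0#≈0#) (e 0F)))
          (solve 2 (λ a b → dot :0 :0 a b := :0) _ (x 0F) (x 1F))))
        E : Edge ⟦ g ∞ ⟧ d
        E = edge-at g d d≉0
        vertex-near : ∀ ε → 0# < ε → GradientAt ⟦ g ∞ ⟧ (slope ℓ) (d +ᵥ ε • x)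
        vertex-near ε 0<ε = dominant (g ∞) (∈∞⁺ g ℓ∈g) λ {m} m∈ → dom (∈∞⁻ g m∈)
          where
          dom : ∀ {m} → ∃[ m′ ] m′ ∈ₘ g × m ≡ linearPart m′ → slope m ≋ slope ℓ ⊎ eval m
            (d +ᵥ ε • x) < eval (linearPart ℓ) (d +ᵥ ε • x)
          dom (m , m∈g , ≡.refl) with sep m∈g
          ... | inj₁ e  = inj₁ e
          ... | inj₂ lt = inj₂ (<-by (+-pos′ (diff≥0 (≤-resp (sym (along-d m)) refl (le m m∈g)))
            (*-pos 0<ε (diff>0 (negative m lt))))
            (trans (solve 3 (λ V ε a → (:0 :- V) :+ ε :* (:0 :- a) := :-
              (V :+ ε :* a)) _ ⟨ slope m -ᵥ slope ℓ , d ⟩ ε (A m))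
            (trans (-‿cong (+-cong (A≈ m d) (*-congˡ (⟨⟩-subˡ (slope m) (slope ℓ) x))))
            (trans (solve 5 (λ M L ε a b → :- (M :- L :+ ε :* (a :- b)) := L :+ ε :* b :-
              (M :+ ε :* a)) _ (eval (linearPart m) d)
                (eval (linearPart ℓ) d) ε ⟨ slope m , x ⟩ ⟨ slope ℓ , x ⟩)
              (+-cong (sym (eval-step (linearPart ℓ) d x ε))
                (-‿cong (sym (eval-step (linearPart m) d x ε))))))))
        b⁺≋ℓ : b⁺ E ≋ slope ℓ
        -- x lies to the left of d, and a small step from d towards x breaks all ties in favour of
        -- `ℓ`.
        b⁺≋ℓ = let (ε , 0<ε , gε) = half-gradient {q = x} (J d) (J-perp d) 0<Jvx
                     (left E) in gradient-unique gε (vertex-near ε 0<ε)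
        curved : width E ≈ 0# → ⊥
        -- If g ∞ were linear near d, the monomial k, which ties with `ℓ` at d, would have to be
        -- parallel to it.
        curved w≈0 = proj₂ Ak<0 (parallel k x
          (≋-trans (touching-≋ (linearPart k) (lin (b⁺ E)) touch near-d) b⁺≋ℓ))
          where
          touch : eval (linearPart k) d ≈ eval (lin (b⁺ E)) d
          touch = trans (trans (solve 2 (λ a b → a := b :+ (a :- b)) _ (eval (linearPart k) d)
            (eval (linearPart ℓ) d))
            (trans (+-congˡ (trans (sym (A≈ k d)) (trans (along-d k) root))) (+-identityʳ _)))
              (lin-cong (≋-sym b⁺≋ℓ) d)
          near-d : Nearby d λ y → eval (linearPart k) y ≤ eval (lin (b⁺ E)) y
          near-d = Nearby-map (λ y h → ≤-resp refl h (upper (g ∞) (∈∞⁺ g k∈g) y)) (flat⇒linear E w≈0)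

  -- A vertex lies on an edge as soon as the polygon is not a point, so a second gradient must be at
  -- hand: u₂ serves for u₁, and u₁ for all others. Rays over different vertices have different
  -- directions, because `b⁺` depends only on the direction.
  gradients⇒actives : ∀ g {us} → Distinct us → All (Gradient ⟦ g ∞ ⟧) us →
    length us ℕ.≤ 1 ⊎ (∃[ vs ] All (Active g) vs × Separate vs × length vs ≡ length us)
  gradients⇒actives g [] [] = inj₁ ℕ.z≤n
  gradients⇒actives g ([] ∷ []) (_ ∷ []) = inj₁ (ℕ.s≤s ℕ.z≤n)
  gradients⇒actives g {u₁ ∷ u₂ ∷ us} distinct@((u₁≉u₂ ∷ _) ∷ _) grads@((x₁ , g₁) ∷ (x₂ , g₂) ∷ _) =
    inj₂ (let (vs , As , separate , same) = build distinct grads in vs , All.map proj₁ As , separate ,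
      same)
    where
    Over : List (Point 2) → Point 2 → Set
    Over us v = ∃[ A ] Any (b⁺ (at {g} {v} A) ≋_) us
    find-active : ∀ {u} → Gradient ⟦ g ∞ ⟧ u → ∃[ v ] ∃[ A ] b⁺ (at {g} {v} A) ≋ u
    find-active {u} (x , gx) with em {P = u ≋ u₁}
    ... | yes u≋u₁ = vertex⇒active g gx g₂ λ u≋u₂ → u₁≉u₂ (≋-trans (≋-sym u≋u₁) u≋u₂)
    ... | no u≉u₁  = vertex⇒active g gx g₁ u≉u₁
    build : ∀ {us} → Distinct us → All (Gradient ⟦ g ∞ ⟧) us → ∃[ vs ] All
      (Over us) vs × Separate vs × length vs ≡ length us
    build [] [] = [] , [] , [] , ≡.refl
    build {u ∷ us} (u≉ ∷ distinct) (gu ∷ grads) =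
      let (vs , As , separate , same) = build distinct grads
          (v , A , A≋u) = find-active gu
      in v ∷ vs , (A , here A≋u) ∷ All.map (λ (B , i) → B , there i) As ,
         All.map (λ (B , i) v~w → apart u≉
           (Any.map (≋-trans (≋-trans (≋-sym A≋u)
             (same-direction⇒same-vertex g v~w A B))) i)) As ∷ separate ,
         ≡.cong suc same
      where
      apart : ∀ {us} → All (λ w → ¬ (u ≋ w)) us → Any (u ≋_) us → ⊥
      apart (u≉w ∷ _) (here e) = u≉w e
      apart (_ ∷ u≉) (there i) = apart u≉ i

  -- The balancing condition for two rays.

  -- The determinant of v and w, positive when w lies to the left of v.
  cr : Point 2 → Point 2 → Carrier
  cr v w = ⟨ J v , w ⟩

  cr-linearʳ : ∀ (a b c : Point 2) s t → cr a (s • b +ᵥ t • c) ≈ s * cr a b + t * cr a c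
  cr-linearʳ a b c s t = solve 8 (λ a0 a1 b0 b1 c0 c1 s t → dot a0 a1 (s :* b0 :+ t :* c0)
    (s :* b1 :+ t :* c1) := s :* dot a0 a1 b0 b1 :+ t :* dot a0 a1 c0 c1)
    _ (J a 0F) (J a 1F) (b 0F) (b 1F) (c 0F) (c 1F) s t

  cr-linearˡ : ∀ (a b c : Point 2) s t → cr (s • b +ᵥ t • c) a ≈ s * cr b a + t * cr c a
  cr-linearˡ a b c s t = solve 8 (λ a0 a1 b0 b1 c0 c1 s t → dot (:- (s :* b1 :+ t :* c1))
    (s :* b0 :+ t :* c0) a0 a1 := s :* dot (:- b1) b0 a0 a1 :+ t :* dot (:- c1) c0 a0 a1)
    _ (a 0F) (a 1F) (b 0F) (b 1F) (c 0F) (c 1F) s t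

  cr-scaleʳ : ∀ (a b : Point 2) t → cr a (t • b) ≈ t * cr a b
  cr-scaleʳ a b t = solve 5 (λ a0 a1 b0 b1 t → dot a0 a1 (t :* b0) (t :* b1) := t :* dot a0 a1 b0 b1) _
    (J a 0F) (J a 1F) (b 0F) (b 1F) t

  cr-scaleˡ : ∀ (a b : Point 2) t → cr (t • b) a ≈ t * cr b a
  cr-scaleˡ a b t = solve 5 (λ a0 a1 b0 b1 t → dot (:- (t :* b1)) (t :* b0) a0 a1 := t :* dot
    (:- b1) b0 a0 a1) _ (a 0F) (a 1F) (b 0F) (b 1F) t

  J-cong : p ≋ q → J p ≋ J q
  J-cong e = ext₂ (-‿cong (e 1F)) (e 0F)

  cr≉0⇒≉0 : ¬ (cr v u ≈ 0#) → ¬ (u ≋ 0ᵥ)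
  cr≉0⇒≉0 {v} {u} cr≉0 e = cr≉0 (trans (⟨⟩-congʳ (J v) e)
    (solve 2 (λ a b → dot a b :0 :0 := :0) _ (J v 0F) (J v 1F)))

  cr≉0⇒≁ : ¬ (cr v u ≈ 0#) → ¬ SameDirection u v
  cr≉0⇒≁ {v} {u} cr≉0 (t , _ , e) = cr≉0
    (trans (⟨⟩-congʳ (J v) e) (trans (cr-scaleʳ v v t) (trans (*-congˡ (J-perp v)) (zeroʳ t))))

  ≈-⇒≉0 : x ≈ - y → ¬ (y ≈ 0#) → ¬ (x ≈ 0#)
  ≈-⇒≉0 e y≉0 x≈0 = y≉0 (trans (sym (R.-‿involutive _)) (trans (-‿cong (trans (sym e) x≈0)) R.-0#≈0#))

  -- Just off v towards q the gradient is the one-sided slope b, and the segment from there to q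
  -- stays within the regular sector.
  sector : ∀ {n b w} → ⟨ n , v ⟩ ≈ 0# → 0# < ⟨ n , q ⟩ → HalfSlope φ n v b →
    (∀ s t → 0# ≤ s → 0# < t → Regular φ (s • v +ᵥ t • q)) → GradientAt φ w q → b ≋ w
  sector {v} {q} {φ} {n} {b} {w} n⊥v 0<nq h regular gq = let (ε , 0<ε , gε) =
                                                               half-gradient {v} {q} n n⊥v 0<nq h in
    gradient-along (λ t 0≤t t≤1 → path ε 0<ε t 0≤t t≤1) gε gq
    where
    path : ∀ ε → 0# < ε → ∀ t → 0# ≤ t → t ≤ 1# → Regular φ (between (v +ᵥ ε • q) q t)
    path ε 0<ε t 0≤t t≤1 =
      -- The coefficient of q on the path is a weighted mean of ε and 1, so it is at least the
      -- smaller of the two.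
      let (m , 0<m , m≤ε , m≤1) = lower 0<ε 0<1
          positive = <-resp refl (solve 3
            (λ m ε t → m :+ ((ε :- m) :* (:1 :- t) :+ (:1 :- m) :* t) := ε :* (:1 :- t) :+ t) _ m ε t)
            (+-pos 0<m (+-nn (*-nonNeg (diff≥0 m≤ε) (diff≥0 t≤1)) (*-nonNeg (diff≥0 m≤1) 0≤t)))
          (u , gu) = regular (1# - t) (ε * (1# - t) + t) (diff≥0 t≤1) positive
      in u , Open-resp (gradient-open φ u)
        (λ i → solve 4 (λ v q ε t → (:1 :- t) :* v :+ (ε :* (:1 :- t) :+ t) :* q := v :+ ε :* q :+ t :*
          (q :- (v :+ ε :* q))) _ (v i) (q i) ε t) gu

  module _ (k g : TropicalPolynomial 2) where
    private
      Δ : Fun 2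
      Δ x = ⟦ k ∞ ⟧ x - ⟦ g ∞ ⟧ x

    -- The signed weight of Δ along the ray of v is `jump` times |v|, positive where Δ is convex and
    -- negative where it is concave. The edges are fields so that the one carried by an `Active` can
    -- be inserted.
    record Jump (v : Point 2) : Set where
      field
        nonzero′ : ¬ (v ≋ 0ᵥ)
        upperEdge : Edge ⟦ k ∞ ⟧ v
        lowerEdge : Edge ⟦ g ∞ ⟧ v
      jump : Carrier
      jump = width upperEdge - width lowerEdge
      slope⁺ slope⁻ : Point 2
      slope⁺ = b⁺ upperEdge -ᵥ b⁺ lowerEdge
      slope⁻ = b⁻ upperEdge -ᵥ b⁻ lowerEdge
      left′ : HalfSlope Δ (J v) v slope⁺
      left′ = half-difference (left upperEdge) (left lowerEdge)
      right′ : HalfSlope Δ (-ᵥ J v) v slope⁻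
      right′ = half-difference (right upperEdge) (right lowerEdge)
      jump≋ : slope⁺ ≋ slope⁻ +ᵥ jump • J v
      jump≋ i = trans (+-cong (edge upperEdge i) (-‿cong (edge lowerEdge i)))
        (solve 5 (λ a b s t j → a :+ s :* j :- (b :+ t :* j) := a :- b :+ (s :- t) :* j) _
          (b⁻ upperEdge i) (b⁻ lowerEdge i) (width upperEdge) (width lowerEdge) (J v i))

    open Jump

    jump-at : ∀ v → ¬ (v ≋ 0ᵥ) → Jump v
    jump-at v v≉0 = record { nonzero′ = v≉0 ; upperEdge = edge-at k v v≉0 ; lowerEdge =
      edge-at g v v≉0 }

    no-jump⇒regular : (j : Jump v) → jump j ≈ 0# → Regular Δ v
    no-jump⇒regular j e = slope⁺ j , gradient 0# (halves-linear (left′ j) (right′ j)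
      λ i → trans (jump≋ j i) (trans (+-congˡ (trans (*-congʳ e) (zeroˡ _))) (+-identityʳ _)))

    module _ {d d′ : Point 2} (D : Jump d) (D′ : Jump d′) (d≁d′ : ¬ SameDirection d′ d)
             (elsewhere : ∀ v → (j : Jump v) → ¬ SameDirection v d → ¬ SameDirection v d′ →
               jump j ≈ 0#) where

      private
        regular : ∀ z → ¬ (z ≋ 0ᵥ) → ¬ SameDirection z d → ¬ SameDirection z d′ → Regular Δ z
        regular z z≉0 z≁d z≁d′ = no-jump⇒regular (jump-at z z≉0) (elsewhere z (jump-at z z≉0) z≁d z≁d′)

        module _ (q : Point 2) (0≤dd′ : 0# ≤ cr d d′) (0<dq : 0# < cr d q) (0<qd′ : 0# < cr q d′) where

          behind : ∀ {z t} → z ≋ t • d′ → 0# < t → 0# ≤ cr d z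
          behind {z} {t} e 0<t = ≤-resp refl (sym (trans (⟨⟩-congʳ (J d) e) (cr-scaleʳ d d′ t)))
            (*-nonNeg (proj₁ 0<t) 0≤dd′)

          behind′ : ∀ {z t} → z ≋ t • d → 0# < t → 0# ≤ cr z d′
          behind′ {z} {t} e 0<t = ≤-resp refl (sym (trans (⟨⟩-congˡ d′ (J-cong e)) (cr-scaleˡ d′ d t)))
            (*-nonNeg (proj₁ 0<t) 0≤dd′)

          crˡ≉0⇒≁ : ∀ {z} → ¬ (cr z d′ ≈ 0#) → ¬ SameDirection z d′
          crˡ≉0⇒≁ {z} n = cr≉0⇒≁ (≈-⇒≉0 (J-neg z d′) n)

          from-d : ∀ s t → 0# ≤ s → 0# < t → Regular Δ (s • d +ᵥ t • q)
          from-d s t 0≤s 0<t = regular ζ (cr≉0⇒≉0 {v = d} dz≉0) (cr≉0⇒≁ dz≉0) (crˡ≉0⇒≁ zd′≉0)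
            where
            ζ : Point 2
            ζ = s • d +ᵥ t • q
            dz≉0 : ¬ (cr d ζ ≈ 0#)
            dz≉0 e = proj₂ (*-pos 0<t 0<dq)
              (sym (trans (sym (trans (+-congʳ (trans (*-congˡ (J-perp d)) (zeroʳ s))) (+-identityˡ _)))
                (trans (sym (cr-linearʳ d d q s t)) e)))
            zd′≉0 : ¬ (cr ζ d′ ≈ 0#)
            zd′≉0 e = proj₂ (+-pos′ (*-nonNeg 0≤s 0≤dd′) (*-pos 0<t 0<qd′))
              (sym (trans (sym (cr-linearˡ d′ d q s t)) e))

          from-d′ : ∀ s t → 0# ≤ s → 0# < t → Regular Δ (s • d′ +ᵥ t • q)
          from-d′ s t 0≤s 0<t = regular ζ (cr≉0⇒≉0 {v = d} dz≉0) (cr≉0⇒≁ dz≉0) (crˡ≉0⇒≁ zd′≉0)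
            where
            ζ : Point 2
            ζ = s • d′ +ᵥ t • q
            dz≉0 : ¬ (cr d ζ ≈ 0#)
            dz≉0 e = proj₂ (+-pos′ (*-nonNeg 0≤s 0≤dd′) (*-pos 0<t 0<dq))
              (sym (trans (sym (cr-linearʳ d d′ q s t)) e))
            zd′≉0 : ¬ (cr ζ d′ ≈ 0#)
            zd′≉0 e = proj₂ (*-pos 0<t 0<qd′)
              (sym (trans (sym (trans (+-congʳ (trans (*-congˡ (J-perp d′)) (zeroʳ s)))
                (+-identityˡ _))) (trans (sym (cr-linearˡ d′ d′ q s t)) e)))

          opposite : Point 2
          opposite = (- 1#) • q

          from-d-back : ∀ s t → 0# ≤ s → 0# < t → Regular Δ (s • d +ᵥ t • opposite)
          from-d-back s t 0≤s 0<t = regular ζ (cr≉0⇒≉0 {v = d} dz≉0) (cr≉0⇒≁ dz≉0) λ (r , 0<r , e) →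
            <⇒≱ dz<0 (behind e 0<r)
            where
            ζ : Point 2
            ζ = s • d +ᵥ t • opposite
            dz : cr d ζ ≈ - (t * cr d q)
            dz = trans (cr-linearʳ d d opposite s t)
              (trans (+-cong (trans (*-congˡ (J-perp d)) (zeroʳ s)) (*-congˡ (cr-scaleʳ d q (- 1#))))
              (solve 2 (λ t x → :0 :+ t :* (:- :1 :* x) := :- (t :* x)) _ t (cr d q)))
            dz<0 : cr d ζ < 0#
            dz<0 = <-by (*-pos 0<t 0<dq) (trans (solve 1 (λ x → x := :0 :- (:- x)) _ (t * cr d q))
              (+-congˡ (-‿cong (sym dz))))
            dz≉0 : ¬ (cr d ζ ≈ 0#)
            dz≉0 = proj₂ dz<0

          from-d′-back : ∀ s t → 0# ≤ s → 0# < t → Regular Δ (s • d′ +ᵥ t • opposite)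
          from-d′-back s t 0≤s 0<t = regular ζ (cr≉0⇒≉0 {v = d′} (≈-⇒≉0 (J-neg ζ d′) zd′≉0))
            (λ (r , 0<r , e) → <⇒≱ zd′<0 (behind′ e 0<r)) (crˡ≉0⇒≁ zd′≉0)
            where
            ζ : Point 2
            ζ = s • d′ +ᵥ t • opposite
            zd′ : cr ζ d′ ≈ - (t * cr q d′)
            zd′ = trans (cr-linearˡ d′ d′ opposite s t)
              (trans (+-cong (trans (*-congˡ (J-perp d′)) (zeroʳ s)) (*-congˡ (cr-scaleˡ d′ q (- 1#))))
              (solve 2 (λ t x → :0 :+ t :* (:- :1 :* x) := :- (t :* x)) _ t (cr q d′)))
            zd′<0 : cr ζ d′ < 0#
            zd′<0 = <-by (*-pos 0<t 0<qd′) (trans (solve 1 (λ x → x := :0 :- (:- x)) _ (t * cr q d′))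
              (+-congˡ (-‿cong (sym zd′))))
            zd′≉0 : ¬ (cr ζ d′ ≈ 0#)
            zd′≉0 = proj₂ zd′<0

          at-axis : ∀ {v p} → Regular Δ (0# • v +ᵥ 1# • p) → Regular Δ p
          at-axis {v} {p} (u , gu) = u , Open-resp (gradient-open Δ u)
            (λ i → solve 2 (λ v p → :0 :* v :+ :1 :* p := p) _ (v i) (p i)) gu

          -- The direction q lies in the sector counterclockwise from d to d′, and -q in the other
          -- one. Each sector has one gradient, w and w′. Crossing d changes w′ into w and crossing
          -- d′ changes w back into w′, so the two changes, `jump D • J d` and `jump D′ • J d′`,
          -- cancel.
          balanced-via : jump D • d +ᵥ jump D′ • d′ ≋ 0ᵥ
          balanced-via =
            let (w , gw) = at-axis {d} {q} (from-d 0# 1# Order.refl 0<1)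
                (w′ , gw′) = at-axis {d} {opposite} (from-d-back 0# 1# Order.refl 0<1)
                l  = sector (J-perp d) 0<dq (left′ D) from-d gw
                r  = sector (-J-perp d) (<-resp refl (negʳ d q) 0<dq) (right′ D) from-d-back gw′
                r′ = sector (-J-perp d′) (<-resp refl (trans (J-neg d′ q) (negˡ d′ q)) 0<qd′)
                  (right′ D′) from-d′ gw
                l′ = sector (J-perp d′) (<-resp refl (trans (J-neg d′ q) (neg d′ q)) 0<qd′)
                  (left′ D′) from-d′-back gw′
                turn = λ i → trans (+-cong (jump-of D i) (jump-of D′ i))
                  (trans (+-cong (+-cong (l i) (-‿cong (r i))) (+-cong (l′ i) (-‿cong (r′ i))))
                    (solve 2 (λ w w′ → w :- w′ :+ (w′ :- w) := :0) _ (w i) (w′ i)))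
            in ext₂ (turn 1F) (trans (solve 4
              (λ s a t b → s :* a :+ t :* b := :- (s :* (:- a) :+ t :* (:- b))) _ (jump D) (d 1F)
                (jump D′) (d′ 1F))
                 (trans (-‿cong (turn 0F)) R.-0#≈0#))
            where
            jump-of : ∀ {v} (j : Jump v) → jump j • J v ≋ slope⁺ j -ᵥ slope⁻ j
            jump-of {v} j i = trans (solve 2 (λ a x → x := a :+ x :- a) _ (slope⁻ j i) (jump j * J v i))
              (+-congʳ (sym (jump≋ j i)))
            negʳ : ∀ (a b : Point 2) → cr a b ≈ ⟨ -ᵥ J a , (- 1#) • b ⟩
            negʳ a b = solve 4 (λ a b c d → dot a b c d := dot (:- a) (:- b) (:- :1 :* c)
              (:- :1 :* d)) _ (J a 0F) (J a 1F) (b 0F) (b 1F)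
            negˡ : ∀ (a b : Point 2) → - cr a b ≈ ⟨ -ᵥ J a , b ⟩
            negˡ a b = solve 4 (λ a b c d → :- dot a b c d := dot (:- a) (:- b) c d) _ (J a 0F) (J a 1F)
              (b 0F) (b 1F)
            neg : ∀ (a b : Point 2) → - cr a b ≈ ⟨ J a , (- 1#) • b ⟩
            neg a b = solve 4 (λ a b c d → :- dot a b c d := dot a b (:- :1 :* c) (:- :1 :* d)) _
              (J a 0F) (J a 1F) (b 0F) (b 1F)

      -- If the sector from d to d′ is narrower than a half plane, d + d′ lies inside it. Otherwise
      -- d′ is opposite to d, and J d serves.
      balanced-oriented : 0# ≤ cr d d′ → jump D • d +ᵥ jump D′ • d′ ≋ 0ᵥ
      balanced-oriented 0≤dd′ with em {P = cr d d′ ≈ 0#}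
      ... | no dd′≉0 = balanced-via (d +ᵥ d′) 0≤dd′ (<-resp refl add-d 0<dd′) (<-resp refl add-d′ 0<dd′)
        where
        0<dd′ : 0# < cr d d′
        0<dd′ = 0≤dd′ , λ e → dd′≉0 (sym e)
        add-d : cr d d′ ≈ cr d (d +ᵥ d′)
        add-d = solve 4 (λ a b c d → dot (:- b) a c d := dot (:- b) a (a :+ c) (b :+ d)) _ (d 0F) (d 1F)
          (d′ 0F) (d′ 1F)
        add-d′ : cr d d′ ≈ cr (d +ᵥ d′) d′
        add-d′ = solve 4 (λ a b c d → dot (:- b) a c d := dot (:- (b :+ d)) (a :+ c) c d) _ (d 0F)
          (d 1F) (d′ 0F) (d′ 1F)
      ... | yes dd′≈0 = let (r , e) = parallel⇒multiple d′ d (nonzero′ D)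
                              (trans (J-neg d d′) (trans (-‿cong dd′≈0) R.-0#≈0#)) in
          balanced-via (J d) 0≤dd′ (‖ J d ‖²-pos (J≉0 (nonzero′ D)))
            (<-resp refl (reversed r e) (*-pos (diff>0 (negative r e (≤-or-> 0# r)))
              (‖ d ‖²-pos (nonzero′ D))))
        where
        negative : ∀ r → d′ ≋ r • d → 0# ≤ r ⊎ r < 0# → r < 0#
        negative r e (inj₂ r<0) = r<0
        negative r e (inj₁ 0≤r) = ⊥-elim
          (d≁d′ (r , (0≤r , λ 0≈r → nonzero′ D′ λ i → trans (e i)
            (trans (*-congʳ (sym 0≈r)) (zeroˡ _))) , e))
        reversed : ∀ r → d′ ≋ r • d → (0# - r) * ⟨ d , d ⟩ ≈ cr (J d) d′
        reversed r e = trans (solve 3 (λ a b r → (:0 :- r) :* dot a b a b := dot (:- a) (:- b) (r :* a)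
          (r :* b)) _ (d 0F) (d 1F) r)
          (⟨⟩-congʳ (J (J d)) (≋-sym e))

    balanced : ∀ {d d′} (D : Jump d) (D′ : Jump d′) → ¬ SameDirection d d′ →
      (∀ v → (j : Jump v) → ¬ SameDirection v d → ¬ SameDirection v d′ → jump j ≈ 0#) →
      jump D • d +ᵥ jump D′ • d′ ≋ 0ᵥ
    balanced {d} {d′} D D′ d≁d′ elsewhere with ≤-or-> 0# (cr d d′)
    ... | inj₁ 0≤dd′ = balanced-oriented D D′ (λ e → d≁d′ (SameDirection-sym e)) elsewhere 0≤dd′
    ... | inj₂ dd′<0 = λ i → trans (+-comm _ _)
      (balanced-oriented D′ D d≁d′ (λ v j v≁d′ v≁d → elsewhere v j v≁d v≁d′)
      (≤-resp refl (trans (+-identityˡ _) (sym (J-neg d d′))) (diff≥0 (proj₁ dd′<0))) i)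

    -- Solving the balancing condition for d writes it as a nonnegative multiple of d′; a zero
    -- factor would make d vanish and a positive one would make the directions equal.
    unbalanced : ∀ {d d′} (D : Jump d) (D′ : Jump d′) → ¬ SameDirection d d′ →
      (∀ v → (j : Jump v) → ¬ SameDirection v d → ¬ SameDirection v d′ → jump j ≈ 0#) →
      jump D < 0# → 0# ≤ jump D′ → ⊥
    unbalanced {d} {d′} D D′ d≁d′ elsewhere D<0 0≤D′ =
      let (i , 0<i , e) = recip (diff>0 D<0)
          d≋ = λ n → trans (sym (*-identityˡ (d n))) (trans (*-congʳ (sym e))
                 (trans (solve 3 (λ x i a → (:0 :- x) :* i :* a := i :* (:- (x :* a))) _ (jump D) i
                   (d n))
                 (trans (*-congˡ (trans (solve 2 (λ x y → :- x := y :- (x :+ y)) _ (jump D * d n)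
                   (jump D′ * d′ n)) (trans (+-congˡ
                     (trans (-‿cong (balanced D D′ d≁d′ elsewhere n)) R.-0#≈0#)) (+-identityʳ _))))
                   (sym (*-assoc i (jump D′) (d′ n))))))
      in d≁d′ (i * jump D′ , *-pos 0<i
        (0≤D′ , λ 0≈D′ → nonzero′ D λ n → trans (d≋ n)
          (trans (*-congʳ (trans (*-congˡ (sym 0≈D′)) (zeroʳ i))) (zeroˡ _))) , d≋)

  -- Counting rays.

  -- Up to the ray d, the numerator and the denominator have no common ray.
  record ConicPair (g h : TropicalPolynomial 2) (d : Point 2) : Set where
    field
      gradients-g : ∀ {u} → Gradient ⟦ g ⟧ u → Gradient ⟦ g ∞ ⟧ u
      gradients-h : ∀ {u} → Gradient ⟦ h ⟧ u → Gradient ⟦ h ∞ ⟧ u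
      common      : ∀ {v} → Active g v → Active h v → SameDirection v d
      active-g    : ¬ (d ≋ 0ᵥ) → Active g d
      active-h    : ¬ (d ≋ 0ᵥ) → Active h d

  swap-pair : ∀ {g h d} → ConicPair g h d → ConicPair h g d
  swap-pair P = record
    { gradients-g = gradients-h ; gradients-h = gradients-g ; common = λ A B → common B A ; active-g =
      active-h ; active-h = active-g }
    where open ConicPair P

  inactive⇒flat : ∀ {g v} → ¬ (v ≋ 0ᵥ) → (E : Edge ⟦ g ∞ ⟧ v) → ¬ Active g v → width E ≈ 0#
  inactive⇒flat v≉0 E ¬A with em {P = width E ≈ 0#}
  ... | yes e = e
  ... | no w≉0 = ⊥-elim (¬A (active v≉0 E (0≤width E , λ e → w≉0 (sym e))))

  -- Any nonzero direction will do: next to it g ∞ has a gradient, and g inherits it far out.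
  some-gradient : ∀ g → ∃[ u ] Gradient ⟦ g ⟧ u
  some-gradient g =
    let (_ , _ , gv) = half-gradient {q = J e₀} (J e₀) (J-perp e₀) (‖ J e₀ ‖²-pos (J≉0 e₀≉0))
          (left (edge-at g e₀ e₀≉0))
        (_ , _ , gt) = recession g gv 0ᵥ
    in _ , _ , gt
    where
    e₀ : Point 2
    e₀ _ = 1#
    e₀≉0 : ¬ (e₀ ≋ 0ᵥ)
    e₀≉0 e = 0≉1 (sym (e 0F))

  0<mComp : ∀ g {k} → mComp ⟦ g ⟧ k → 1 ℕ.≤ k
  0<mComp g comp = let (u , gu) = some-gradient g in gradients≤mComp comp ([] ∷ []) (gu ∷ [])

  nonzero-direction : SameDirection v u → ¬ (v ≋ 0ᵥ) → ¬ (u ≋ 0ᵥ)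
  nonzero-direction (t , _ , e) v≉0 u≋0 = v≉0 λ i → trans (e i) (trans (*-congˡ (u≋0 i)) (zeroʳ t))

  -- A separate list meets the direction d at most once, so dropping it costs at most one ray.
  remove : ∀ (d : Point 2) {P : Pred (Point 2) 0ℓ} {vs} → Separate vs → All P vs →
    ∃[ ws ] Separate ws × All (λ v → P v × ¬ SameDirection v d) ws × length vs ℕ.≤ suc (length ws)
  remove d [] [] = [] , [] , [] , ℕ.z≤n
  remove d {P} {v ∷ vs} (v≁ ∷ separate) (Pv ∷ Ps) with em {P = SameDirection v d}
  ... | yes v~d = vs , separate , All.zipWith
    (λ (Pw , v≁w) → Pw , λ w~d → v≁w (SameDirection-trans v~d (SameDirection-sym w~d))) (Ps , v≁) ,
      ℕₚ.≤-refl
  ... | no v≁d = let (ws , separate′ , Qs , le) = remove d {λ w → P w × ¬ SameDirection v w} separate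
                       (All.zip (Ps , v≁)) in
    v ∷ ws , All.map (λ ((_ , v≁w) , _) → v≁w) Qs ∷ separate′ , (Pv , v≁d) ∷ All.map
      (λ ((Pw , _) , w≁d) → Pw , w≁d) Qs , ℕ.s≤s le

  -- Comparison with a representation whose numerator has fewer regions.

  module _ {g h : TropicalPolynomial 2} {d : Point 2} (pair : ConicPair g h d)
    (g′ h′ : TropicalPolynomial 2)
           (identity : ∀ x → ⟦ g ∞ ⟧ x + ⟦ h′ ∞ ⟧ x ≈ ⟦ g′ ∞ ⟧ x + ⟦ h ∞ ⟧ x)
           {us ws : List (Point 2)}
           (us-distinct : Distinct us) (us-gradients : All (Gradient ⟦ g ⟧) us)
           (ws-distinct : Distinct ws) (ws-gradients : All (Gradient ⟦ h ⟧) ws)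
           {m′ n′ : ℕ} (comp-g′ : mComp ⟦ g′ ⟧ m′) (comp-h′ : mComp ⟦ h′ ⟧ n′)
           (m′<m : m′ ℕ.< length us) (n′≤n : n′ ℕ.≤ length ws) where
    open ConicPair pair
    private
      -- Where h is flat, the width of g′ is the sum of those of g and h′, so no ray of g can be
      -- lost.
      positive-g : Active g v → ¬ Active h v → Active g′ v
      positive-g {v} A ¬B = active v≉0 G′ (<-resp refl
        (trans (width-sum v≉0 (at A) (edge-at h′ v v≉0) G′ H identity)
          (trans (+-congˡ (inactive⇒flat v≉0 H ¬B)) (+-identityʳ _)))
        (+-pos (0<width A) (0≤width (edge-at h′ v v≉0))))
        where
        v≉0 = nonzero A
        G′ : Edge ⟦ g′ ∞ ⟧ v
        G′ = edge-at g′ v v≉0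
        H : Edge ⟦ h ∞ ⟧ v
        H = edge-at h v v≉0

      positive-h : Active h v → ¬ Active g v → Active h′ v
      positive-h {v} B ¬A = active v≉0 H′ (<-resp refl
        (trans (sym (width-sum v≉0 G H′ (edge-at g′ v v≉0) (at B) identity))
          (trans (+-congʳ (inactive⇒flat v≉0 G ¬A)) (+-identityˡ _)))
        (+-pos′ (0≤width (edge-at g′ v v≉0)) (0<width B)))
        where
        v≉0 = nonzero B
        H′ : Edge ⟦ h′ ∞ ⟧ v
        H′ = edge-at h′ v v≉0
        G : Edge ⟦ g ∞ ⟧ v
        G = edge-at g v v≉0

      Rays : TropicalPolynomial 2 → ℕ → Set
      Rays k m = ∃[ vs ] All (Active k) vs × Separate vs × length vs ≡ m

      scale : ∀ k → SameDirection v u → Active k u → Active k v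
      scale k v~u A = proj₁ (active-scale k v~u A)

      too-many-g′ : ∀ {vs} → All (Active g′) vs → Separate vs → length us ℕ.≤ length vs → ⊥
      too-many-g′ As separate le = ℕₚ.<⇒≱ m′<m (ℕₚ.≤-trans le (actives≤mComp g′ comp-g′ As separate))

      -- Rays of g off the direction d are absent from h and survive in g′ by `positive-g`. If the
      -- one along d survived too, g′ would have as many rays as g has regions.
      ¬all-active : Rays g (length us) → (∀ {v} → SameDirection v d → Active g v → Active g′ v) → ⊥
      ¬all-active (vs , As , separate , same) f = too-many-g′ (All.map activate As) separate
        (ℕₚ.≤-reflexive (≡.sym same))
        where
        activate : Active g v → Active g′ v
        activate {v} A with em {P = SameDirection v d}
        ... | yes v~d = f v~d A
        ... | no v≁d  = positive-g A λ B → v≁d (common A B)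

      d≉0 : Rays g (length us) → ¬ (d ≋ 0ᵥ)
      d≉0 rays d≋0 = ¬all-active rays λ v~d A → ⊥-elim (nonzero-direction v~d (nonzero A) d≋0)

      ¬active-g′ : Rays g (length us) → ¬ Active g′ d
      ¬active-g′ rays A′ = ¬all-active rays λ v~d _ → scale g′ v~d A′

      -- g′ already has all rays of g except possibly d; a ray that g lacks would fill the gap left
      -- by d and bring the count up to the number of regions of g.
      shared⇒active : Rays g (length us) → Active g′ v → Active g v
      shared⇒active {v} rays@(vs , As , separate , same) A′ with em {P = Active g v}
      ... | yes A = A
      ... | no ¬A = let (ws , separate′ , Bs , le) = remove d separate As in
        ⊥-elim (too-many-g′
          (A′ ∷ All.map (λ (A , w≁d) → positive-g A λ B → w≁d (common A B)) Bs)
          (All.map (λ (A , _) v~w → ¬A (scale g v~w A)) Bs ∷ separate′)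
          (≡.subst (ℕ._≤ _) same le))

      Shared : Point 2 → Set
      Shared v = Active g′ v × Active h′ v

      shared≁d : Rays g (length us) → Shared v → ¬ SameDirection v d
      shared≁d rays (A′ , _) v~d = ¬active-g′ rays (scale g′ (SameDirection-sym v~d) A′)

      shared⇒inactive : Rays g (length us) → Shared v → ¬ Active h v
      shared⇒inactive rays S@(A′ , _) B = shared≁d rays S (common (shared⇒active rays A′) B)

      -- h′ keeps all rays of h except possibly d. Shared rays are not among these, so two of them
      -- would give h′ more rays than h has regions.
      shared-unique : Rays g (length us) → Shared v → Shared u → SameDirection v u
      shared-unique {v} {u} rays S@(_ , B′) T@(_ , C′) with em {P = SameDirection v u}
      ... | yes v~u = v~u
      ... | no v≁u = ⊥-elim (count (gradients⇒actives h ws-distinct (All.map gradients-h ws-gradients)))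
        where
        count : length ws ℕ.≤ 1 ⊎ Rays h (length ws) → ⊥
        -- With at most one region in h, the two shared rays alone are too many for h′.
        count (inj₁ n≤1) = ℕₚ.<⇒≱ (ℕₚ.≤-trans
          (actives≤mComp h′ comp-h′ (B′ ∷ C′ ∷ []) ((v≁u ∷ []) ∷ [] ∷ [])) n′≤n) n≤1
        count (inj₂ (vs , Bs , separate , same)) =
          let (xs , separate′ , Cs , le) = remove d separate Bs
              apart : ∀ {w} → Shared w → All (λ x → ¬ SameDirection w x) xs
              apart W = All.map (λ (B , _) w~x → shared⇒inactive rays W (scale h w~x B)) Cs
              bound = actives≤mComp h′ comp-h′
                (B′ ∷ C′ ∷ All.map (λ (B , x≁d) → positive-h B λ A → x≁d (common A B)) Cs)
                ((v≁u ∷ apart S) ∷ apart T ∷ separate′)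
          in ℕₚ.<⇒≱ (ℕₚ.≤-trans bound n′≤n) (≡.subst (ℕ._≤ _) same le)

      nn-sum-zero : 0# ≤ x → 0# ≤ y → x + y ≈ 0# → x ≈ 0#
      nn-sum-zero {x} {y} 0≤x 0≤y e = Order.antisym
        (≤-by 0≤y (trans (solve 2 (λ x y → y := (x :+ y) :- x) _ x y) (+-congʳ e))) 0≤x

      open Jump

      jump-sum : (j : Jump g′ g v) → width (lowerEdge j) + width (edge-at h′ v (nonzero′ j)) ≈ width
        (upperEdge j) + width (edge-at h v (nonzero′ j))
      jump-sum {v} j = width-sum (nonzero′ j) (lowerEdge j) (edge-at h′ v (nonzero′ j)) (upperEdge j)
        (edge-at h v (nonzero′ j)) identity

      -- The difference of widths is the same for g, h as for g′, h′. In each pair one of the two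
      -- nonnegative widths is zero, so both are determined by the difference as its positive and
      -- negative part.
      no-jump : (j : Jump g′ g v) → ¬ SameDirection v d → ¬ Shared v → jump j ≈ 0#
      no-jump {v} j v≁d ¬S = difference (unshared (λ A B → v≁d (common A B)) (lowerEdge j) H)
        (unshared (λ A B → ¬S (A , B)) (upperEdge j) H′)
        where
        v≉0 = nonzero′ j
        H : Edge ⟦ h ∞ ⟧ v
        H = edge-at h v v≉0
        H′ : Edge ⟦ h′ ∞ ⟧ v
        H′ = edge-at h′ v v≉0
        unshared : ∀ {k l} → (Active k v → Active l v → ⊥) → (E : Edge ⟦ k ∞ ⟧ v) (F : Edge ⟦ l ∞ ⟧ v) →
          width E ≈ 0# ⊎ width F ≈ 0#
        unshared {k} {l} ¬both E F with em {P = Active k v}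
        ... | no ¬A = inj₁ (inactive⇒flat v≉0 E ¬A)
        ... | yes A = inj₂ (inactive⇒flat v≉0 F (¬both A))
        equal : width (upperEdge j) ≈ width (lowerEdge j) → jump j ≈ 0#
        equal e = trans (+-congʳ e) (-‿inverseʳ _)
        difference : width (lowerEdge j) ≈ 0# ⊎ width H ≈ 0# → width
          (upperEdge j) ≈ 0# ⊎ width H′ ≈ 0# → jump j ≈ 0#
        difference (inj₁ a) (inj₁ a′) = equal (trans a′ (sym a))
        difference (inj₁ a) (inj₂ b′) = equal (trans (nn-sum-zero (0≤width (upperEdge j)) (0≤width H)
          (trans (sym (jump-sum j)) (trans (+-cong a b′) (+-identityʳ _)))) (sym a))
        difference (inj₂ b) (inj₁ a′) = equal
          (trans a′ (sym (nn-sum-zero (0≤width (lowerEdge j)) (0≤width H′)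
          (trans (jump-sum j) (trans (+-cong a′ b) (+-identityʳ _))))))
        difference (inj₂ b) (inj₂ b′) = equal
          (trans (sym (trans (+-congˡ b) (+-identityʳ _)))
            (trans (sym (jump-sum j)) (trans (+-congˡ b′) (+-identityʳ _))))

      jump-at-d : (rays : Rays g (length us)) → ∃[ D ] jump {g′} {g} {d} D < 0#
      jump-at-d rays = D , <-by (0<width A)
        (trans (solve 2 (λ x y → x := :0 :- (y :- x) :+ y) _ (width (at A)) (width G′))
          (trans (+-congˡ (inactive⇒flat (d≉0 rays) G′ (¬active-g′ rays))) (+-identityʳ _)))
        where
        A : Active g d
        A = active-g (d≉0 rays)
        G′ : Edge ⟦ g′ ∞ ⟧ d
        G′ = edge-at g′ d (d≉0 rays)
        D : Jump g′ g d
        D = record { nonzero′ = d≉0 rays ; upperEdge = G′ ; lowerEdge = at A }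

      -- A shared ray is not a ray of h, which makes the jump equal to the width of h′.
      jump-at-shared : Rays g (length us) → Shared v → (j : Jump g′ g v) → 0# ≤ jump j
      jump-at-shared {v} rays S j = ≤-resp refl
        (trans (solve 2 (λ a b → b := a :+ b :- a) _ (width (lowerEdge j)) (width H′))
          (+-congʳ (trans (jump-sum j) (trans
            (+-congˡ (inactive⇒flat (nonzero′ j) H (shared⇒inactive rays S))) (+-identityʳ _)))))
        (0≤width H′)
        where
        H : Edge ⟦ h ∞ ⟧ v
        H = edge-at h v (nonzero′ j)
        H′ : Edge ⟦ h′ ∞ ⟧ v
        H′ = edge-at h′ v (nonzero′ j)

      fewer-impossible : Rays g (length us) → ⊥
      fewer-impossible rays with em {P = ∃[ v ] Shared v}
      ... | yes (v , S) = let (D , D<0) = jump-at-d rays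
                              V = jump-at g′ g v (nonzero (proj₁ S)) in
        unbalanced g′ g D V (λ d~v → shared≁d rays S (SameDirection-sym d~v))
          (λ w j w≁d w≁v → no-jump j w≁d λ T → w≁v (shared-unique rays T S))
          D<0 (jump-at-shared rays S V)
      -- Now d is the only direction with a jump; its opposite, where the jump is zero, stands in
      -- for the second ray.
      ... | no ¬shared = let (D , D<0) = jump-at-d rays
                             V = jump-at g′ g -d -d≉0 in
        unbalanced g′ g D V (λ d~-d → -d≁d (SameDirection-sym d~-d))
          (λ w j w≁d _ → no-jump j w≁d λ T → ¬shared (w , T))
          D<0 (Order.reflexive (sym (no-jump V -d≁d λ T → ¬shared (-d , T))))
        where
        -d : Point 2
        -d = -ᵥ d
        -d≉0 : ¬ (-d ≋ 0ᵥ)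
        -d≉0 e = d≉0 rays λ i → trans (sym (R.-‿involutive _)) (trans (-‿cong (e i)) R.-0#≈0#)
        -d≁d : ¬ SameDirection -d d
        -d≁d (t , 0<t , e) = d≉0 rays (≋0-multiple (+-pos 0<1 (proj₁ 0<t)) λ i →
          trans (solve 2 (λ t x → (:1 :+ t) :* x := x :+ t :* x) _ t (d i))
            (trans (+-congˡ (sym (e i))) (-‿inverseʳ _)))

    not-fewer : ⊥
    not-fewer = cases (gradients⇒actives g us-distinct (All.map gradients-g us-gradients))
      where
      cases : length us ℕ.≤ 1 ⊎ Rays g (length us) → ⊥
      -- A polynomial always has at least one region, so nothing lies below m ≤ 1.
      cases (inj₁ m≤1)  = ℕₚ.<⇒≱ (ℕₚ.≤-trans (ℕ.s≤s (0<mComp g′ comp-g′)) m′<m) m≤1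
      cases (inj₂ rays) = fewer-impossible rays

  -- The canonical representation.

  Ray-scale : ∀ {t} → 0# < t → Ray τ u (τ +ᵥ t • v) → Ray τ u (τ +ᵥ v)
  Ray-scale {τ} {u} {v} {t} 0<t (u≉0 , s , 0≤s , e) = let (i , 0<i , ti≈1) = recip 0<t in
    u≉0 , i * s , *-nonNeg (proj₁ 0<i) 0≤s , λ k → +-congˡ
      (trans (sym (*-identityˡ (v k))) (trans (*-congʳ (sym ti≈1))
      (trans (solve 4 (λ t i v a → t :* i :* v := i :* ((a :+ t :* v) :- a)) _ t i (v k) (τ k))
      (trans (*-congˡ (+-congʳ (e k)))
        (solve 4 (λ i a s u → i :* (a :+ s :* u :- a) := i :* s :* u) _ i (τ k) s (u k))))))

  Ray⇒SameDirection : ¬ (v ≋ 0ᵥ) → Ray τ u (τ +ᵥ v) → SameDirection v u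
  Ray⇒SameDirection {v} {τ} {u} v≉0 (_ , s , 0≤s , e) = s ,
    (0≤s , λ 0≈s → v≉0 λ k → trans (v≋ k) (trans (*-congʳ (sym 0≈s)) (zeroˡ _))) , v≋
    where
    v≋ : v ≋ s • u
    v≋ k = trans (solve 2 (λ a v → v := a :+ v :- a) _ (τ k) (v k))
      (trans (+-congʳ (e k)) (solve 2 (λ a x → a :+ x :- a := x) _ (τ k) (s * u k)))

  module _ {g : TropicalPolynomial 2} {τ : Point 2} {vs : Fan 2} {d : Point 2}
    (fan : EqualsFan (𝒱ʷ ⟦ g ⟧) τ (vs ∷ʳ d)) where
    open EqualsFan fan

    fan-regular : ¬ (p ∈ ∣ vs ∷ʳ d ∣[ τ ]) → Regular ⟦ g ⟧ p
    fan-regular p∉ = regular⇒gradient λ p∈𝒱 → p∉ (proj₁ supports p∈𝒱)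

    fan-singular : p ∈ ∣ vs ∷ʳ d ∣[ τ ] → ¬ Regular ⟦ g ⟧ p
    fan-singular p∈ (_ , gp) = gradient⇒regular gp (proj₂ supports p∈)

    fan-conic : Conic ⟦ g ⟧ τ
    fan-conic v t 0<t regular = fan-regular λ p∈ → fan-singular (Any.map (Ray-scale 0<t) p∈) regular

    fan-gradients : ∀ {u} → Gradient ⟦ g ⟧ u → Gradient ⟦ g ∞ ⟧ u
    fan-gradients {u} (x , gx) = x -ᵥ τ , blow-up g fan-conic
      (Open-resp (gradient-open ⟦ g ⟧ u) (λ i → solve 2 (λ a x → x := a :+ (x :- a)) _ (τ i) (x i)) gx)

    -- If the width in direction d were zero, g ∞ would be linear near d and `recession` would
    -- produce a regular point of g on the ray from τ along d.
    fan-active : ¬ (d ≋ 0ᵥ) → Active g d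
    fan-active d≉0 = active d≉0 E (0≤width E , λ 0≈w →
      let (t , 0<t , gt) = recession {u = b⁺ E} g (gradient 0# (flat⇒linear E (sym 0≈w))) τ in
      fan-singular (Anyₚ.++⁺ʳ vs (here (d≉0 , t , proj₁ 0<t , ≋-refl))) (_ , gt))
      where
      E : Edge ⟦ g ∞ ⟧ d
      E = edge-at g d d≉0

    -- If τ + v were off the fan, it would be a regular point, and by `blow-up` g ∞ would have a
    -- gradient at v, leaving no edge there.
    active⇒fan : Active g v → Any (λ u → τ +ᵥ v ∈ Ray τ u) vs ⊎ SameDirection v d
    active⇒fan {v} A with em {P = τ +ᵥ v ∈ ∣ vs ∷ʳ d ∣[ τ ]}
    ... | no ¬fan = ⊥-elim (proj₂ (0<width A)
      (sym (gradient⇒flat (nonzero A) (at A) (blow-up g fan-conic (proj₂ (fan-regular ¬fan))))))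
    ... | yes on-fan with Anyₚ.++⁻ vs on-fan
    ...   | inj₁ i        = inj₁ i
    ...   | inj₂ (here r) = inj₂ (Ray⇒SameDirection {τ = τ} (nonzero A) r)

  -- A function that is convex and concave near x preserves midpoints. For steps of length t to both
  -- sides of x along e = u₁ - u₂, with the sign of t chosen by the side of n, the mean of the two
  -- values exceeds the value at x by t|e|² / 2, so e vanishes.
  separates⇒¬affine : ∀ {x : Point 2} {u₁ u₂} → Separates φ x u₁ u₂ → LocallyConvex φ x →
    LocallyConcave φ x → ⊥
  separates⇒¬affine {φ} {x} {u₁} {u₂} (u₁≉u₂ , n , a₁ , a₂ , _ , r₁ , 0<r₁ , sides) (r₂ , 0<r₂ , convex)
    (r₃ , 0<r₃ , concave) =
    let (r₁₂ , 0<r₁₂ , r₁₂≤r₁ , r₁₂≤r₂) = lower 0<r₁ 0<r₂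
        (r , 0<r , r≤r₁₂ , r≤r₃) = lower 0<r₁₂ 0<r₃
        (ε , 0<ε , f) = Ball-along x e 0<r
    in u₁≉u₂ (-ᵥ≋0⇒≋ (≋0⇐‖‖² (choose ε 0<ε λ t t²≤ε² →
         Ball-mono x (proj₁ 0<r) (Order.trans r≤r₁₂ r₁₂≤r₁) (x +ᵥ t • e) (f t t²≤ε²) ,
         Ball-mono x (proj₁ 0<r) (Order.trans r≤r₁₂ r₁₂≤r₂) (x +ᵥ t • e) (f t t²≤ε²) ,
         Ball-mono x (proj₁ 0<r) r≤r₃ (x +ᵥ t • e) (f t t²≤ε²))))
    where
    e : Point 2
    e = u₁ -ᵥ u₂
    ℓ₁ ℓ₂ : Affine 2
    ℓ₁ = affine u₁ a₁
    ℓ₂ = affine u₂ a₂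
    All-balls : Point 2 → Set
    All-balls y = y ∈ Ball x r₁ × y ∈ Ball x r₂ × y ∈ Ball x r₃

    along-n : ∀ t → ⟨ n , x +ᵥ t • e -ᵥ x ⟩ ≈ t * ⟨ n , e ⟩
    along-n t = solve 7 (λ n0 n1 x0 x1 e0 e1 t → dot n0 n1 (x0 :+ t :* e0 :- x0)
      (x1 :+ t :* e1 :- x1) := t :* dot n0 n1 e0 e1)
      _ (n 0F) (n 1F) (x 0F) (x 1F) (e 0F) (e 1F) t

    touch : All-balls x → eval ℓ₁ x ≈ eval ℓ₂ x
    touch (x∈ , _) = trans (sym (proj₁ (sides x x∈) (Order.reflexive (sym at-x))))
      (proj₂ (sides x x∈) (Order.reflexive at-x))
      where
      at-x : ⟨ n , x -ᵥ x ⟩ ≈ 0#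
      at-x = solve 4 (λ a b c d → dot a b (c :- c) (d :- d) := :0) _ (n 0F) (n 1F) (x 0F) (x 1F)

    flat-along : ∀ t → ¬ (t ≈ 0#) → 0# ≤ t * ⟨ n , e ⟩ → All-balls (x +ᵥ t • e) → All-balls
      (x +ᵥ (- t) • e) → All-balls x → ⟨ e , e ⟩ ≈ 0#
    flat-along t t≉0 0≤tne (y₁∈ , y₂∈ , y₃∈) (z₁∈ , z₂∈ , z₃∈) x∈ = let (h , 0<h , h+h≈1) =
                                                                          half in midpoint h 0<h h+h≈1
      where
      y′ z′ : Point 2
      y′ = x +ᵥ t • e
      z′ = x +ᵥ (- t) • e
      φy : φ y′ ≈ eval ℓ₁ y′
      φy = proj₁ (sides y′ y₁∈) (≤-resp refl (sym (along-n t)) 0≤tne)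
      φz : φ z′ ≈ eval ℓ₂ z′
      φz = proj₂ (sides z′ z₁∈) (≤-by 0≤tne
        (trans (solve 2 (λ t k → t :* k := :0 :- (:- t) :* k) _ t ⟨ n , e ⟩)
          (+-congˡ (-‿cong (sym (along-n (- t)))))))
      midpoint : ∀ h → 0# < h → h + h ≈ 1# → ⟨ e , e ⟩ ≈ 0#
      midpoint h 0<h h+h≈1 = nz-cancel (λ ht≈0 → t≉0 (nz-cancel (λ h≈0 → proj₂ 0<h (sym h≈0)) ht≈0))
        (trans (*-congˡ (⟨⟩-subˡ u₁ u₂ e))
          (trans (solve 6 (λ h t A B X Y → h :* t :* (A :- B) := h :* (X :+ t :* A) :+ h :*
            (Y :+ (:- t) :* B) :- (h :* X :+ h :* Y)) _ h t ⟨ u₁ , e ⟩ ⟨ u₂ , e ⟩ (eval ℓ₁ x)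
              (eval ℓ₂ x))
          (trans (+-congʳ (trans (+-cong (*-congˡ (sym (trans φy (eval-step ℓ₁ x e t))))
            (*-congˡ (sym (trans φz (eval-step ℓ₂ x e (- t))))))
                   (trans (sym averaged) φM)))
          (trans (+-congˡ (-‿cong (trans (+-congˡ (*-congˡ (sym (touch x∈)))) (collapse (eval ℓ₁ x)))))
            (-‿inverseʳ _)))))
        where
        M : Point 2
        -- The midpoint equals x only up to `≋`, which φ is not assumed to respect; its value is
        -- therefore obtained from `sides`.
        M = h • y′ +ᵥ h • z′
        collapse : ∀ X → h * X + h * X ≈ X
        collapse X = trans (sym (distribʳ X h h)) (trans (*-congʳ h+h≈1) (*-identityˡ X))
        x≋M : x ≋ M
        x≋M i = sym (trans (solve 4 (λ h t x e → h :* (x :+ t :* e) :+ h :* (x :+ (:- t) :* e) :=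
          h :* x :+ h :* x) _ h t (x i) (e i)) (collapse (x i)))
        M∈ : M ∈ Ball x r₁
        M∈ = Ball-resp 0<r₁ x≋M
        φM : φ M ≈ eval ℓ₁ x
        φM = trans (proj₁ (sides M M∈) (Order.reflexive
          (sym (trans (⟨⟩-congʳ n λ i → trans (+-congˡ (-‿cong (x≋M i))) (-‿inverseʳ _))
            (solve 2 (λ a b → dot a b :0 :0 := :0) _ (n 0F) (n 1F))))))
          (eval-cong ℓ₁ (≋-sym x≋M))
        averaged : φ M ≈ h * φ y′ + h * φ z′
        averaged = Order.antisym (convex y′ z′ h h y₂∈ z₂∈ (proj₁ 0<h) (proj₁ 0<h) h+h≈1)
          (≤-by (diff≥0 (concave y′ z′ h h y₃∈ z₃∈ (proj₁ 0<h) (proj₁ 0<h) h+h≈1))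
            (solve 4 (λ h Y Z m → h :* (:- Y) :+ h :* (:- Z) :- (:- m) := m :- (h :* Y :+ h :* Z)) _ h
              (φ y′) (φ z′) (φ M)))

    choose : ∀ ε → 0# < ε → (∀ t → t * t ≤ ε * ε → All-balls (x +ᵥ t • e)) → ⟨ e , e ⟩ ≈ 0#
    choose ε 0<ε balls with Order.total 0# ⟨ n , e ⟩
    ... | inj₁ 0≤ne = flat-along ε (λ ε≈0 → proj₂ 0<ε (sym ε≈0)) (*-nonNeg (proj₁ 0<ε) 0≤ne)
      (balls ε Order.refl) (balls (- ε) flip) centre
      where
      flip : - ε * - ε ≤ ε * ε
      flip = Order.reflexive (solve 1 (λ ε → (:- ε) :* (:- ε) := ε :* ε) _ ε)
      centre : All-balls x
      centre = center x 0<r₁ , center x 0<r₂ , center x 0<r₃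
    ... | inj₂ ne≤0 = flat-along (- ε)
      (λ -ε≈0 → proj₂ 0<ε (trans (sym R.-0#≈0#) (trans (-‿cong (sym -ε≈0)) (R.-‿involutive ε))))
        (≤-resp refl (solve 2 (λ ε k → ε :* (:0 :- k) := (:- ε) :* k) _ ε ⟨ n , e ⟩)
          (*-nonNeg (proj₁ 0<ε) (diff≥0 ne≤0)))
        (balls (- ε) (Order.reflexive (solve 1 (λ ε → (:- ε) :* (:- ε) := ε :* ε) _ ε)))
        (balls (- - ε) (Order.reflexive (solve 1 (λ ε → (:- (:- ε)) :* (:- (:- ε)) := ε :* ε) _ ε)))
          (center x 0<r₁ , center x 0<r₂ , center x 0<r₃)

  0≤-⇒≯0 : 0# ≤ - x → ¬ (0# < x)
  0≤-⇒≯0 {x} 0≤-x 0<x = 0<+⇒ 0<x 0≤-x (-‿inverseʳ x)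

  -- Norms are nonnegative, so the signs of the two weights force local convexity on the one hand
  -- and local concavity on the other.
  ¬𝒱₊∩𝒱₋ : ∀ {x : Point 2} {w w′} → 0# < w → Weight φ x w → 0# < w′ → Weight φ x (- w′) → ⊥
  ¬𝒱₊∩𝒱₋ 0<w (_ , _ , _ , inj₂ (_ , 0≤-w , _)) _ _ = 0≤-⇒≯0 0≤-w 0<w
  ¬𝒱₊∩𝒱₋ _ _ 0<w′ (_ , _ , _ , inj₁ (_ , 0≤-w′ , _)) = 0≤-⇒≯0 0≤-w′ 0<w′
  ¬𝒱₊∩𝒱₋ {φ} {x} _ (u₁ , u₂ , separates , inj₁ (convex , _)) _ (_ , _ , _ , inj₂ (concave , _)) =
    separates⇒¬affine {φ} {x} {u₁} {u₂} separates convex concave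

  canonical-pair : ∀ {g h} (C : Canonical φ τ g h) → ConicPair g h (balancing (Canonical.vs C))
  canonical-pair {φ} {τ} {g} {h} C = record
    { gradients-g = fan-gradients {g} {τ} {vs} numerator ; gradients-h =
      fan-gradients {h} {τ} {us} denominator
    ; common = λ A B → separate A (active⇒fan numerator A) (active⇒fan denominator B)
    ; active-g = fan-active numerator ; active-h = fan-active denominator }
    where
    open Canonical C
    module P = EqualsFan (HasRays.equalsFan 𝒱₊-rays)
    module N = EqualsFan (HasRays.equalsFan 𝒱₋-rays)
    separate : ∀ {v} → Active g v → Any (λ u → τ +ᵥ v ∈ Ray τ u) vs ⊎ SameDirection v (balancing vs) →
      Any (λ u → τ +ᵥ v ∈ Ray τ u) us ⊎ SameDirection v (balancing vs) → SameDirection v (balancing vs)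
    separate _ (inj₂ v~d) _ = v~d
    separate _ (inj₁ _) (inj₂ v~d) = v~d
    -- Here the common ray comes from both 𝒱₊ and 𝒱₋, whose weights at the same point contradict
    -- each other.
    separate {v} A (inj₁ i) (inj₁ j) =
      let (_ , _ , 0<w , weight) = P.weights (τ +ᵥ v) (proj₂ P.supports i) off-apex
          (_ , _ , 0<w′ , weight′) = N.weights (τ +ᵥ v) (proj₂ N.supports j) off-apex
      in ⊥-elim (¬𝒱₊∩𝒱₋ {φ} {τ +ᵥ v} 0<w weight 0<w′ weight′)
      where
      off-apex : ¬ (τ +ᵥ v ≋ τ)
      off-apex e = nonzero A λ k → trans (solve 2 (λ a v → v := a :+ v :- a) _ (τ k) (v k))
        (trans (+-congʳ (e k)) (-‿inverseʳ _))

  canonical-minimal : ∀ {g h} → Canonical φ τ g h → Minimal φ g h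
  canonical-minimal {φ} {τ} {g} {h} C =
    let (us , us-distinct , us-gradients , comp-g) = components g
        (ws , ws-distinct , ws-gradients , comp-h) = components h
    in record
    { represents = represents
    ; m = length us
    ; n = length ws
    ; mComp-g = comp-g
    ; mComp-h = comp-h
    ; minimal = λ
      { g′ h′ rep m′ n′ comp-g′ comp-h′ m′≤m n′≤n (inj₁ m′<m) →
          not-fewer pair g′ h′ (identity g′ h′ rep) us-distinct us-gradients ws-distinct ws-gradients comp-g′ comp-h′ m′<m n′≤n
      -- Exchanging numerators and denominators represents -φ, and the identity of recession
      -- functions turns into the one needed for h and h′.
      ; g′ h′ rep m′ n′ comp-g′ comp-h′ m′≤m n′≤n (inj₂ n′<n) →
          not-fewer (swap-pair pair) h′ g′
            (λ x → trans (+-comm _ _) (trans (sym (identity g′ h′ rep x)) (+-comm _ _)))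
            ws-distinct ws-gradients us-distinct us-gradients comp-h′ comp-g′ n′<n m′≤m }
    }
    where
    open Canonical C
    pair : ConicPair g h (balancing vs)
    pair = canonical-pair C
    identity : ∀ g′ h′ → Represents φ g′ h′ → ∀ x → ⟦ g ∞ ⟧ x + ⟦ h′ ∞ ⟧ x ≈ ⟦ g′ ∞ ⟧ x + ⟦ h ∞ ⟧ x
    identity g′ h′ rep = recession-identity g h g′ h′ λ x → trans (sym (represents x)) (rep x)

proposition1 : (∀ {ℓ} → ExcludedMiddle ℓ) →
    (ℝ : CompleteOrderedField) →
    let open PiecewiseLinear ℝ in
    ∀ (φ : Fun 2) (τ : Point 2) → ConewiseLinear φ τ →
    ∀ (g h : TropicalPolynomial 2) → Canonical φ τ g h → Minimal φ g h
proposition1 em ℝ φ τ _ g h canonical = canonical-minimal em ℝ canonical
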